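{- Let $Q(x,y)=ax^2+bxy+cy^2$ with $a,b,c\in\mathbb{Z}$ be a primitive positive-definite binary quadratic form. Then the proper representation counting function $r_Q^+:\mathbb{Z}_{\ge0}\to\mathbb{Z}_{\ge0}$ is surjective.
   Context: $Q$ is primitive if $\gcd(a,b,c)=1$, and positive-definite if $Q(x,y)>0$ for all $(x,y)\in\mathbb{Z}^2\setminus\{(0,0)\}$. $\mathrm{Aut}(Q)$ is the group of matrices $\begin{pmatrix}p&q\\ r&s\end{pmatrix}\in\mathrm{GL}_2(\mathbb{Z})$ with $Q(px+qy,rx+sy)=Q(x,y)$ for all $x,y\in\mathbb{Z}$, and $\mathrm{Aut}^+(Q)=\mathrm{Aut}(Q)\cap\mathrm{SL}_2(\mathbb{Z})$ (proper automorphisms). For $n\in\mathbb{Z}_{\ge0}$, $r_Q^+(n)$ is the number of representations of $n$ by $Q$ up to proper automorphism, i.e. the number of orbits of $\mathrm{Aut}^+(Q)$ acting on $\{(x,y)\in\mathbb{Z}^2: Q(x,y)=n\}$. -}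

module Defs where

open import Data.Nat as ℕ using (ℕ)
open import Data.Nat.GCD using (gcd)
open import Data.Integer using (ℤ; +_; _+_; _*_; _-_; _<_; ∣_∣)
open import Data.Fin using (Fin)
open import Data.Product using (Σ; ∃; _×_; _,_)
open import Relation.Binary.PropositionalEquality using (_≡_)
open import Relation.Nullary using (¬_)

record BQF : Set where
  constructor form
  field
    a b c : ℤ

evalQ : BQF → ℤ → ℤ → ℤ
evalQ (form a b c) x y = a * (x * x) + b * (x * y) + c * (y * y)

Primitive : BQF → Set
Primitive (form a b c) = gcd (gcd ∣ a ∣ ∣ b ∣) ∣ c ∣ ≡ 1

PositiveDefinite : BQF → Set
PositiveDefinite Q = ∀ (x y : ℤ) → ¬ (x ≡ + 0 × y ≡ + 0) → + 0 < evalQ Q x y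

record Mat2 : Set where
  constructor mat
  field
    p q r s : ℤ

det : Mat2 → ℤ
det (mat p q r s) = p * s - q * r

act : Mat2 → ℤ × ℤ → ℤ × ℤ
act (mat p q r s) (x , y) = (p * x + q * y , r * x + s * y)

IsProperAut : BQF → Mat2 → Set
IsProperAut Q g@(mat p q r s) =
  det g ≡ + 1 × (∀ (x y : ℤ) → evalQ Q (p * x + q * y) (r * x + s * y) ≡ evalQ Q x y)

IsRep : BQF → ℕ → ℤ × ℤ → Set
IsRep Q n (x , y) = evalQ Q x y ≡ + n

SameOrbit : BQF → ℤ × ℤ → ℤ × ℤ → Set
SameOrbit Q v w = Σ Mat2 λ g → IsProperAut Q g × act g v ≡ w

-- r_Q^+(n) = k : the Aut⁺(Q)-orbits on {v : Q(v) = n} are exactly k in number,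
-- i.e. there is a complete system of k pairwise inequivalent orbit representatives.
RepCountPlus : BQF → ℕ → ℕ → Set
RepCountPlus Q n k =
  Σ (Fin k → ℤ × ℤ) λ rep →
    (∀ i → IsRep Q n (rep i)) ×
    (∀ i j → SameOrbit Q (rep i) (rep j) → i ≡ j) ×
    (∀ v → IsRep Q n v → ∃ λ i → SameOrbit Q (rep i) v)

{-# OPTIONS --safe #-}

-- Vectors v and w of value n > 0 lie in one proper orbit iff n ∣ det (v , w). Let P be a split prime and s the least exponent
-- for which the order of discriminant D contains an element of norm P²ˢ not divisible by P; Thue's lemma and the pigeonhole
-- principle give one. Let v have value n = n′ Pᴹ, P ∤ n′, P ∤ v. If n′ ∣ det (v , w) for all w of value n, then the orbits on
-- the value n correspond to the multiples of s in [0 , M], so there are k + 1 of them when k s ≤ M < (k + 1) s. Multiplying v by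
-- elements of norm a power of P brings M into this window up to the parity of M / s, and that parity is changed by bisection:
-- when w also has value n, the primitive vector u along v + w has a value dividing D n. If n′ ∤ det (v , w) for some w, then
-- either w is divisible by a prime ℓ ∣ n′ with ℓ ∤ D or the value of u is prime to such an ℓ, and one descends on the part of n
-- prime to P D.
--
-- The primes dividing D cause no obstruction if D is fundamental. In general, the values divisible by ℓ² of a form of
-- discriminant ℓ² D′ are ℓ² times those of a form of discriminant D′, with the same orbits unless D′ = -3 or -4. In the last two
-- cases one works with values prime to ℓ only, which v + w or v - w preserves.
module Submission where

open import Defs
open import Data.Empty using (⊥; ⊥-elim)
open import Data.Fin as Fin using (Fin; toℕ)
import Data.Fin.Properties as Finₚ
open import Data.Integer using (ℤ; +_; -[1+_]; _+_; _*_; _-_; -_; _^_; _<_) renaming (∣_∣ to abs)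
import Data.Integer as ℤ
open import Data.Integer.Divisibility.Signed
open import Data.Integer.DivMod using (n%ℕd<d; a≡a%ℕn+[a/ℕn]*n)
import Data.Integer.Properties as ℤₚ
open import Data.Integer.Tactic.RingSolver
open import Data.List using (_∷_; [])
import Data.List.Relation.Unary.All as All
open import Data.Nat as ℕ using (ℕ; zero; suc; NonZero; z≤n; s≤s; _!)
import Data.Nat.Divisibility as ℕ∣
open import Data.Nat.GCD as ℕGCD using (module Bézout; module GCD)
open import Data.Nat.Induction using (<-rec)
open import Data.Nat.Primality
  using (Prime; prime?; prime[2]; euclidsLemma; prime⇒irreducible; prime⇒nonZero; prime⇒nonTrivial; ¬prime[0]; ¬prime[1])
open import Data.Nat.Primality.Factorisation using (factorise)
import Data.Nat.Properties as ℕₚ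
open import Data.Nat.Tactic.RingSolver using () renaming (solve-∀ to solveℕ-∀)
open import Data.Product using (∃; ∃₂; _×_; _,_; proj₁; proj₂)
open import Data.Sum using (_⊎_; inj₁; inj₂; [_,_]′)
open import Data.Unit using (⊤; tt)
open import Relation.Binary.Definitions using (tri<; tri≈; tri>)
open import Relation.Binary.PropositionalEquality
open import Relation.Nullary using (¬_; Dec; yes; no; contradiction)
open import Relation.Nullary.Decidable using (map′; _×-dec_; _⊎-dec_; ¬?; from-no)
open import Relation.Unary using (Decidable)

-- Integer arithmetic

-- Two vectors v, w of one value n differ by a number λ of norm 1 in the quadratic field, and share
-- an orbit iff λ is a unit of the order. Once the primes of n′ are barred from the denominator of
-- λ, only a power P^z remains there, and P^z λ is an element of norm P^2z. Hence only even
-- exponents matter. The obstacle is to bring M into the window. Elements of norm P^2z turn M into M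
-- + 2 z or 2 z - M, so ± M modulo 2 s does not change, and M = 0 never becomes M = s. But the 2s-th
-- power of a prime ideal above P is principal, so its s-th power lies in an ambiguous class. In
-- passing to the primitive part of v + w, new primes come only from D. This is why the part of n
-- prime to P D can measure the descent.

ringlc : ∀ {L R A B} c → A ≡ B → L - R ≡ c * (A - B) → L ≡ R
ringlc {L} {R} {A} c refl e = ℤₚ.i-j≡0⇒i≡j L R (trans e (vanish c A))
  where
  vanish : ∀ c A → c * (A - A) ≡ + 0
  vanish = solve-∀

-- The ring solver settles identities only. An equation that follows from others becomes an identity
-- through a certificate: the difference of its sides is an explicit combination of the differences
-- of the sides of the hypotheses.
ringlc₂ : ∀ {L R A B A′ B′} c d → A ≡ B → A′ ≡ B′ → L - R ≡ c * (A - B) + d * (A′ - B′) → L ≡ R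
ringlc₂ {L} {R} {A} {A′ = A′} c d refl refl e = ℤₚ.i-j≡0⇒i≡j L R (trans e (vanish c d A A′))
  where
  vanish : ∀ c d A B → c * (A - A) + d * (B - B) ≡ + 0
  vanish = solve-∀

ringlc₃ : ∀ {L R A B A′ B′ A″ B″} c d f → A ≡ B → A′ ≡ B′ → A″ ≡ B″ →
  L - R ≡ c * (A - B) + d * (A′ - B′) + f * (A″ - B″) → L ≡ R
ringlc₃ {L} {R} {A} {A′ = A′} {A″ = A″} c d f refl refl refl e = ℤₚ.i-j≡0⇒i≡j L R (trans e (vanish c d f A A′ A″))
  where
  vanish : ∀ c d f A B C → c * (A - A) + d * (B - B) + f * (C - C) ≡ + 0
  vanish = solve-∀

cancelˡ : ∀ k {x y} → ¬ k ≡ + 0 → k * x ≡ k * y → x ≡ y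
cancelˡ k {x} {y} k≢0 = ℤₚ.*-cancelˡ-≡ k x y {{ℤ.≢-nonZero k≢0}}

*≢0 : ∀ {x y} → ¬ x ≡ + 0 → ¬ y ≡ + 0 → ¬ x * y ≡ + 0
*≢0 {x} x≢0 y≢0 e = [ x≢0 , y≢0 ]′ (ℤₚ.i*j≡0⇒i≡0∨j≡0 x e)

∣-cancelˡ : ∀ k {x y} → ¬ k ≡ + 0 → k * x ∣ k * y → x ∣ y
∣-cancelˡ k {x} {y} k≢0 (divides q e) =
  divides q (cancelˡ k k≢0 (ringlc (+ 1) e (solve (q ∷ k ∷ x ∷ y ∷ []))))

record Bezout (x y : ℤ) : Set where
  constructor bez
  field
    g x₁ y₁ r s : ℤ
    x≡ : x ≡ g * x₁
    y≡ : y ≡ g * y₁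
    comb : x * s - y * r ≡ g

sgn : ∀ x → ∃ λ ε → x ≡ ε * + abs x × + abs x ≡ ε * x
sgn (+ n) = + 1 , sym (ℤₚ.*-identityˡ _) , sym (ℤₚ.*-identityˡ _)
sgn -[1+ n ] = -[1+ 0 ] , sym (ℤₚ.-1*i≡-i (+ suc n)) , sym (ℤₚ.-1*i≡-i -[1+ n ])

private
  factor : ∀ η X D Q z → z ≡ η * X → X ≡ Q * D → z ≡ D * (η * Q)
  factor η X D Q z refl refl = solve (η ∷ Q ∷ D ∷ [])

  combine : ∀ x y ε δ D m n X Y → X ≡ ε * x → Y ≡ δ * y → D + n * Y ≡ m * X → x * (ε * m) - y * (δ * n) ≡ D
  combine x y ε δ D m n X Y refl refl e = ringlc (- + 1) e (solve (x ∷ y ∷ ε ∷ δ ∷ m ∷ n ∷ D ∷ []))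

  combine′ : ∀ x y ε δ D m n X Y → X ≡ ε * x → Y ≡ δ * y → D + m * X ≡ n * Y → x * (- (ε * m)) - y * (- (δ * n)) ≡ D
  combine′ x y ε δ D m n X Y refl refl e = ringlc (- + 1) e (solve (x ∷ y ∷ ε ∷ δ ∷ m ∷ n ∷ D ∷ []))

  pos-≡ : ∀ {a} b c → a ≡ b ℕ.* c → + a ≡ + b * + c
  pos-≡ b c e = trans (cong +_ e) (ℤₚ.pos-* b c)

  pos-lift : ∀ {d} a b c f → d ℕ.+ a ℕ.* b ≡ c ℕ.* f → + d + + a * + b ≡ + c * + f
  pos-lift {d} a b c f e = trans (cong (ℤ._+_ (+ d)) (sym (ℤₚ.pos-* a b))) (trans (sym (ℤₚ.pos-+ d (a ℕ.* b))) (pos-≡ c f e))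

bezout : ∀ x y → Bezout x y
bezout x y with sgn x | sgn y | Bézout.lemma (abs x) (abs y)
... | ε , ex , ex′ | δ , ey , ey′ | Bézout.result d gcd id
  with GCD.gcd∣m gcd | GCD.gcd∣n gcd | id
... | ℕ∣.divides q₁ e₁ | ℕ∣.divides q₂ e₂ | Bézout.Identity.+- m n e =
  bez (+ d) (ε * + q₁) (δ * + q₂) (δ * + n) (ε * + m)
    (factor ε _ (+ d) (+ q₁) _ ex (pos-≡ q₁ d e₁)) (factor δ _ (+ d) (+ q₂) _ ey (pos-≡ q₂ d e₂))
    (combine x y ε δ (+ d) (+ m) (+ n) _ _ ex′ ey′ (pos-lift n (abs y) m (abs x) e))
... | ℕ∣.divides q₁ e₁ | ℕ∣.divides q₂ e₂ | Bézout.Identity.-+ m n e =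
  bez (+ d) (ε * + q₁) (δ * + q₂) (- (δ * + n)) (- (ε * + m))
    (factor ε _ (+ d) (+ q₁) _ ex (pos-≡ q₁ d e₁)) (factor δ _ (+ d) (+ q₂) _ ey (pos-≡ q₂ d e₂))
    (combine′ x y ε δ (+ d) (+ m) (+ n) _ _ ex′ ey′ (pos-lift m (abs x) n (abs y) e))

data IsPrime : ℤ → Set where
  isPrime : ∀ {p} → Prime p → IsPrime (+ p)

euclid : ∀ {P} → IsPrime P → ∀ x y → P ∣ x * y → P ∣ x ⊎ P ∣ y
euclid (isPrime {p} pr) x y d
  with euclidsLemma (abs x) (abs y) pr (subst (p ℕ∣.∣_) (ℤₚ.abs-* x y) (∣⇒∣ᵤ d))
... | inj₁ e = inj₁ (∣ᵤ⇒∣ e)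
... | inj₂ e = inj₂ (∣ᵤ⇒∣ e)

euclid′ : ∀ {P} → IsPrime P → ∀ {x} → ¬ P ∣ x → ∀ y → P ∣ x * y → P ∣ y
euclid′ pr {x} ndx y d with euclid pr x y d
... | inj₁ dx = contradiction dx ndx
... | inj₂ dy = dy

euclid-sq : ∀ {P} → IsPrime P → ∀ x → P ∣ x * x → P ∣ x
euclid-sq pr x d = [ (λ e → e) , (λ e → e) ]′ (euclid pr x x d)

prime∤1 : ∀ {P} → IsPrime P → ¬ P ∣ + 1
prime∤1 (isPrime {p} pr) d with ℕ∣.∣1⇒≡1 (∣⇒∣ᵤ d)
... | refl = ¬prime[1] pr

prime≢0 : ∀ {P} → IsPrime P → ¬ P ≡ + 0
prime≢0 (isPrime pr) refl = ¬prime[0] pr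

prime-∣-prime : ∀ {P L} → IsPrime P → IsPrime L → L ∣ P → L ≡ P
prime-∣-prime (isPrime pp) (isPrime pl) d with prime⇒irreducible pp (∣⇒∣ᵤ d)
... | inj₁ refl = contradiction pl ¬prime[1]
... | inj₂ refl = refl

prime-∣-^ : ∀ {P L} → IsPrime L → ∀ n → L ∣ P ^ n → L ∣ P
prime-∣-^ pl zero d = contradiction d (prime∤1 pl)
prime-∣-^ {P} pl (suc n) d with euclid pl P (P ^ n) d
... | inj₁ e = e
... | inj₂ e = prime-∣-^ pl n e

^≢0 : ∀ {P} → ¬ P ≡ + 0 → ∀ n → ¬ P ^ n ≡ + 0
^≢0 ne zero ()
^≢0 ne (suc n) = *≢0 ne (^≢0 ne n)

^-∣-cancel : ∀ {P} → IsPrime P → ∀ {x} → ¬ P ∣ x → ∀ n y → P ^ n ∣ x * y → P ^ n ∣ y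
^-∣-cancel pr ndx zero y d = divides y (sym (ℤₚ.*-identityʳ y))
^-∣-cancel {P} pr {x} ndx (suc n) y d
  with euclid′ pr ndx y (∣-trans (divides (P ^ n) (ℤₚ.*-comm P (P ^ n))) d)
... | divides q refl = shift (^-∣-cancel pr ndx n q (∣-cancelˡ P (prime≢0 pr) (subst (P * P ^ n ∣_) (swap x q P) d)))
  where
  swap : ∀ x q P → x * (q * P) ≡ P * (x * q)
  swap = solve-∀
  shift : ∀ {A} → A ∣ q → P * A ∣ q * P
  shift {A} (divides k refl) = divides k (solve (k ∷ A ∷ P ∷ []))

^-+ : ∀ P m n → P ^ (m ℕ.+ n) ≡ P ^ m * P ^ n
^-+ P m n = ℤₚ.^-distribˡ-+-* P m n

unit-or-prime-divisor : ∀ r → r ∣ + 1 ⊎ ∃ λ L → IsPrime L × L ∣ r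
unit-or-prime-divisor r = go (abs r) refl
  where
  go : ∀ n → abs r ≡ n → r ∣ + 1 ⊎ ∃ λ L → IsPrime L × L ∣ r
  go zero e = inj₂ (+ 2 , isPrime prime[2] , divides (+ 0) (ℤₚ.∣i∣≡0⇒i≡0 e))
  go (suc n) e with factorise (suc n)
  ... | record { factors = [] ; isFactorisation = f } = inj₁ (∣ᵤ⇒∣ (ℕ∣.∣-reflexive (trans e f)))
  ... | record { factors = p ∷ ps ; isFactorisation = f ; factorsPrime = pp All.∷ _ } =
    inj₂ (+ p , isPrime pp , ∣ᵤ⇒∣ (subst (p ℕ∣.∣_) (sym (trans e f)) (ℕ∣.m∣m*n _)))

^-double : ∀ P x y → P ^ ((x ℕ.+ y) ℕ.+ (x ℕ.+ y)) ≡ P ^ (x ℕ.+ x) * P ^ (y ℕ.+ y)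
^-double P x y = trans (cong (P ^_) (lem x y)) (^-+ P (x ℕ.+ x) (y ℕ.+ y))
  where
  lem : ∀ x y → (x ℕ.+ y) ℕ.+ (x ℕ.+ y) ≡ (x ℕ.+ x) ℕ.+ (y ℕ.+ y)
  lem = solveℕ-∀

-- The completing vector (r , s) is kept because it is the second vector of the new basis in
-- `changeBasis`.
Unimodular : ℤ → ℤ → Set
Unimodular x y = ∃₂ λ r s → x * s - y * r ≡ + 1

private
  scale : ∀ x y q r s g → x * s - y * r ≡ g → + 1 ≡ q * g → x * (q * s) - y * (q * r) ≡ + 1
  scale x y q r s g e f = ringlc₂ q (- + 1) e f (solve (x ∷ y ∷ q ∷ r ∷ s ∷ g ∷ []))

noCommonPrime⇒unimodular : ∀ x y → (∀ {L} → IsPrime L → L ∣ x → L ∣ y → ⊥) → Unimodular x y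
noCommonPrime⇒unimodular x y np with bezout x y
... | bez g x₁ y₁ r s ex ey cb with unit-or-prime-divisor g
...   | inj₁ (divides q e) = q * r , q * s , scale x y q r s g cb e
...   | inj₂ (L , pL , d) = ⊥-elim
  (np pL (∣-trans d (divides x₁ (trans ex (ℤₚ.*-comm g x₁)))) (∣-trans d (divides y₁ (trans ey (ℤₚ.*-comm g y₁)))))

unimodular⇒noCommonPrime : ∀ {x y} → Unimodular x y → ∀ {L} → IsPrime L → L ∣ x → L ∣ y → ⊥
unimodular⇒noCommonPrime {x} {y} (r , s , e) pL dx dy =
  prime∤1 pL (subst (_ ∣_) e (∣m∣n⇒∣m-n (∣m⇒∣m*n s dx) (∣m⇒∣m*n r dy)))

record PrimitivePart (x y : ℤ) : Set where
  constructor primPart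
  field
    c x₁ y₁ : ℤ
    c≢0 : ¬ c ≡ + 0
    x≡ : x ≡ c * x₁
    y≡ : y ≡ c * y₁
    unimodular : Unimodular x₁ y₁

primitivePart : ∀ x y → ¬ (x ≡ + 0 × y ≡ + 0) → PrimitivePart x y
primitivePart x y ne with bezout x y
... | bez g x₁ y₁ r s ex ey cb = primPart g x₁ y₁ g≢0 ex ey (r , s , cancelˡ g g≢0 E)
  where
  g≢0 : ¬ g ≡ + 0
  g≢0 refl = ne (trans ex (ℤₚ.*-zeroˡ x₁) , trans ey (ℤₚ.*-zeroˡ y₁))
  E : g * (x₁ * s - y₁ * r) ≡ g * + 1
  E = ringlc₃ (+ 1) (- s) r cb ex ey (solve (g ∷ x₁ ∷ y₁ ∷ r ∷ s ∷ x ∷ y ∷ []))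

private
  factor-gcd : ∀ g h m r s n H → H * s - n * r ≡ g → H ≡ g * h → n ≡ g * m → g * (h * s - m * r) ≡ g * + 1
  factor-gcd g h m r s n H cb eh em = ringlc₃ (+ 1) (- s) r cb eh em (solve (g ∷ h ∷ m ∷ r ∷ s ∷ n ∷ H ∷ []))

  factor-gcd² : ∀ g h m β k n H → H ≡ g * h → n ≡ g * m → H * H + n * β * H ≡ n * n * k →
    (g * g) * (h * h + m * β * h) ≡ (g * g) * (m * m * k)
  factor-gcd² g h m β k n H refl refl e = ringlc (+ 1) e (solve (g ∷ h ∷ m ∷ k ∷ β ∷ []))

  root-quotient : ∀ g h m r s β k → h * s - m * r ≡ + 1 → h * h + m * β * h ≡ m * m * k →
    g * h ≡ (m * k * s - β * h * s - h * r) * (g * m)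
  root-quotient g h m r s β k e f = ringlc₂ (- (g * h)) (g * s) e f (solve (g ∷ h ∷ m ∷ r ∷ s ∷ k ∷ β ∷ []))

-- A rational root H / n of a monic quadratic polynomial is integral.
monic-root-∣ : ∀ n H β k → H * H + n * β * H ≡ n * n * k → n ∣ H
monic-root-∣ n H β k e with bezout H n
... | bez g h m r s eh em cb with g ℤ.≟ + 0
...   | yes refl = divides (+ 0) (trans eh (trans (ℤₚ.*-zeroˡ h) (sym (ℤₚ.*-zeroˡ n))))
...   | no g≢0 = divides (m * k * s - β * h * s - h * r)
  (trans eh (trans (root-quotient g h m r s β k (cancelˡ g g≢0 (factor-gcd g h m r s n H cb eh em))
      (cancelˡ (g * g) (*≢0 g≢0 g≢0) (factor-gcd² g h m β k n H eh em e)))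
    (cong ((m * k * s - β * h * s - h * r) *_) (sym em))))

private
  rearrange : ∀ x P r s → x * s - P * r ≡ + 1 → x * s ≡ + 1 + P * r
  rearrange x P r s e = ringlc (+ 1) e (solve (x ∷ P ∷ r ∷ s ∷ []))

inverse-mod : ∀ {P x} → IsPrime P → ¬ P ∣ x → ∃₂ λ y k → x * y ≡ + 1 + P * k
inverse-mod {P} {x} pP nd with noCommonPrime⇒unimodular x P np
  where
  np : ∀ {L} → IsPrime L → L ∣ x → L ∣ P → ⊥
  np pL dx dP with prime-∣-prime pP pL dP
  ... | refl = nd dx
... | r , s , e = s , r , rearrange x P r s e

base∣^ : ∀ P {n} → 1 ℕ.≤ n → P ∣ P ^ n
base∣^ P {suc n} _ = divides (P ^ n) (ℤₚ.*-comm P (P ^ n))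

-- Forms, proper orbits and change of basis

val : ℤ → ℤ → ℤ → ℤ → ℤ → ℤ
val a b c x y = a * (x * x) + b * (x * y) + c * (y * y)

val₁₀ : ∀ a b c → a * (+ 1 * + 1) + b * (+ 1 * + 0) + c * (+ 0 * + 0) ≡ a
val₁₀ = solve-∀

val₀₀ : ∀ a b c → a * (+ 0 * + 0) + b * (+ 0 * + 0) + c * (+ 0 * + 0) ≡ + 0
val₀₀ = solve-∀

det-swap : ∀ x y x′ y′ → - (x * y′ - x′ * y) ≡ x′ * y - x * y′
det-swap = solve-∀

-- This is multiplication by the unit h + u ω of the order ℤ[ω], ω² = b ω - a c, on the lattice a ℤ
-- + ω ℤ, where a x + ω y has norm a times the value of (x , y).
record Rotation (a b c x y x′ y′ : ℤ) : Set where
  constructor rotation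
  field
    h u : ℤ
    norm : h * h + b * h * u + a * c * u * u ≡ + 1
    x′≡ : x′ ≡ h * x + (- (c * u)) * y
    y′≡ : y′ ≡ a * u * x + (h + b * u) * y

private
  composition : ∀ a b c x y x′ y′ n u → a * (x * x) + b * (x * y) + c * (y * y) ≡ n →
    a * (x′ * x′) + b * (x′ * y′) + c * (y′ * y′) ≡ n → x * y′ - x′ * y ≡ u * n →
    (a * x * x′ + b * x′ * y + c * y * y′) * (a * x * x′ + b * x′ * y + c * y * y′)
      + n * (b * u) * (a * x * x′ + b * x′ * y + c * y * y′) ≡ n * n * (+ 1 - a * c * u * u)
  composition a b c x y x′ y′ n u e f d = lem (a * x * x′ + b * x′ * y + c * y * y′) refl
    where
    N² : (a * x * x′ + b * x′ * y + c * y * y′) * (a * x * x′ + b * x′ * y + c * y * y′)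
      + b * (x * y′ - x′ * y) * (a * x * x′ + b * x′ * y + c * y * y′) + a * c * ((x * y′ - x′ * y) * (x * y′ - x′ * y)) ≡
        (a * (x * x) + b * (x * y) + c * (y * y)) * (a * (x′ * x′) + b * (x′ * y′) + c * (y′ * y′))
    N² = solve (a ∷ b ∷ c ∷ x ∷ y ∷ x′ ∷ y′ ∷ [])
    move : ∀ H → H * H + b * (u * n) * H + a * c * ((u * n) * (u * n)) ≡ n * n →
      H * H + n * (b * u) * H ≡ n * n * (+ 1 - a * c * u * u)
    move H e = ringlc (+ 1) e (solve (H ∷ a ∷ b ∷ c ∷ u ∷ n ∷ []))
    lem : ∀ H → H ≡ a * x * x′ + b * x′ * y + c * y * y′ → H * H + n * (b * u) * H ≡ n * n * (+ 1 - a * c * u * u)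
    lem H refl = move H (trans (cong (λ z → H * H + b * z * H + a * c * (z * z)) (sym d)) (trans N² (cong₂ _*_ e f)))

  norm-one : ∀ a b c n h u H → H ≡ h * n → H * H + n * (b * u) * H ≡ n * n * (+ 1 - a * c * u * u) →
    (n * n) * (h * h + b * h * u + a * c * u * u) ≡ (n * n) * + 1
  norm-one a b c n h u H refl e = ringlc (+ 1) e (solve (a ∷ b ∷ c ∷ n ∷ h ∷ u ∷ []))

  image-x : ∀ a b c x y x′ y′ n h u → a * (x * x) + b * (x * y) + c * (y * y) ≡ n → x * y′ - x′ * y ≡ u * n →
    a * x * x′ + b * x′ * y + c * y * y′ ≡ h * n → n * x′ ≡ n * (h * x + (- (c * u)) * y)
  image-x a b c x y x′ y′ n h u e d f = ringlc₃ (- x′) (- (c * y)) x e d f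
    (solve (a ∷ b ∷ c ∷ x ∷ y ∷ x′ ∷ y′ ∷ n ∷ h ∷ u ∷ []))

  image-y : ∀ a b c x y x′ y′ n h u → a * (x * x) + b * (x * y) + c * (y * y) ≡ n → x * y′ - x′ * y ≡ u * n →
    a * x * x′ + b * x′ * y + c * y * y′ ≡ h * n → n * y′ ≡ n * (a * u * x + (h + b * u) * y)
  image-y a b c x y x′ y′ n h u e d f = ringlc₃ (- y′) (a * x + b * y) y e d f
    (solve (a ∷ b ∷ c ∷ x ∷ y ∷ x′ ∷ y′ ∷ n ∷ h ∷ u ∷ []))

-- Put λ = a x + ω y and λ′ = a x′ + ω y′. Then λ′ / λ = (H + (x y′ - x′ y) ω) / n has norm 1. When
-- n divides the determinant, the coefficient of ω is an integer, so H / n is a rational root of a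
-- monic integral polynomial and is an integer too.
∣det⇒rotation : ∀ a b c n {x y x′ y′} → ¬ n ≡ + 0 → val a b c x y ≡ n → val a b c x′ y′ ≡ n →
  n ∣ x * y′ - x′ * y → Rotation a b c x y x′ y′
∣det⇒rotation a b c n {x} {y} {x′} {y′} n≢0 e f (divides u d) =
  conclude (monic-root-∣ n H (b * u) (+ 1 - a * c * u * u) C)
  where
  H = a * x * x′ + b * x′ * y + c * y * y′
  C : H * H + n * (b * u) * H ≡ n * n * (+ 1 - a * c * u * u)
  C = composition a b c x y x′ y′ n u e f d
  conclude : n ∣ H → Rotation a b c x y x′ y′
  conclude (divides h g) = rotation h u
    (cancelˡ (n * n) (*≢0 n≢0 n≢0) (norm-one a b c n h u H g C))
    (cancelˡ n n≢0 (image-x a b c x y x′ y′ n h u e d g))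
    (cancelˡ n n≢0 (image-y a b c x y x′ y′ n h u e d g))

private
  rotation-val : ∀ a b c h u x y → h * h + b * h * u + a * c * u * u ≡ + 1 →
    a * ((h * x + (- (c * u)) * y) * (h * x + (- (c * u)) * y)) +
    b * ((h * x + (- (c * u)) * y) * (a * u * x + (h + b * u) * y)) +
    c * ((a * u * x + (h + b * u) * y) * (a * u * x + (h + b * u) * y)) ≡
    a * (x * x) + b * (x * y) + c * (y * y)
  rotation-val a b c h u x y e = ringlc (a * (x * x) + b * (x * y) + c * (y * y)) e
    (solve (a ∷ b ∷ c ∷ h ∷ u ∷ x ∷ y ∷ []))

  rotation-det : ∀ a b c h u → h * h + b * h * u + a * c * u * u ≡ + 1 →
    h * (h + b * u) - (- (c * u)) * (a * u) ≡ + 1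
  rotation-det a b c h u e = ringlc (+ 1) e (solve (a ∷ b ∷ c ∷ h ∷ u ∷ []))

rotation⇒SameOrbit : ∀ {a b c x y x′ y′} → Rotation a b c x y x′ y′ → SameOrbit (form a b c) (x , y) (x′ , y′)
rotation⇒SameOrbit {a} {b} {c} (rotation h u N ex ey) =
  mat h (- (c * u)) (a * u) (h + b * u) ,
  (rotation-det a b c h u N , λ x y → rotation-val a b c h u x y N) ,
  cong₂ _,_ (sym ex) (sym ey)

private
  col₁ : ∀ a b c p q r s →
    a * ((p * + 1 + q * + 0) * (p * + 1 + q * + 0)) + b * ((p * + 1 + q * + 0) * (r * + 1 + s * + 0)) + c *
    ((r * + 1 + s * + 0) * (r * + 1 + s * + 0)) ≡ a * (+ 1 * + 1) + b * (+ 1 * + 0) + c * (+ 0 * + 0) →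
    a * p * p + b * p * r + c * r * r ≡ a
  col₁ a b c p q r s e = ringlc (+ 1) e (solve (a ∷ b ∷ c ∷ p ∷ q ∷ r ∷ s ∷ []))

  col₂ : ∀ a b c p q r s →
    a * ((p * + 0 + q * + 1) * (p * + 0 + q * + 1)) + b * ((p * + 0 + q * + 1) * (r * + 0 + s * + 1)) + c *
    ((r * + 0 + s * + 1) * (r * + 0 + s * + 1)) ≡ a * (+ 0 * + 0) + b * (+ 0 * + 1) + c * (+ 1 * + 1) →
    a * q * q + b * q * s + c * s * s ≡ c
  col₂ a b c p q r s e = ringlc (+ 1) e (solve (a ∷ b ∷ c ∷ p ∷ q ∷ r ∷ s ∷ []))

  col₁₂ : ∀ a b c p q r s → a * p * p + b * p * r + c * r * r ≡ a → a * q * q + b * q * s + c * s * s ≡ c →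
    a * ((p * + 1 + q * + 1) * (p * + 1 + q * + 1)) + b * ((p * + 1 + q * + 1) * (r * + 1 + s * + 1)) + c *
      ((r * + 1 + s * + 1) * (r * + 1 + s * + 1)) ≡ a * (+ 1 * + 1) + b * (+ 1 * + 1) + c * (+ 1 * + 1) →
    + 2 * a * p * q + b * (p * s + q * r) + + 2 * c * r * s ≡ b
  col₁₂ a b c p q r s e f g = ringlc₃ (- + 1) (- + 1) (+ 1) e f g (solve (a ∷ b ∷ c ∷ p ∷ q ∷ r ∷ s ∷ []))

  -- For the Gram matrix G with rows (2a , b) and (b , 2c), invariance under g of determinant 1
  -- becomes linear in g: G g is the inverse transpose of g times G. Its entries say that (r , s - p
  -- , - q) is proportional to (a , b , c).
  module Automorph (a b c p q r s : ℤ) (D : p * s - q * r ≡ + 1)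
    (e₁ : a * p * p + b * p * r + c * r * r ≡ a) (e₂ : a * q * q + b * q * s + c * s * s ≡ c)
    (e₁₂ : + 2 * a * p * q + b * (p * s + q * r) + + 2 * c * r * s ≡ b) where
    rel₁ : + 2 * (b * r) ≡ + 2 * (a * (s - p))
    rel₁ = ringlc₃ (+ 2 * s) (- r) (- (+ 2 * a * p + b * r)) e₁ e₁₂ D (solve (a ∷ b ∷ c ∷ p ∷ q ∷ r ∷ s ∷ []))
    rel₂ : + 2 * (a * q) ≡ + 2 * (- (c * r))
    rel₂ = ringlc₃ s (- (+ 2 * r)) (- (+ 2 * a * q + b * s)) e₁₂ e₂ D (solve (a ∷ b ∷ c ∷ p ∷ q ∷ r ∷ s ∷ []))
    rel₃ : + 2 * (c * (s - p)) ≡ + 2 * (- (b * q))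
    rel₃ = ringlc₃ (- q) (+ 2 * p) (- (b * q + + 2 * c * s)) e₁₂ e₂ D (solve (a ∷ b ∷ c ∷ p ∷ q ∷ r ∷ s ∷ []))

  coef-a : ∀ a b c p q r s x y n → b * r ≡ a * (s - p) → a * q ≡ - (c * r) → a * (x * x) + b * (x * y) + c * (y * y) ≡ n →
    a * (x * (r * x + s * y) - (p * x + q * y) * y) ≡ r * n
  coef-a a b c p q r s x y n f g e = ringlc₃ r (- (x * y)) (- (y * y)) e f g
    (solve (a ∷ b ∷ c ∷ p ∷ q ∷ r ∷ s ∷ x ∷ y ∷ n ∷ []))

  coef-b : ∀ a b c p q r s x y n → b * r ≡ a * (s - p) → c * (s - p) ≡ - (b * q) → a * (x * x) + b * (x * y) + c * (y * y) ≡ n →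
    b * (x * (r * x + s * y) - (p * x + q * y) * y) ≡ (s - p) * n
  coef-b a b c p q r s x y n f g e = ringlc₃ (s - p) (x * x) (- (y * y)) e f g
    (solve (a ∷ b ∷ c ∷ p ∷ q ∷ r ∷ s ∷ x ∷ y ∷ n ∷ []))

  coef-c : ∀ a b c p q r s x y n → c * (s - p) ≡ - (b * q) → a * q ≡ - (c * r) → a * (x * x) + b * (x * y) + c * (y * y) ≡ n →
    c * (x * (r * x + s * y) - (p * x + q * y) * y) ≡ - q * n
  coef-c a b c p q r s x y n f g e = ringlc₃ (- q) (x * y) (x * x) e f g (solve (a ∷ b ∷ c ∷ p ∷ q ∷ r ∷ s ∷ x ∷ y ∷ n ∷ []))

primitive-∣ : ∀ a b c n d → Primitive (form a b c) → n ∣ a * d → n ∣ b * d → n ∣ c * d → n ∣ d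
primitive-∣ a b c n d prim da db dc = ∣ᵤ⇒∣
  (subst (abs n ℕ∣.∣_) eq (ℕGCD.gcd-greatest (ℕGCD.gcd-greatest (un a da) (un b db)) (un c dc)))
  where
  un : ∀ z → n ∣ z * d → abs n ℕ∣.∣ abs d ℕ.* abs z
  un z e = subst (abs n ℕ∣.∣_) (trans (ℤₚ.abs-* z d) (ℕₚ.*-comm (abs z) (abs d))) (∣⇒∣ᵤ e)
  eq : ℕGCD.gcd (ℕGCD.gcd (abs d ℕ.* abs a) (abs d ℕ.* abs b)) (abs d ℕ.* abs c) ≡ abs d
  eq = trans (cong (λ z → ℕGCD.gcd z (abs d ℕ.* abs c)) (sym (ℕGCD.c*gcd[m,n]≡gcd[cm,cn] (abs d) (abs a) (abs b))))
    (trans (sym (ℕGCD.c*gcd[m,n]≡gcd[cm,cn] (abs d) _ (abs c))) (trans (cong (abs d ℕ.*_) prim) (ℕₚ.*-identityʳ _)))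

-- Because (r , s - p , - q) is proportional to (a , b , c), each of a, b, c times the determinant
-- of v and g v is n times the matching entry. Primitivity then removes the coefficient.
SameOrbit⇒∣det : ∀ a b c n {x y x′ y′} → Primitive (form a b c) → val a b c x y ≡ n →
  SameOrbit (form a b c) (x , y) (x′ , y′) → n ∣ x * y′ - x′ * y
SameOrbit⇒∣det a b c n {x} {y} prim e (mat p q r s , (D , inv) , refl) =
  primitive-∣ a b c n (x * (r * x + s * y) - (p * x + q * y) * y) prim
    (divides r (coef-a a b c p q r s x y n R₁ R₂ e))
    (divides (s - p) (coef-b a b c p q r s x y n R₁ R₃ e))
    (divides (- q) (coef-c a b c p q r s x y n R₃ R₂ e))
  where
  e₁ = col₁ a b c p q r s (inv (+ 1) (+ 0))
  e₂ = col₂ a b c p q r s (inv (+ 0) (+ 1))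
  open Automorph a b c p q r s D e₁ e₂ (col₁₂ a b c p q r s e₁ e₂ (inv (+ 1) (+ 1)))
  R₁ : b * r ≡ a * (s - p)
  R₁ = cancelˡ (+ 2) (λ ()) rel₁
  R₂ : a * q ≡ - (c * r)
  R₂ = cancelˡ (+ 2) (λ ()) rel₂
  R₃ : c * (s - p) ≡ - (b * q)
  R₃ = cancelˡ (+ 2) (λ ()) rel₃

-- For a primitive form and n ≠ 0, vectors v and w of value n lie in one proper orbit iff n ∣ det (v , w).
record Count (a b c n : ℤ) (k : ℕ) : Set where
  field
    X Y : Fin k → ℤ
    value : ∀ i → val a b c (X i) (Y i) ≡ n
    distinct : ∀ i j → n ∣ X i * Y j - X j * Y i → i ≡ j
    complete : ∀ x y → val a b c x y ≡ n → ∃ λ i → n ∣ X i * y - x * Y i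

Count⇒RepCountPlus : ∀ {a b c k} n → Primitive (form a b c) → ¬ + n ≡ + 0 → Count a b c (+ n) k → RepCountPlus (form a b c) n k
Count⇒RepCountPlus {a} {b} {c} n prim n≢0 C =
  (λ i → X i , Y i) , value ,
  (λ i j o → distinct i j (SameOrbit⇒∣det a b c (+ n) prim (value i) o)) ,
  λ (x , y) e → let (i , d) = complete x y e in
    i , rotation⇒SameOrbit (∣det⇒rotation a b c (+ n) n≢0 (value i) e d)
  where
  open Count C

-- A primitive vector of value n becomes (1 , 0) in a form (n , b′ , c′), where its determinant with
-- (x , y) is simply y. All later moves between vectors are expressed as changes of the form.
record ChangedBasis (a b c x y : ℤ) : Set where
  field
    b′ c′ : ℤ
    disc : + 4 * (val a b c x y * c′) - b′ * b′ ≡ + 4 * (a * c) - b * b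
    count : ∀ {n k} → Count (val a b c x y) b′ c′ n k → Count a b c n k

private
  change-val : ∀ a b c x y r s X Y →
    a * ((X * x + Y * r) * (X * x + Y * r)) + b * ((X * x + Y * r) * (X * y + Y * s)) + c *
      ((X * y + Y * s) * (X * y + Y * s)) ≡
    (a * (x * x) + b * (x * y) + c * (y * y)) * (X * X) + (+ 2 * a * x * r + b * (x * s + y * r) + + 2 * c * y * s) * (X * Y)
      + (a * (r * r) + b * (r * s) + c * (s * s)) * (Y * Y)
  change-val = solve-∀

  change-disc : ∀ a b c x y r s → x * s - y * r ≡ + 1 →
    + 4 * ((a * (x * x) + b * (x * y) + c * (y * y)) * (a * (r * r) + b * (r * s) + c * (s * s)))
      - (+ 2 * a * x * r + b * (x * s + y * r) + + 2 * c * y * s) * (+ 2 * a * x * r + b * (x * s + y * r) + + 2 * c * y * s)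
      ≡ + 4 * (a * c) - b * b
  change-disc a b c x y r s e = ringlc ((+ 4 * (a * c) - b * b) * (x * s - y * r + + 1)) e
    (solve (a ∷ b ∷ c ∷ x ∷ y ∷ r ∷ s ∷ []))

  change-det : ∀ x y r s X Y X′ Y′ → x * s - y * r ≡ + 1 →
    (X * x + Y * r) * (X′ * y + Y′ * s) - (X′ * x + Y′ * r) * (X * y + Y * s) ≡ X * Y′ - X′ * Y
  change-det x y r s X Y X′ Y′ e = ringlc (X * Y′ - X′ * Y) e (solve (x ∷ y ∷ r ∷ s ∷ X ∷ Y ∷ X′ ∷ Y′ ∷ []))

  change-inv₁ : ∀ x y r s X Y → x * s - y * r ≡ + 1 → (X * s - Y * r) * x + (x * Y - y * X) * r ≡ X
  change-inv₁ x y r s X Y e = ringlc X e (solve (x ∷ y ∷ r ∷ s ∷ X ∷ Y ∷ []))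

  change-inv₂ : ∀ x y r s X Y → x * s - y * r ≡ + 1 → (X * s - Y * r) * y + (x * Y - y * X) * s ≡ Y
  change-inv₂ x y r s X Y e = ringlc Y e (solve (x ∷ y ∷ r ∷ s ∷ X ∷ Y ∷ []))

changeBasis : ∀ a b c x y → Unimodular x y → ChangedBasis a b c x y
changeBasis a b c x y (r , s , e) = record
  { b′ = b′
  ; c′ = c′
  ; disc = change-disc a b c x y r s e
  ; count = transport
  }
  where
  b′ = + 2 * a * x * r + b * (x * s + y * r) + + 2 * c * y * s
  c′ = val a b c r s
  transport : ∀ {n k} → Count (val a b c x y) b′ c′ n k → Count a b c n k
  transport {n} {k} C = record { X = X′ ; Y = Y′ ; value = value′ ; distinct = distinct′ ; complete = complete′ }
    where
    open Count C
    X′ Y′ : Fin k → ℤ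
    X′ i = X i * x + Y i * r
    Y′ i = X i * y + Y i * s
    value′ : ∀ i → val a b c (X′ i) (Y′ i) ≡ n
    value′ i = trans (change-val a b c x y r s (X i) (Y i)) (value i)
    distinct′ : ∀ i j → n ∣ X′ i * Y′ j - X′ j * Y′ i → i ≡ j
    distinct′ i j d = distinct i j (subst (n ∣_) (change-det x y r s (X i) (Y i) (X j) (Y j) e) d)
    complete′ : ∀ x₁ y₁ → val a b c x₁ y₁ ≡ n → ∃ λ i → n ∣ X′ i * y₁ - x₁ * Y′ i
    complete′ x₁ y₁ v = from (complete p q (trans (sym (change-val a b c x y r s p q)) (trans (cong₂ (val a b c) x₁≡ y₁≡) v)))
      where
      p = x₁ * s - y₁ * r
      q = x * y₁ - y * x₁
      x₁≡ : p * x + q * r ≡ x₁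
      x₁≡ = change-inv₁ x y r s x₁ y₁ e
      y₁≡ : p * y + q * s ≡ y₁
      y₁≡ = change-inv₂ x y r s x₁ y₁ e
      from : (∃ λ i → n ∣ X i * q - p * Y i) → ∃ λ i → n ∣ X′ i * y₁ - x₁ * Y′ i
      from (i , d) = i , subst (n ∣_)
        (trans (sym (change-det x y r s (X i) (Y i) p q e)) (cong₂ (λ u w → X′ i * w - u * Y′ i) x₁≡ y₁≡)) d

-- Norm elements prime to P

sq-abs : ∀ z → z * z ≡ + (abs z ℕ.* abs z)
sq-abs (+ n) = sym (ℤₚ.pos-* n n)
sq-abs -[1+ n ] = refl

sum-squares : ∀ d z y → z * z + + suc d * (y * y) ≡ + (abs z ℕ.* abs z ℕ.+ suc d ℕ.* (abs y ℕ.* abs y))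
sum-squares d z y = sym (trans (ℤₚ.pos-+ (abs z ℕ.* abs z) (suc d ℕ.* (abs y ℕ.* abs y)))
  (cong₂ _+_ (sym (sq-abs z)) (trans (ℤₚ.pos-* (suc d) (abs y ℕ.* abs y)) (cong (+ suc d *_) (sym (sq-abs y))))))

n≤n² : ∀ n → n ℕ.≤ n ℕ.* n
n≤n² zero = z≤n
n≤n² (suc n) = ℕₚ.m≤m+n (suc n) (n ℕ.* suc n)

abs-bound : ∀ d y z m → z * z + + suc d * (y * y) ≡ m → abs y ℕ.≤ abs m
abs-bound d y z m e = subst (abs y ℕ.≤_) (cong abs (trans (sym (sum-squares d z y)) e))
  (ℕₚ.≤-trans (n≤n² (abs y)) (ℕₚ.≤-trans (ℕₚ.m≤m+n (abs y ℕ.* abs y) (d ℕ.* (abs y ℕ.* abs y)))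
    (ℕₚ.m≤n+m (suc d ℕ.* (abs y ℕ.* abs y)) (abs z ℕ.* abs z))))

any-≤abs? : ∀ {p} {P : ℤ → Set p} → Decidable P → ∀ B → Dec (∃ λ x → abs x ℕ.≤ B × P x)
any-≤abs? {P = P} P? B = map′ f g (ℕₚ.anyUpTo? (λ n → P? (+ n) ⊎-dec P? (- + n)) (suc B))
  where
  f : (∃ λ n → n ℕ.< suc B × (P (+ n) ⊎ P (- + n))) → ∃ λ x → abs x ℕ.≤ B × P x
  f (n , s≤s n≤B , inj₁ p) = + n , n≤B , p
  f (n , s≤s n≤B , inj₂ p) = - + n , subst (ℕ._≤ B) (sym (ℤₚ.∣-i∣≡∣i∣ (+ n))) n≤B , p
  g : (∃ λ x → abs x ℕ.≤ B × P x) → ∃ λ n → n ℕ.< suc B × (P (+ n) ⊎ P (- + n))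
  g (+ n , l , p) = n , s≤s l , inj₁ p
  g (-[1+ n ] , l , p) = suc n , s≤s l , inj₂ p

private
  complete-square-y : ∀ a b c x y n D → + 4 * (a * c) - b * b ≡ D → a * (x * x) + b * (x * y) + c * (y * y) ≡ n →
    (+ 2 * a * x + b * y) * (+ 2 * a * x + b * y) + D * (y * y) ≡ + 4 * a * n
  complete-square-y a b c x y n D e f = ringlc₂ (- (y * y)) (+ 4 * a) e f (solve (a ∷ b ∷ c ∷ x ∷ y ∷ n ∷ D ∷ []))

  complete-square-x : ∀ a b c x y n D → + 4 * (a * c) - b * b ≡ D → a * (x * x) + b * (x * y) + c * (y * y) ≡ n →
    (+ 2 * c * y + b * x) * (+ 2 * c * y + b * x) + D * (x * x) ≡ + 4 * c * n
  complete-square-x a b c x y n D e f = ringlc₂ (- (x * x)) (+ 4 * c) e f (solve (a ∷ b ∷ c ∷ x ∷ y ∷ n ∷ D ∷ []))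

-- Completing the square in either variable writes 4 a n or 4 c n as a square plus a positive
-- multiple of a square. This bounds both coordinates and leaves a finite search.
represented? : ∀ a b c d n → + 4 * (a * c) - b * b ≡ + suc d → ∀ {p} {P : ℤ → ℤ → Set p} → (∀ x y → Dec (P x y)) →
  Dec (∃₂ λ x y → val a b c x y ≡ n × P x y)
represented? a b c d n e {P = P} P? = map′ forget bounded
  (any-≤abs? (λ x → any-≤abs? (λ y → (val a b c x y ℤ.≟ n) ×-dec P? x y) Y) X)
  where
  X = abs (+ 4 * c * n)
  Y = abs (+ 4 * a * n)
  forget : (∃ λ x → abs x ℕ.≤ X × ∃ λ y → abs y ℕ.≤ Y × val a b c x y ≡ n × P x y) → ∃₂ λ x y → val a b c x y ≡ n × P x y
  forget (x , _ , y , _ , v) = x , y , v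
  bounded : (∃₂ λ x y → val a b c x y ≡ n × P x y) → ∃ λ x → abs x ℕ.≤ X × ∃ λ y → abs y ℕ.≤ Y × val a b c x y ≡ n × P x y
  bounded (x , y , v , p) =
    x , abs-bound d x (+ 2 * c * y + b * x) (+ 4 * c * n) (complete-square-x a b c x y n (+ suc d) e v) ,
    y , abs-bound d y (+ 2 * a * x + b * y) (+ 4 * a * n) (complete-square-y a b c x y n (+ suc d) e v) , v , p

-- h² + b h u + m u² is the norm of h + u ω, where ω² = b ω - m.
record NormElement (P b m N : ℤ) : Set where
  constructor element
  field
    h u : ℤ
    norm : h * h + b * h * u + m * u * u ≡ N
    ∤u : ¬ P ∣ u

private
  -- For α = h + u ω and β = h′ + u′ ω, the index + marks the coordinates of α β, and the index -
  -- those of α times the conjugate of β.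
  module Product (b m h u h′ u′ : ℤ) where
    U₊ = h * u′ + u * h′ + b * u * u′
    H₊ = h * h′ - m * u * u′
    U₋ = u * h′ - h * u′
    H₋ = h * (h′ + b * u′) + m * u * u′

  norm₊ : ∀ b m h u h′ u′ N N′ → h * h + b * h * u + m * u * u ≡ N → h′ * h′ + b * h′ * u′ + m * u′ * u′ ≡ N′ →
    (h * h′ - m * u * u′) * (h * h′ - m * u * u′) + b * (h * h′ - m * u * u′) * (h * u′ + u * h′ + b * u * u′)
      + m * (h * u′ + u * h′ + b * u * u′) * (h * u′ + u * h′ + b * u * u′) ≡ N * N′
  norm₊ b m h u h′ u′ N N′ e f = ringlc₂ N′ (h * h + b * h * u + m * u * u) e f
    (solve (b ∷ m ∷ h ∷ u ∷ h′ ∷ u′ ∷ N ∷ N′ ∷ []))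

  norm₋ : ∀ b m h u h′ u′ N N′ → h * h + b * h * u + m * u * u ≡ N → h′ * h′ + b * h′ * u′ + m * u′ * u′ ≡ N′ →
    (h * (h′ + b * u′) + m * u * u′) * (h * (h′ + b * u′) + m * u * u′) + b * (h * (h′ + b * u′) + m * u * u′) *
      (u * h′ - h * u′)
      + m * (u * h′ - h * u′) * (u * h′ - h * u′) ≡ N * N′
  norm₋ b m h u h′ u′ N N′ e f = ringlc₂ N′ (h * h + b * h * u + m * u * u) e f
    (solve (b ∷ m ∷ h ∷ u ∷ h′ ∷ u′ ∷ N ∷ N′ ∷ []))

  U-product : ∀ b m h u h′ u′ N N′ → h * h + b * h * u + m * u * u ≡ N → h′ * h′ + b * h′ * u′ + m * u′ * u′ ≡ N′ →
    (u * h′ - h * u′) * (h * u′ + u * h′ + b * u * u′) ≡ u * u * N′ - u′ * u′ * N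
  U-product b m h u h′ u′ N N′ e f = ringlc₂ (- (u′ * u′)) (u * u) e f
    (solve (b ∷ m ∷ h ∷ u ∷ h′ ∷ u′ ∷ N ∷ N′ ∷ []))

  U-sum : ∀ b h u h′ u′ → (h * u′ + u * h′ + b * u * u′) + (u * h′ - h * u′) ≡ u * (+ 2 * h′ + b * u′)
  U-sum = solve-∀

  trace-sq : ∀ b m h u N D → + 4 * m - b * b ≡ D → h * h + b * h * u + m * u * u ≡ N →
    D * (u * u) ≡ + 4 * N - (+ 2 * h + b * u) * (+ 2 * h + b * u)
  trace-sq b m h u N D e f = ringlc₂ (- (u * u)) (+ 4) e f (solve (b ∷ m ∷ h ∷ u ∷ N ∷ D ∷ []))

prime∤trace : ∀ {P} → IsPrime P → ∀ b m {h u N} → ¬ P ∣ + 4 * m - b * b → P ∣ N → h * h + b * h * u + m * u * u ≡ N →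
  ¬ P ∣ u → ¬ P ∣ + 2 * h + b * u
prime∤trace {P} pP b m {h} {u} {N} nD dN e nu dt = [ nD , (λ d → nu (euclid-sq pP u d)) ]′ (euclid pP D (u * u) Du²)
  where
  D = + 4 * m - b * b
  t = + 2 * h + b * u
  Du² : P ∣ D * (u * u)
  Du² = subst (P ∣_) (sym (trace-sq b m h u N D refl e)) (∣m∣n⇒∣m-n (∣n⇒∣m*n (+ 4) dN) (∣n⇒∣m*n t dt))

module _ {P : ℤ} (pP : IsPrime P) (b m : ℤ) (nD : ¬ P ∣ + 4 * m - b * b) where

  PrimeTo : ℤ → Set
  PrimeTo N = NormElement P b m N

  private
    data Exclusive (U V : ℤ) : Set where
      left : P ∣ U → ¬ P ∣ V → Exclusive U V
      right : P ∣ V → ¬ P ∣ U → Exclusive U V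

    exclusive : ∀ {U V} → P ∣ U * V → ¬ P ∣ V + U → Exclusive U V
    exclusive {U} {V} d n with euclid pP U V d
    ... | inj₁ dU = left dU (λ dV → n (∣m∣n⇒∣m+n dV dU))
    ... | inj₂ dV = right dV (λ dU → n (∣m∣n⇒∣m+n dV dU))

    -- α and β each involve only one of the two primes above P. If it is the same one, α β stays
    -- prime to P; otherwise α times the conjugate of β does. In coordinates, P divides U₋ U₊ but
    -- not U₋ + U₊, which is u times the trace of β.
    exclusive-products : ∀ {N N′} (α : PrimeTo N) (β : PrimeTo N′) → P ∣ N → P ∣ N′ →
      Exclusive (Product.U₋ b m (NormElement.h α) (NormElement.u α) (NormElement.h β) (NormElement.u β))
        (Product.U₊ b m (NormElement.h α) (NormElement.u α) (NormElement.h β) (NormElement.u β))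
    exclusive-products {N} {N′} (element h u e nu)
      (element h′ u′ e′ nu′) dN dN′ = exclusive {Product.U₋ b m h u h′ u′} {Product.U₊ b m h u h′ u′}
      (subst (P ∣_) (sym (U-product b m h u h′ u′ N N′ e e′)) (∣m∣n⇒∣m-n (∣n⇒∣m*n (u * u) dN′) (∣n⇒∣m*n (u′ * u′) dN)))
      (λ d → prime∤trace pP b m {h′} {u′} {N′} nD dN′ e′ nu′
        (euclid′ pP nu (+ 2 * h′ + b * u′) (subst (P ∣_) (U-sum b h u h′ u′) d)))

  element-* : ∀ {N N′} → P ∣ N → P ∣ N′ → PrimeTo N → PrimeTo N′ → PrimeTo (N * N′)
  element-* {N} {N′} dN dN′ α@(element h u e nu) β@(element h′ u′ e′ nu′) = go (exclusive-products α β dN dN′)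
    where
    open Product b m h u h′ u′
    go : Exclusive U₋ U₊ → PrimeTo (N * N′)
    go (left _ n) = element H₊ U₊ (norm₊ b m h u h′ u′ N N′ e e′) n
    go (right _ n) = element H₋ U₋ (norm₋ b m h u h′ u′ N N′ e e′) n

  private
    root : ∀ b m H U R W → H * H + b * H * (U * R) + m * (U * R) * (U * R) ≡ (R * (W * W)) * R →
      H * H + R * (b * U) * H ≡ R * R * (W * W - m * U * U)
    root b m H U R W e = ringlc (+ 1) e (solve (b ∷ m ∷ H ∷ U ∷ R ∷ W ∷ []))

    reduce : ∀ b m H U R W → (H * R) * (H * R) + b * (H * R) * (U * R) + m * (U * R) * (U * R) ≡ (R * (W * W)) * R →
      (R * R) * (H * H + b * H * U + m * U * U) ≡ (R * R) * (W * W)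
    reduce b m H U R W e = ringlc (+ 1) e (solve (b ∷ m ∷ H ∷ U ∷ R ∷ W ∷ []))

    -- (H , U) has norm R² W² and R ∣ U, hence it is R times an element of norm W².
    divide : ∀ R W H U V u u′ → ¬ R ≡ + 0 → P ∣ W → ¬ P ∣ u → R ∣ U →
      H * H + b * H * U + m * U * U ≡ (R * (W * W)) * R →
      U * V ≡ u * u * R - u′ * u′ * (R * (W * W)) → PrimeTo (W * W)
    divide R W H _ V u u′ R≢0 dW nu (divides U refl) e f = go
      (monic-root-∣ R H (b * U) (W * W - m * U * U) (root b m H U R W e)) e
      where
      rel : ∀ R U V u u′ W → U * R * V ≡ u * u * R - u′ * u′ * (R * W) → R * (u * u) ≡ R * (U * V + u′ * u′ * W)
      rel R U V u u′ W e = ringlc (- + 1) e (solve (R ∷ U ∷ V ∷ u ∷ u′ ∷ W ∷ []))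
      u² : u * u ≡ U * V + u′ * u′ * (W * W)
      u² = cancelˡ R R≢0 (rel R U V u u′ (W * W) f)
      nU : ¬ P ∣ U
      nU d = nu (euclid-sq pP u (subst (P ∣_) (sym u²) (∣m∣n⇒∣m+n (∣m⇒∣m*n V d) (∣n⇒∣m*n (u′ * u′) (∣m⇒∣m*n W dW)))))
      go : R ∣ H → H * H + b * H * (U * R) + m * (U * R) * (U * R) ≡ (R * (W * W)) * R → PrimeTo (W * W)
      go (divides H′ refl) e = element H′ U (cancelˡ (R * R) (*≢0 R≢0 R≢0) (reduce b m H′ U R W e)) nU

    R∣UV : ∀ U V R u u′ W → U * V ≡ u * u * R - u′ * u′ * (R * W) → R ∣ V * U
    R∣UV U V R u u′ W e = divides (u * u - u′ * u′ * W) (trans (ℤₚ.*-comm V U) (trans e (lem R u u′ W)))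
      where
      lem : ∀ R u u′ W → u * u * R - u′ * u′ * (R * W) ≡ (u * u - u′ * u′ * W) * R
      lem = solve-∀

  -- P^n divides U₋ U₊ and one factor is prime to P, so the other carries all of P^n. The
  -- corresponding product can be divided by P^n, which leaves norm W².
  element-/ : ∀ n W → P ∣ W → P ∣ P ^ n → PrimeTo (P ^ n * (W * W)) → PrimeTo (P ^ n) → PrimeTo (W * W)
  element-/ n W dW dR α@(element h u e nu) β@(element h′ u′ e′ nu′) = go (exclusive-products α β (∣m⇒∣m*n (W * W) dR) dR)
    where
    open Product b m h u h′ u′
    R = P ^ n
    R≢0 = ^≢0 (prime≢0 pP) n
    UV : U₋ * U₊ ≡ u * u * R - u′ * u′ * (R * (W * W))
    UV = U-product b m h u h′ u′ (R * (W * W)) R e e′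
    VU : U₊ * U₋ ≡ u * u * R - u′ * u′ * (R * (W * W))
    VU = trans (ℤₚ.*-comm U₊ U₋) UV
    go : Exclusive U₋ U₊ → PrimeTo (W * W)
    go (left _ nV) = divide R W H₋ U₋ U₊ u u′ R≢0 dW nu
      (^-∣-cancel pP nV n U₋ (R∣UV U₋ U₊ R u u′ (W * W) UV)) (norm₋ b m h u h′ u′ (R * (W * W)) R e e′) UV
    go (right _ nU) = divide R W H₊ U₊ U₋ u u′ R≢0 dW nu
      (^-∣-cancel pP nU n U₊ (R∣UV U₊ U₋ R u u′ (W * W) VU)) (norm₊ b m h u h′ u′ (R * (W * W)) R e e′) VU

private
  parity-factor : ∀ b m b′ m′ → + 4 * m - b * b ≡ + 4 * m′ - b′ * b′ →
    (b - b′) * (b - b′) ≡ (+ 2 * (m - m′) - b′ * (b - b′)) * + 2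
  parity-factor b m b′ m′ e = ringlc (- + 1) e (solve (b ∷ m ∷ b′ ∷ m′ ∷ []))

  base-m : ∀ b m b′ m′ κ → + 4 * m - b * b ≡ + 4 * m′ - b′ * b′ → b - b′ ≡ κ * + 2 → + 4 * m ≡ + 4 * (m′ + κ * b′ + κ * κ)
  base-m b m b′ m′ κ e f = ringlc₂ (+ 1) (b + b′ + + 2 * κ) e f (solve (b ∷ m ∷ b′ ∷ m′ ∷ κ ∷ []))

  base-norm : ∀ b m b′ m′ κ h u N → m ≡ m′ + κ * b′ + κ * κ → b - b′ ≡ κ * + 2 → h * h + b * h * u + m * u * u ≡ N →
    (h + κ * u) * (h + κ * u) + b′ * (h + κ * u) * u + m′ * u * u ≡ N
  base-norm b m b′ m′ κ h u N e f g = ringlc₃ (- (u * u)) (- (h * u)) (+ 1) e f g (solve (b ∷ m ∷ b′ ∷ m′ ∷ κ ∷ h ∷ u ∷ N ∷ []))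

disc-parity : ∀ b m b′ m′ → + 4 * m - b * b ≡ + 4 * m′ - b′ * b′ → + 2 ∣ b - b′
disc-parity b m b′ m′ e = euclid-sq (isPrime prime[2]) (b - b′)
  (divides (+ 2 * (m - m′) - b′ * (b - b′)) (parity-factor b m b′ m′ e))
  

-- Equal discriminants force b ≡ b′ modulo 2, and ω = ω′ + κ with 2 κ = b - b′. As the order depends
-- on the discriminant alone, one computation of s serves all forms met in the descent.
changeOrderBasis : ∀ {P b m b′ m′ N} → + 4 * m - b * b ≡ + 4 * m′ - b′ * b′ → NormElement P b m N → NormElement P b′ m′ N
changeOrderBasis {P} {b} {m} {b′} {m′} {N} e (element h u n nu) = go (disc-parity b m b′ m′ e)
  where
  go : + 2 ∣ b - b′ → NormElement P b′ m′ N
  go (divides κ f) = element (h + κ * u) u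
    (base-norm b m b′ m′ κ h u N (cancelˡ (+ 4) {m} {m′ + κ * b′ + κ * κ} (λ ()) (base-m b m b′ m′ κ e f)) f n) nu

-- For P prime to the discriminant and z ≥ 1, such an element generates the 2z-th power of a prime
-- ideal above P. At z = 0 the element 1 is lost, since it has u = 0; hence the conditions 1 ≤ z
-- below.
InS : (P b m : ℤ) → ℕ → Set
InS P b m z = NormElement P b m (P ^ (z ℕ.+ z))

-- The exponents are the positive part of a subgroup of ℤ, and s is its generator: the order of the
-- class of the square of a prime ideal above P.
record NormExponents (P b m : ℤ) : Set where
  field
    s : ℕ
    s≥1 : 1 ℕ.≤ s
    multiples : ∀ i → 1 ℕ.≤ i → InS P b m (i ℕ.* s)
    generates : ∀ z → 1 ℕ.≤ z → InS P b m z → ∃ λ i → z ≡ i ℕ.* s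

module _ {P : ℤ} (pP : IsPrime P) (b m : ℤ) (d : ℕ) (disc : + 4 * m - b * b ≡ + suc d) (nD : ¬ P ∣ + 4 * m - b * b) where

  private
    norm-val : ∀ b m h u → + 1 * (h * h) + b * (h * u) + m * (u * u) ≡ h * h + b * h * u + m * u * u
    norm-val = solve-∀

  inS? : Decidable (InS P b m)
  inS? z = map′ to from (represented? (+ 1) b m d N disc′ (λ h u → ¬? (P ∣? u)))
    where
    N = P ^ (z ℕ.+ z)
    disc′ : + 4 * (+ 1 * m) - b * b ≡ + suc d
    disc′ = trans (cong (λ x → + 4 * x - b * b) (ℤₚ.*-identityˡ m)) disc
    to : (∃₂ λ h u → val (+ 1) b m h u ≡ N × ¬ P ∣ u) → NormElement P b m N
    to (h , u , e , n) = element h u (trans (sym (norm-val b m h u)) e) n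
    from : NormElement P b m N → ∃₂ λ h u → val (+ 1) b m h u ≡ N × ¬ P ∣ u
    from (element h u e n) = h , u , trans (norm-val b m h u) e , n

  private
    inS-+ : ∀ {x y} → 1 ℕ.≤ x → 1 ℕ.≤ y → InS P b m x → InS P b m y → InS P b m (x ℕ.+ y)
    inS-+ {x} {y} lx ly α β = subst (NormElement P b m) (sym (^-double P x y))
      (element-* pP b m nD (base∣^ P (ℕₚ.≤-trans lx (ℕₚ.m≤m+n x x))) (base∣^ P (ℕₚ.≤-trans ly (ℕₚ.m≤m+n y y))) α β)

    inS-∸ : ∀ {x y} → 1 ℕ.≤ x → 1 ℕ.≤ y → InS P b m (x ℕ.+ y) → InS P b m x → InS P b m y
    inS-∸ {x} {y} lx ly α β = subst (NormElement P b m) (sym (^-+ P y y))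
      (element-/ pP b m nD (x ℕ.+ x) (P ^ y) (base∣^ P ly) (base∣^ P (ℕₚ.≤-trans lx (ℕₚ.m≤m+n x x)))
        (subst (NormElement P b m) (trans (^-double P x y) (cong (P ^ (x ℕ.+ x) *_) (^-+ P y y))) α) β)

    Least : Set
    Least = ∃ λ s → 1 ℕ.≤ s × InS P b m s × (∀ z → 1 ℕ.≤ z → InS P b m z → s ℕ.≤ z)

    least : ∀ z → 1 ℕ.≤ z → InS P b m z → Least
    least = <-rec (λ z → 1 ℕ.≤ z → InS P b m z → Least) step
      where
      step : ∀ z → (∀ {y} → y ℕ.< z → 1 ℕ.≤ y → InS P b m y → Least) → 1 ℕ.≤ z → InS P b m z → Least
      step z rec l i = go (ℕₚ.anyUpTo? (λ y → (1 ℕ.≤? y) ×-dec inS? y) z)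
        where
        go : Dec (∃ λ y → y ℕ.< z × 1 ℕ.≤ y × InS P b m y) → Least
        go (yes (y , y<z , ly , iy)) = rec y<z ly iy
        go (no ¬p) = z , l , i , λ y ly iy → ℕₚ.≮⇒≥ (λ y<z → ¬p (y , y<z , ly , iy))

  normExponents : ∀ z → 1 ℕ.≤ z → InS P b m z → NormExponents P b m
  normExponents z l i = fromLeast (least z l i)
    where
    fromLeast : Least → NormExponents P b m
    fromLeast (s , ls , is , min) = record { s = s ; s≥1 = ls ; multiples = mult ; generates = <-rec Gen gen }
      where
      Gen : ℕ → Set
      Gen z = 1 ℕ.≤ z → InS P b m z → ∃ λ i → z ≡ i ℕ.* s
      mult : ∀ i → 1 ℕ.≤ i → InS P b m (i ℕ.* s)
      mult 1 _ = subst (InS P b m) (sym (ℕₚ.+-identityʳ s)) is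
      mult (suc (suc i)) _ = inS-+ ls (ℕₚ.≤-trans ls (ℕₚ.m≤m+n s (i ℕ.* s))) is (mult (suc i) (s≤s z≤n))
      gen : ∀ z → (∀ {y} → y ℕ.< z → Gen y) → Gen z
      gen z rec lz iz = go (ℕₚ.m≤n⇒∃[o]m+o≡n (min z lz iz))
        where
        go : (∃ λ o → s ℕ.+ o ≡ z) → ∃ λ i → z ≡ i ℕ.* s
        go (zero , e) = 1 , trans (sym e) (trans (ℕₚ.+-identityʳ s) (sym (ℕₚ.+-identityʳ s)))
        go (suc y , e) =
          let i , f = rec (subst (suc y ℕ.<_) e (ℕₚ.m<n+m (suc y) ls)) (s≤s z≤n)
                (inS-∸ ls (s≤s z≤n) (subst (InS P b m) (sym e) iz) is)
          in suc i , trans (sym e) (cong (s ℕ.+_) f)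

-- Counting the orbits on a good value

infix 4 _∤_
_∤_ : ℤ → ℤ → Set
x ∤ y = ¬ x ∣ y

∤-* : ∀ {P} → IsPrime P → ∀ x y → P ∤ x → P ∤ y → P ∤ x * y
∤-* pP x y nx ny d = [ nx , ny ]′ (euclid pP x y d)

-- An element whose conjugate h + b u is prime to P.
record Oriented (P b m N : ℤ) : Set where
  constructor oriented
  field
    h u : ℤ
    norm : h * h + b * h * u + m * u * u ≡ N
    ∤u : P ∤ u
    ∤h̄ : P ∤ h + b * u

private
  conj-norm : ∀ b m h u N → h * h + b * h * u + m * u * u ≡ N →
    (h + b * u) * (h + b * u) + b * (h + b * u) * (- u) + m * (- u) * (- u) ≡ N
  conj-norm b m h u N e = ringlc (+ 1) e (solve (b ∷ m ∷ h ∷ u ∷ N ∷ []))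

  conj-conj : ∀ b h u → (h + b * u) + b * (- u) ≡ h
  conj-conj = solve-∀

  bu-diff : ∀ b h u → (h + b * u) - h ≡ b * u
  bu-diff = solve-∀

∤-neg : ∀ {P x} → P ∤ x → P ∤ - x
∤-neg {P} {x} n d = n (subst (P ∣_) (ℤₚ.neg-involutive x) (∣m⇒∣-m d))

-- h and h + b u differ by b u, so P divides at most one of them, and conjugation exchanges the two.
orient : ∀ {P} → IsPrime P → ∀ b m N → P ∤ b → NormElement P b m N → Oriented P b m N
orient {P} pP b m N nb (element h u e nu) = go (P ∣? h)
  where
  go : Dec (P ∣ h) → Oriented P b m N
  go (yes d) = oriented h u e nu (λ d′ → ∤-* pP b u nb nu (subst (P ∣_) (bu-diff b h u) (∣m∣n⇒∣m-n d′ d)))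
  go (no nd) = oriented (h + b * u) (- u) (conj-norm b m h u N e) (∤-neg nu) (subst (P ∤_) (sym (conj-conj b h u)) nd)

-- The equation says that (x , n₀ u) has value n₀ A in the form (n₀ A , b , c).
record DepthVector (P b c n₀ A : ℤ) : Set where
  constructor depthVector
  field
    x u : ℤ
    eq : A * x * x + b * x * u + n₀ * c * u * u ≡ A
    ∤u : P ∤ u

private
  hh̄ : ∀ b c h u n₀ A N → h * h + b * h * u + (n₀ * A * c) * u * u ≡ A * N → (h + b * u) * h ≡ (N - n₀ * c * u * u) * A
  hh̄ b c h u n₀ A N e = ringlc (+ 1) e (solve (b ∷ c ∷ h ∷ u ∷ n₀ ∷ A ∷ N ∷ []))

  depth-cancel : ∀ b c x u n₀ A → x * A * (x * A) + b * (x * A) * u + (n₀ * A * c) * u * u ≡ A * A →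
    A * (A * x * x + b * x * u + n₀ * c * u * u) ≡ A * A
  depth-cancel b c x u n₀ A e = ringlc (+ 1) e (solve (b ∷ c ∷ x ∷ u ∷ n₀ ∷ A ∷ []))

  depth-value : ∀ b c x u n₀ A → A * x * x + b * x * u + n₀ * c * u * u ≡ A →
    (n₀ * A) * (x * x) + b * (x * (n₀ * u)) + c * ((n₀ * u) * (n₀ * u)) ≡ n₀ * A
  depth-value b c x u n₀ A e = ringlc n₀ e (solve (b ∷ c ∷ x ∷ u ∷ n₀ ∷ A ∷ []))

  value-depth : ∀ b c x u n₀ A → (n₀ * A) * (x * x) + b * (x * (n₀ * u)) + c * ((n₀ * u) * (n₀ * u)) ≡ n₀ * A →
    n₀ * (A * x * x + b * x * u + n₀ * c * u * u) ≡ n₀ * A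
  value-depth b c x u n₀ A e = ringlc (+ 1) e (solve (b ∷ c ∷ x ∷ u ∷ n₀ ∷ A ∷ []))

  depth-norm : ∀ b c x u n₀ A → A * x * x + b * x * u + n₀ * c * u * u ≡ A →
    (A * x) * (A * x) + b * (A * x) * u + (n₀ * A * c) * u * u ≡ A * A
  depth-norm b c x u n₀ A e = ringlc A e (solve (b ∷ c ∷ x ∷ u ∷ n₀ ∷ A ∷ []))

  Ψ-eq : ∀ b c x u n₀ A → A * x * x + b * x * u + n₀ * c * u * u ≡ A → u * (b * x + n₀ * c * u) ≡ (+ 1 - x * x) * A
  Ψ-eq b c x u n₀ A e = ringlc (+ 1) e (solve (b ∷ c ∷ x ∷ u ∷ n₀ ∷ A ∷ []))

  Ψ-det : ∀ b c x u x′ u′ n₀ → (b * x + n₀ * c * u) * u′ - (b * x′ + n₀ * c * u′) * u ≡ b * (x * u′ - x′ * u)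
  Ψ-det = solve-∀

  x-div : ∀ b c x u n₀ A → A * x * x + b * x * u + n₀ * c * u * u ≡ A → (b * u) * x ≡ A * (+ 1 - x * x) - n₀ * (c * u * u)
  x-div b c x u n₀ A e = ringlc (+ 1) e (solve (b ∷ c ∷ x ∷ u ∷ n₀ ∷ A ∷ []))

-- With A = P^z, the norm equation reads h (h + b u) = (A - n₀ c u²) A. The orientation keeps P out
-- of h + b u, so h takes all of A, and a factor A cancels from the equation.
norm⇒depthVector : ∀ {P} → IsPrime P → ∀ b c n₀ z → Oriented P b (n₀ * P ^ z * c) (P ^ z * P ^ z) → DepthVector P b c n₀ (P ^ z)
norm⇒depthVector {P} pP b c n₀ z (oriented h u e nu nh̄) =
  go (^-∣-cancel pP nh̄ z h (divides (A - n₀ * c * u * u) (hh̄ b c h u n₀ A A e))) e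
  where
  A = P ^ z
  go : A ∣ h → h * h + b * h * u + (n₀ * A * c) * u * u ≡ A * A → DepthVector P b c n₀ A
  go (divides x refl) e = depthVector x u (cancelˡ A (^≢0 (prime≢0 pP) z) (depth-cancel b c x u n₀ A e)) nu

depthVector⇒norm : ∀ {P b c n₀ A} → DepthVector P b c n₀ A → NormElement P b (n₀ * A * c) (A * A)
depthVector⇒norm {b = b} {c} {n₀} {A} (depthVector x u e nu) = element (A * x) u (depth-norm b c x u n₀ A e) nu

-- Hence all vectors of value n and of one depth z lie in one orbit.
depthVector-unique : ∀ {P} → IsPrime P → ∀ b c n₀ z (v w : DepthVector P b c n₀ (P ^ z)) → P ∤ b →
  P ^ z ∣ DepthVector.x v * DepthVector.u w - DepthVector.x w * DepthVector.u v
depthVector-unique {P} pP b c n₀ z v w nb = ^-∣-cancel pP nb z (x v * u w - x w * u v)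
  (subst (A ∣_) (Ψ-det b c (x v) (u v) (x w) (u w) n₀) (∣m∣n⇒∣m-n (∣m⇒∣m*n (u w) (Ψ v)) (∣m⇒∣m*n (u v) (Ψ w))))
  where
  open DepthVector
  A = P ^ z
  Ψ : (v : DepthVector P b c n₀ A) → A ∣ b * x v + n₀ * c * u v
  Ψ v = ^-∣-cancel pP (∤u v) z (b * x v + n₀ * c * u v) (divides (+ 1 - x v * x v) (Ψ-eq b c (x v) (u v) n₀ A (eq v)))

-- For P ∣ n₀ the vector (x , n₀ u) is thus divisible by P. `down` divides it; in `bisector-split`
-- it follows that 1 ± x is prime to P.
depthVector-∣x : ∀ {P} → IsPrime P → ∀ b c n₀ A → P ∣ n₀ → P ∣ A → P ∤ b → (v : DepthVector P b c n₀ A) → P ∣ DepthVector.x v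
depthVector-∣x {P} pP b c n₀ A dn dA nb (depthVector x u e nu) = euclid′ pP (∤-* pP b u nb nu) x
  (subst (P ∣_) (sym (x-div b c x u n₀ A e)) (∣m∣n⇒∣m-n (∣m⇒∣m*n (+ 1 - x * x) dA) (∣m⇒∣m*n (c * u * u) dn)))

-- The valuation is cut off at M. When n′ y is the second coordinate of a vector of value n′ P^M, z
-- is the power of P in the denominator of y / P^M, which is the depth. `high` is depth 0, the orbit
-- of (1 , 0).
data Valuation (P : ℤ) (M : ℕ) (y : ℤ) : Set where
  high : P ^ M ∣ y → Valuation P M y
  low : ∀ z r y₂ → z ℕ.+ r ≡ M → 1 ℕ.≤ z → y ≡ P ^ r * y₂ → P ∤ y₂ → Valuation P M y

valuation : ∀ P M y → Valuation P M y
valuation P zero y = high (divides y (sym (ℤₚ.*-identityʳ y)))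
valuation P (suc M) y = go (P ∣? y)
  where
  assoc : ∀ P A y₂ → A * y₂ * P ≡ P * A * y₂
  assoc = solve-∀
  assoc′ : ∀ P A q → q * A * P ≡ q * (P * A)
  assoc′ = solve-∀
  step : ∀ {q} → y ≡ q * P → Valuation P M q → Valuation P (suc M) y
  step e (high (divides q f)) = high (divides q (trans e (trans (cong (_* P) f) (assoc′ P (P ^ M) q))))
  step e (low z r y₂ f lz g ny) = low z (suc r) y₂ (trans (ℕₚ.+-suc z r) (cong suc f)) lz
    (trans e (trans (cong (_* P) g) (assoc P (P ^ r) y₂))) ny
  go : Dec (P ∣ y) → Valuation P (suc M) y
  go (no ny) = low (suc M) 0 y (ℕₚ.+-identityʳ (suc M)) (s≤s z≤n) (sym (ℤₚ.*-identityˡ y)) ny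
  go (yes (divides q e)) = step e (valuation P M q)

module CountOrbits
  {P : ℤ} (pP : IsPrime P) (n′ : ℤ) (n′≢0 : ¬ n′ ≡ + 0) (M : ℕ) (b c : ℤ)
  (nD : P ∤ + 4 * (n′ * P ^ M * c) - b * b)
  (exponents : NormExponents P b (n′ * P ^ M * c))
  (k : ℕ) (k-low : k ℕ.* NormExponents.s exponents ℕ.≤ M) (k-high : M ℕ.< suc k ℕ.* NormExponents.s exponents)
  (good : ∀ x y → val (n′ * P ^ M) b c x y ≡ n′ * P ^ M → n′ ∣ y) where

  open NormExponents exponents

  private
    n = n′ * P ^ M

    P≢0 = prime≢0 pP

    n≢0 : ¬ n ≡ + 0
    n≢0 = *≢0 n′≢0 (^≢0 P≢0 M)

    P∤b : 1 ℕ.≤ M → P ∤ b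
    P∤b lM db = nD (∣m∣n⇒∣m-n (∣n⇒∣m*n (+ 4) (∣m⇒∣m*n c (∣n⇒∣m*n n′ (base∣^ P lM)))) (∣m⇒∣m*n b db))

    n₀ : ℕ → ℤ
    n₀ r = n′ * P ^ r

    n₀A : ∀ z r → z ℕ.+ r ≡ M → n₀ r * P ^ z ≡ n
    n₀A z r e = trans (swap n′ (P ^ r) (P ^ z)) (cong (n′ *_) (trans (sym (^-+ P z r)) (cong (P ^_) e)))
      where
      swap : ∀ n r z → n * r * z ≡ n * (z * r)
      swap = solve-∀

    data Rep (z r : ℕ) (X Y : ℤ) : Set where
      base : z ≡ 0 → X ≡ + 1 → Y ≡ + 0 → Rep z r X Y
      deep : (v : DepthVector P b c (n₀ r) (P ^ z)) → 1 ℕ.≤ z → X ≡ DepthVector.x v → Y ≡ n₀ r * DepthVector.u v → Rep z r X Y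

    rep : ∀ i → i ℕ.* s ℕ.≤ M → ∃₂ (Rep (i ℕ.* s) (M ℕ.∸ i ℕ.* s))
    rep zero _ = + 1 , + 0 , base refl refl refl
    rep (suc i) l = x , n₀ r * u , deep v z≥1 refl refl
      where
      z = suc i ℕ.* s
      r = M ℕ.∸ z
      z≥1 : 1 ℕ.≤ z
      z≥1 = ℕₚ.≤-trans s≥1 (ℕₚ.m≤m+n s (i ℕ.* s))
      α : NormElement P b (n₀ r * P ^ z * c) (P ^ z * P ^ z)
      α = subst₂ (λ m N → NormElement P b (m * c) N) (sym (n₀A z r (ℕₚ.m+[n∸m]≡n l))) (^-+ P z z) (multiples (suc i) (s≤s z≤n))
      v : DepthVector P b c (n₀ r) (P ^ z)
      v = norm⇒depthVector pP b c (n₀ r) z (orient pP b (n₀ r * P ^ z * c) (P ^ z * P ^ z) (P∤b (ℕₚ.≤-trans z≥1 l)) α)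
      open DepthVector v

    rep-value : ∀ z r {X Y} → z ℕ.+ r ≡ M → Rep z r X Y → val n b c X Y ≡ n
    rep-value z r e (base _ refl refl) = val₁₀ n b c
    rep-value z r e (deep v _ refl refl) = subst (λ m → val m b c (DepthVector.x v) (n₀ r * DepthVector.u v) ≡ m) (n₀A z r e)
      (depth-value b c (DepthVector.x v) (DepthVector.u v) (n₀ r) (P ^ z) (DepthVector.eq v))

    rep-∣ : ∀ z r {X Y} → Rep z r X Y → n₀ r ∣ Y
    rep-∣ z r (base _ _ refl) = divides (+ 0) (sym (ℤₚ.*-zeroˡ (n₀ r)))
    rep-∣ z r (deep v _ _ refl) = divides (DepthVector.u v) (ℤₚ.*-comm (n₀ r) (DepthVector.u v))

    z≤M : (i : Fin (suc k)) → toℕ i ℕ.* s ℕ.≤ M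
    z≤M i = ℕₚ.≤-trans (ℕₚ.*-monoˡ-≤ s (ℕₚ.≤-pred (Finₚ.toℕ<n i))) k-low

    X Y : Fin (suc k) → ℤ
    X i = proj₁ (rep (toℕ i) (z≤M i))
    Y i = proj₁ (proj₂ (rep (toℕ i) (z≤M i)))

    Z R : Fin (suc k) → ℕ
    Z i = toℕ i ℕ.* s
    R i = M ℕ.∸ Z i

    Z+R : ∀ i → Z i ℕ.+ R i ≡ M
    Z+R i = ℕₚ.m+[n∸m]≡n (z≤M i)

    isRep : ∀ i → Rep (Z i) (R i) (X i) (Y i)
    isRep i = proj₂ (proj₂ (rep (toℕ i) (z≤M i)))

    value : ∀ i → val n b c (X i) (Y i) ≡ n
    value i = rep-value (Z i) (R i) (Z+R i) (isRep i)

    -- A rotation of the form (n , b , c) has lower left entry n u, so divisibility of y by a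
    -- divisor of n is constant on orbits. This makes the depth an invariant.
    transfer : ∀ {x y x′ y′} d → d ∣ n → d ∣ y → Rotation n b c x y x′ y′ → d ∣ y′
    transfer {x} {y} d dn dy (rotation h u _ _ e) = subst (d ∣_) (sym e)
      (∣m∣n⇒∣m+n (∣m⇒∣m*n x (∣m⇒∣m*n u dn)) (∣n⇒∣m*n (h + b * u) dy))

    not-deeper : ∀ z z′ r r′ {X′ Y′} → z ℕ.< z′ → z ℕ.+ r ≡ M → z′ ℕ.+ r′ ≡ M → Rep z′ r′ X′ Y′ → n₀ r ∤ Y′
    not-deeper z z′ r r′ l e e′ (base refl _ _) d = contradiction l ℕₚ.n≮0
    not-deeper z z′ r r′ l e e′ (deep v _ _ refl) d = DepthVector.∤u v
      (∣-trans (base∣^ P {suc o} (s≤s z≤n))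
        (∣-cancelˡ (n₀ r′) (*≢0 n′≢0 (^≢0 P≢0 r′)) (subst (_∣ n₀ r′ * DepthVector.u v) split d)))
      where
      o = proj₁ (ℕₚ.m≤n⇒∃[o]m+o≡n l)
      eo : suc z ℕ.+ o ≡ z′
      eo = proj₂ (ℕₚ.m≤n⇒∃[o]m+o≡n l)
      r≡ : r ≡ r′ ℕ.+ suc o
      r≡ = ℕₚ.+-cancelˡ-≡ z r (r′ ℕ.+ suc o) (trans e (trans (sym e′) (trans (cong (ℕ._+ r′) (sym eo)) (lemℕ z o r′))))
        where
        lemℕ : ∀ z o r → suc z ℕ.+ o ℕ.+ r ≡ z ℕ.+ (r ℕ.+ suc o)
        lemℕ = solveℕ-∀
      split : n₀ r ≡ n₀ r′ * P ^ suc o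
      split = trans (cong n₀ r≡) (trans (cong (n′ *_) (^-+ P r′ (suc o))) (sym (ℤₚ.*-assoc n′ (P ^ r′) (P ^ suc o))))

    inequivalent : ∀ i j → toℕ i ℕ.< toℕ j → n ∤ X i * Y j - X j * Y i
    inequivalent i j l d = not-deeper (Z i) (Z j) (R i) (R j) (ℕₚ.*-monoˡ-< s {{ℕ.>-nonZero s≥1}} l) (Z+R i) (Z+R j) (isRep j)
      (transfer {X i} {Y i} {X j} {Y j} (n₀ (R i))
        (divides (P ^ Z i) (trans (sym (n₀A (Z i) (R i) (Z+R i))) (ℤₚ.*-comm (n₀ (R i)) (P ^ Z i))))
        (rep-∣ (Z i) (R i) (isRep i)) (∣det⇒rotation n b c n {X i} {Y i} {X j} {Y j} n≢0 (value i) (value j) d))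

    distinct : ∀ i j → n ∣ X i * Y j - X j * Y i → i ≡ j
    distinct i j d with ℕₚ.<-cmp (toℕ i) (toℕ j)
    ... | tri≈ _ e _ = Finₚ.toℕ-injective e
    ... | tri< l _ _ = contradiction d (inequivalent i j l)
    ... | tri> _ _ l = contradiction (subst (n ∣_) (det-swap (X i) (Y i) (X j) (Y j)) (∣m⇒∣-m d)) (inequivalent j i l)

    det-factor : ∀ n₀ x u x′ u′ → n₀ * (x * u′ - x′ * u) ≡ x * (n₀ * u′) - x′ * (n₀ * u)
    det-factor = solve-∀

    same-depth : ∀ z r {x y X Y} → z ℕ.+ r ≡ M → (v : DepthVector P b c (n₀ r) (P ^ z)) → 1 ℕ.≤ z → x ≡ DepthVector.x v →
      y ≡ n₀ r * DepthVector.u v →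
      Rep z r X Y → n ∣ X * y - x * Y
    same-depth z r e v lz _ _ (base refl _ _) = contradiction lz ℕₚ.n≮0
    same-depth z r e v lz refl refl (deep w _ refl refl) = go
      (depthVector-unique pP b c (n₀ r) z w v (P∤b (subst (1 ℕ.≤_) e (ℕₚ.≤-trans lz (ℕₚ.m≤m+n z r)))))
      where
      x₁ = DepthVector.x w
      u₁ = DepthVector.u w
      x₂ = DepthVector.x v
      u₂ = DepthVector.u v
      mult : ∀ m q A → m * (q * A) ≡ q * (m * A)
      mult = solve-∀
      go : P ^ z ∣ x₁ * u₂ - x₂ * u₁ → n ∣ x₁ * (n₀ r * u₂) - x₂ * (n₀ r * u₁)
      go (divides q f) = divides q (trans (sym (det-factor (n₀ r) x₁ u₁ x₂ u₂))
        (trans (cong (n₀ r *_) f) (trans (mult (n₀ r) q (P ^ z)) (cong (q *_) (n₀A z r e)))))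

    complete : ∀ x y → val n b c x y ≡ n → ∃ λ i → n ∣ X i * y - x * Y i
    complete x y e = fromGood (good x y e)
      where
      one-det : ∀ x y → + 1 * y - x * + 0 ≡ y
      one-det = solve-∀
      reassoc : ∀ y A n → y * A * n ≡ n * (A * y)
      reassoc = solve-∀
      reassoc′ : ∀ q A n → q * A * n ≡ q * (n * A)
      reassoc′ = solve-∀
      Goal = ∃ λ i → n ∣ X i * y - x * Y i
      atDepth : ∀ z r y₂ → z ℕ.+ r ≡ M → 1 ℕ.≤ z → y ≡ n₀ r * y₂ → P ∤ y₂ → Goal
      atDepth z r y₂ f lz ey ny = located
        (generates z lz (subst₂ (λ m N → NormElement P b (m * c) N) (n₀A z r f) (sym (^-+ P z z)) (depthVector⇒norm v)))
        where
        n₀≢0 = *≢0 n′≢0 (^≢0 P≢0 r)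
        v : DepthVector P b c (n₀ r) (P ^ z)
        v = depthVector x y₂ (cancelˡ (n₀ r) n₀≢0 (value-depth b c x y₂ (n₀ r) (P ^ z)
              (subst₂ (λ m y → val m b c x y ≡ m) (sym (n₀A z r f)) ey e))) ny
        located : (∃ λ i → z ≡ i ℕ.* s) → Goal
        located (i , refl) = Fin.fromℕ< i<k , transport (Finₚ.toℕ-fromℕ< i<k)
          where
          i<k : i ℕ.< suc k
          i<k = ℕₚ.*-cancelʳ-< s i (suc k) (ℕₚ.≤-<-trans (ℕₚ.m+n≤o⇒m≤o z (ℕₚ.≤-reflexive f)) k-high)
          j = Fin.fromℕ< i<k
          transport : toℕ j ≡ i → n ∣ X j * y - x * Y j
          transport ej = same-depth z r f v lz refl ey (subst₂ (λ z r → Rep z r (X j) (Y j)) Zj Rj (isRep j))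
            where
            Zj : Z j ≡ z
            Zj = cong (ℕ._* s) ej
            Rj : R j ≡ r
            Rj = trans (cong (M ℕ.∸_) Zj) (trans (cong (ℕ._∸ z) (sym f)) (ℕₚ.m+n∸m≡n z r))
      fromVal : ∀ y₁ → y ≡ y₁ * n′ → Valuation P M y₁ → Goal
      fromVal y₁ ey (high (divides q f)) = Fin.zero , divides q
        (trans (one-det x y) (trans ey (trans (cong (_* n′) f) (reassoc′ q (P ^ M) n′))))
      fromVal y₁ ey (low z r y₂ f lz g ny) = atDepth z r y₂ f lz (trans ey (trans (cong (_* n′) g) (reassoc″ (P ^ r) y₂ n′))) ny
        where
        reassoc″ : ∀ A y n → A * y * n ≡ n * A * y
        reassoc″ = solve-∀
      fromGood : n′ ∣ y → Goal
      fromGood (divides y₁ ey) = fromVal y₁ ey (valuation P M y₁)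

  count : Count n b c n (suc k)
  count = record { X = X ; Y = Y ; value = value ; distinct = distinct ; complete = complete }

-- Bisectors and equivalent forms

-- For v = (1 , 0) and w = (x , y), the vector (X , Y) lies along v + ε w; division by the content
-- c₁ lets it serve as a first basis vector. The sign leaves a choice between v + w and v - w, as
-- one of them may give an inadmissible value.
record Bisector (Adm : ℤ → Set) (n b c x y : ℤ) : Set where
  constructor bisector
  field
    ε c₁ X Y : ℤ
    ε² : ε * ε ≡ + 1
    c₁≢0 : ¬ c₁ ≡ + 0
    X≡ : c₁ * X ≡ + 1 + ε * x
    Y≡ : c₁ * Y ≡ ε * y
    unimodular : Unimodular X Y
    adm : Adm (val n b c X Y)

-- Adm singles out the values for which a form (n , b , c) of discriminant - Δ is maximal at every prime divisor
-- of n, in a way compatible with bisecting a pair of vectors of the same value.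
record Admissible (Δ : ℤ) (Adm : ℤ → Set) : Set where
  field
    adm≢0 : ∀ {n} → Adm n → ¬ n ≡ + 0
    adm-∣ : ∀ {P} → IsPrime P → P ∤ Δ → ∀ i n n₁ → Adm n → n₁ ∣ n * P ^ i → Adm n₁
    maximal : ∀ {L} → IsPrime L → ∀ n → Adm n → L ∣ n → ∀ k b → ¬ Δ ≡ L * L * (+ 4 * k - b * b)
    bisect : ∀ n b c x y → + 4 * (n * c) - b * b ≡ Δ → Adm n → val n b c x y ≡ n → ¬ y ≡ + 0 → Bisector Adm n b c x y

private
  bis-val : ∀ n b c x y ε c₁ X Y → ε * ε ≡ + 1 → n * (x * x) + b * (x * y) + c * (y * y) ≡ n →
    n * ((+ 1 + ε * x) * (+ 1 + ε * x)) + b * ((+ 1 + ε * x) * (ε * y)) + c * ((ε * y) * (ε * y)) ≡ + 2 * n + ε *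
      (+ 2 * n * x + b * y)
  bis-val n b c x y ε c₁ X Y e f = ringlc₂ (n * (x * x) + b * (x * y) + c * (y * y)) (+ 1) e f
    (solve (n ∷ b ∷ c ∷ x ∷ y ∷ ε ∷ c₁ ∷ X ∷ Y ∷ []))

  scale-val : ∀ n b c X Y k →
    k * k * (n * (X * X) + b * (X * Y) + c * (Y * Y)) ≡ n * ((k * X) * (k * X)) + b * ((k * X) * (k * Y)) + c *
    ((k * Y) * (k * Y))
  scale-val = solve-∀

  bis-E : ∀ n b c x y ε c₁ X Y → c₁ * X ≡ + 1 + ε * x → c₁ * Y ≡ ε * y →
    c₁ * c₁ * (n * (X * X) + b * (X * Y) + c * (Y * Y)) ≡ + 2 * n + ε * (+ 2 * n * x + b * y) →
    c₁ * (c₁ * (n * (X * X) + b * (X * Y) + c * (Y * Y))) ≡ c₁ * (+ 2 * n * X + b * Y)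
  bis-E n b c x y ε c₁ X Y e f g = ringlc₃ (- (+ 2 * n)) (- b) (+ 1) e f g (solve (n ∷ b ∷ c ∷ x ∷ y ∷ ε ∷ c₁ ∷ X ∷ Y ∷ []))

  ΔYY : ∀ n b c X Y Δ → + 4 * (n * c) - b * b ≡ Δ →
    Δ * (Y * Y) ≡ + 4 * n * (n * (X * X) + b * (X * Y) + c * (Y * Y)) - (+ 2 * n * X + b * Y) * (+ 2 * n * X + b * Y)
  ΔYY n b c X Y Δ e = ringlc (- (Y * Y)) e (solve (n ∷ b ∷ c ∷ X ∷ Y ∷ Δ ∷ []))

  ΔXY : ∀ n b c X Y Δ → + 4 * (n * c) - b * b ≡ Δ →
    Δ * (X * Y) ≡ (b * X + + 2 * c * Y) * (+ 2 * n * X + b * Y) - + 2 * b * (n * (X * X) + b * (X * Y) + c * (Y * Y))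
  ΔXY n b c X Y Δ e = ringlc (- (X * Y)) e (solve (n ∷ b ∷ c ∷ X ∷ Y ∷ Δ ∷ []))

  Δn : ∀ n b c X Y Δ r s → X * s - Y * r ≡ + 1 →
    Δ * n ≡ s * s * (Δ * (n * (X * X) + b * (X * Y) + c * (Y * Y)) - b * (Δ * (X * Y)) - c * (Δ * (Y * Y)))
      + (r * r * n * (Δ * (Y * Y)) - + 2 * r * s * n * (Δ * (X * Y)))
  Δn n b c X Y Δ r s e = ringlc (- (Δ * n * (X * s - Y * r + + 1))) e (solve (n ∷ b ∷ c ∷ X ∷ Y ∷ Δ ∷ r ∷ s ∷ []))

module _ {Adm : ℤ → Set} {n b c x y : ℤ} (e : val n b c x y ≡ n) (B : Bisector Adm n b c x y) where
  open Bisector B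

  private
    A = val n b c X Y

  bisector-value : c₁ * c₁ * A ≡ + 2 * n + ε * (+ 2 * n * x + b * y)
  bisector-value = trans (scale-val n b c X Y c₁) (trans (cong₂ (val n b c) X≡ Y≡) (bis-val n b c x y ε c₁ X Y ε² e))

  -- v and ε w have the same value, so (X , Y) has the same inner product with both, namely E = c₁
  -- A. Hence A divides E, then Δ Y² and Δ X Y, and the relation X s - Y r = 1 recovers Δ n from
  -- these and Δ A.
  bisector-∣ : ∀ {Δ} → + 4 * (n * c) - b * b ≡ Δ → A ∣ Δ * n
  bisector-∣ {Δ} disc = subst (A ∣_) (sym (Δn n b c X Y Δ r s us))
    (∣m∣n⇒∣m+n (∣n⇒∣m*n (s * s) (∣m∣n⇒∣m-n (∣m∣n⇒∣m-n (∣n⇒∣m*n Δ ∣-refl) (∣n⇒∣m*n b dXY)) (∣n⇒∣m*n c dYY)))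
      (∣m∣n⇒∣m-n (∣n⇒∣m*n (r * r * n) dYY) (∣n⇒∣m*n (+ 2 * r * s * n) dXY)))
    where
    r = proj₁ unimodular
    s = proj₁ (proj₂ unimodular)
    us = proj₂ (proj₂ unimodular)
    E = + 2 * n * X + b * Y
    E≡ : c₁ * A ≡ E
    E≡ = cancelˡ c₁ c₁≢0 (bis-E n b c x y ε c₁ X Y X≡ Y≡ bisector-value)
    A∣E : A ∣ E
    A∣E = divides c₁ (sym E≡)
    dYY : A ∣ Δ * (Y * Y)
    dYY = subst (A ∣_) (sym (ΔYY n b c X Y Δ disc)) (∣m∣n⇒∣m-n (∣n⇒∣m*n (+ 4 * n) ∣-refl) (∣n⇒∣m*n E A∣E))
    dXY : A ∣ Δ * (X * Y)
    dXY = subst (A ∣_) (sym (ΔXY n b c X Y Δ disc)) (∣m∣n⇒∣m-n (∣n⇒∣m*n (b * X + + 2 * c * Y) A∣E) (∣n⇒∣m*n (+ 2 * b) ∣-refl))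

record Equivalent (Δ n b c n₁ : ℤ) : Set where
  constructor equivalent
  field
    b₁ c₁ : ℤ
    disc₁ : + 4 * (n₁ * c₁) - b₁ * b₁ ≡ Δ
    count : ∀ {N k} → Count n₁ b₁ c₁ N k → Count n b c N k

equiv-refl : ∀ {Δ n b c} → + 4 * (n * c) - b * b ≡ Δ → Equivalent Δ n b c n
equiv-refl {b = b} {c} e = equivalent b c e (λ C → C)

equiv : ∀ {Δ n b c n₁} → + 4 * (n * c) - b * b ≡ Δ → ∀ x y → Unimodular x y → val n b c x y ≡ n₁ → Equivalent Δ n b c n₁
equiv {Δ} {n} {b} {c} disc x y uni refl = equivalent (ChangedBasis.b′ C) (ChangedBasis.c′ C) (trans (ChangedBasis.disc C) disc)
  (ChangedBasis.count C)
  where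
  C : ChangedBasis n b c x y
  C = changeBasis n b c x y uni

equiv-trans : ∀ {Δ n b c n₁ n₂} (E : Equivalent Δ n b c n₁) → Equivalent Δ n₁ (Equivalent.b₁ E) (Equivalent.c₁ E) n₂ →
  Equivalent Δ n b c n₂
equiv-trans E F = equivalent (Equivalent.b₁ F) (Equivalent.c₁ F) (Equivalent.disc₁ F)
  (λ C → Equivalent.count E (Equivalent.count F C))

primitive-value : ∀ {Δ n b c} → + 4 * (n * c) - b * b ≡ Δ → ∀ x y → ¬ n ≡ + 0 → val n b c x y ≡ n →
  ∃₂ λ k n₁ → n ≡ k * k * n₁ × Equivalent Δ n b c n₁ × (∀ {L} → IsPrime L → L ∣ x → L ∣ y → L ∣ k)
primitive-value {Δ} {n} {b} {c} disc x y n≢0 e = go (primitivePart x y nz)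
  where
  nz : ¬ (x ≡ + 0 × y ≡ + 0)
  nz (refl , refl) = n≢0 (trans (sym e) (val₀₀ n b c))
  go : PrimitivePart x y → ∃₂ λ k n₁ → n ≡ k * k * n₁ × Equivalent Δ n b c n₁ × (∀ {L} → IsPrime L → L ∣ x → L ∣ y → L ∣ k)
  go (primPart k X Y k≢0 ex ey uni) = k , val n b c X Y ,
    trans (sym e) (trans (cong₂ (val n b c) ex ey) (sym (scale-val n b c X Y k))) ,
    equiv disc X Y uni refl , common
    where
    common : ∀ {L} → IsPrime L → L ∣ x → L ∣ y → L ∣ k
    common {L} pL dx dy = from (euclid pL k X (subst (L ∣_) ex dx)) (euclid pL k Y (subst (L ∣_) ey dy))
      where
      from : L ∣ k ⊎ L ∣ X → L ∣ k ⊎ L ∣ Y → L ∣ k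
      from (inj₁ d) _ = d
      from _ (inj₁ d) = d
      from (inj₂ d) (inj₂ d′) = ⊥-elim (unimodular⇒noCommonPrime uni pL d d′)

record Split (P n : ℤ) (M : ℕ) : Set where
  constructor split
  field
    n′ : ℤ
    n≡ : n ≡ n′ * P ^ M
    ∤n′ : P ∤ n′

prime-abs>1 : ∀ {P} → IsPrime P → 1 ℕ.< abs P
prime-abs>1 (isPrime {p} pr) = ℕ.nonTrivial⇒n>1 p {{prime⇒nonTrivial pr}}
  

splitPower : ∀ {P} → IsPrime P → ∀ n → ¬ n ≡ + 0 → ∃ (Split P n)
splitPower {P} pP n n≢0 = <-rec Goal step (abs n) n refl n≢0
  where
  Goal : ℕ → Set
  Goal a = ∀ n → abs n ≡ a → ¬ n ≡ + 0 → ∃ (Split P n)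
  assoc : ∀ n A P → n * A * P ≡ n * (P * A)
  assoc = solve-∀
  step : ∀ a → (∀ {a′} → a′ ℕ.< a → Goal a′) → Goal a
  step a rec n ea n≢0 = go (P ∣? n)
    where
    lift : ∀ q → n ≡ q * P → ∃ (Split P q) → ∃ (Split P n)
    lift q e (M , split n′ f nd) = suc M , split n′ (trans e (trans (cong (_* P) f) (assoc n′ (P ^ M) P))) nd
    go : Dec (P ∣ n) → ∃ (Split P n)
    go (no nd) = 0 , split n (sym (ℤₚ.*-identityʳ n)) nd
    go (yes (divides q e)) = lift q e (rec smaller q refl q≢0)
      where
      q≢0 : ¬ q ≡ + 0
      q≢0 refl = n≢0 e
      smaller : abs q ℕ.< a
      smaller = subst (abs q ℕ.<_) (trans (sym (trans (cong abs e) (ℤₚ.abs-* q P))) ea)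
        (ℕₚ.m<m*n (abs q) (abs P) {{ℤ.≢-nonZero q≢0}} (prime-abs>1 pP))

split-unique-< : ∀ {P} → IsPrime P → ∀ {n n₁ k M M₁} → n ≡ k * k * n₁ → P ∣ k → Split P n M → Split P n₁ M₁ → M₁ ℕ.< M
split-unique-< {P} pP {n} {n₁} {k} {M} {M₁} e dk (split n′ f nd) (split n₁′ g _) = ℕₚ.≰⇒> λ M≤M₁ → nd (bad M≤M₁ dk)
  where
  rearr : ∀ q P n A B → q * P * (q * P) * (n * (A * B)) ≡ A * (q * q * n * B * P * P)
  rearr = solve-∀
  bad : M ℕ.≤ M₁ → P ∣ k → P ∣ n′
  bad le (divides q refl) = divides (q * q * n₁′ * P ^ o * P)
    (cancelˡ (P ^ M) (^≢0 (prime≢0 pP) M) (trans (ℤₚ.*-comm (P ^ M) n′) (trans (sym f) (trans e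
      (trans (cong (q * P * (q * P) *_) (trans g (cong (n₁′ *_) (trans (cong (P ^_) (sym eo)) (^-+ P M o)))))
        (rearr q P n₁′ (P ^ M) (P ^ o)))))))
    where
    o = proj₁ (ℕₚ.m≤n⇒∃[o]m+o≡n le)
    eo : M ℕ.+ o ≡ M₁
    eo = proj₂ (ℕₚ.m≤n⇒∃[o]m+o≡n le)

-- Descent

changeExponents : ∀ {P b m b′ m′} → + 4 * m - b * b ≡ + 4 * m′ - b′ * b′ → NormExponents P b m → NormExponents P b′ m′
changeExponents {P} {b} {m} {b′} {m′} e E = record
  { s = s ; s≥1 = s≥1
  ; multiples = λ i l → changeOrderBasis {P} {b} {m} {b′} {m′} e (multiples i l)
  ; generates = λ z l i → generates z l (changeOrderBasis {P} {b′} {m′} {b} {m} (sym e) i) }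
  where
  open NormExponents E

zero-or-positive : ∀ e → e ≡ 0 ⊎ 1 ℕ.≤ e
zero-or-positive zero = inj₁ refl
zero-or-positive (suc e) = inj₂ (s≤s z≤n)

sign∤ : ∀ {L} → IsPrime L → ∀ ε → ε * ε ≡ + 1 → L ∤ ε
sign∤ {L} pL ε e d = prime∤1 pL (subst (L ∣_) e (∣m⇒∣m*n ε d))

private
  switch-value : ∀ n′ b x u c₁ v₁ ε A E K → A * (+ 2 * (+ 1 + ε * x)) + ε * (b * u) ≡ K →
    c₁ * c₁ * v₁ ≡ + 2 * (n′ * E * A) + ε * (+ 2 * (n′ * E * A) * x + b * (n′ * E * u)) → c₁ * (c₁ * v₁) ≡ n′ * K * E
  switch-value n′ b x u c₁ v₁ ε A E K f e = ringlc₂ (n′ * E) (+ 1) f e (solve (n′ ∷ b ∷ x ∷ u ∷ c₁ ∷ v₁ ∷ ε ∷ A ∷ E ∷ K ∷ []))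

  one-combination : ∀ c₁ X ε x → c₁ * X ≡ + 1 + ε * x → + 1 ≡ c₁ * X - ε * x
  one-combination c₁ X ε x e = ringlc (- + 1) e (solve (c₁ ∷ X ∷ ε ∷ x ∷ []))

  cancel-power : ∀ c₁ q E K → c₁ * (c₁ * (q * E)) ≡ K * E → E * (c₁ * c₁ * q) ≡ E * K
  cancel-power c₁ q E K e = ringlc (+ 1) e (solve (c₁ ∷ q ∷ E ∷ K ∷ []))

  square-split : ∀ {P} → IsPrime P → ∀ e c₁ v₁ K → P ∤ c₁ → P ∤ K → c₁ * (c₁ * v₁) ≡ K * P ^ e → Split P v₁ e
  square-split {P} pP e c₁ v₁ K nc nK eq = go (^-∣-cancel pP nc e v₁ (^-∣-cancel pP nc e (c₁ * v₁) (divides K eq))) eq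
    where
    go : P ^ e ∣ v₁ → c₁ * (c₁ * v₁) ≡ K * P ^ e → Split P v₁ e
    go (divides q refl) eq = split q refl
      (λ d → nK (subst (P ∣_) (cancelˡ (P ^ e) (^≢0 (prime≢0 pP) e) (cancel-power c₁ q (P ^ e) K eq)) (∣n⇒∣m*n (c₁ * c₁) d)))

  -- The value of v + ε w is n′ P^e K, where K ≡ ε b u modulo P is prime to P. So is c₁: for e = 0
  -- because c₁² v₁ = n′ K, and for e ≥ 1 because P ∣ x makes c₁ X = 1 + ε x prime to P.
  bisector-split : ∀ {P} → IsPrime P → ∀ n′ e A b u x ε c₁ X v₁ n y → P ∤ n′ → P ∣ A → P ∤ b → P ∤ u → ε * ε ≡ + 1 →
    n ≡ n′ * P ^ e * A → y ≡ n′ * P ^ e * u → c₁ * X ≡ + 1 + ε * x → (1 ℕ.≤ e → P ∣ x) →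
    c₁ * c₁ * v₁ ≡ + 2 * n + ε * (+ 2 * n * x + b * y) → Split P v₁ e
  bisector-split {P} pP n′ e A b u x ε c₁ X v₁ n y nn′ dA nb nu ε² refl refl eX dx ev =
    withK (A * (+ 2 * (+ 1 + ε * x)) + ε * (b * u)) refl nK₁
    where
    nK₁ : P ∤ A * (+ 2 * (+ 1 + ε * x)) + ε * (b * u)
    nK₁ d = ∤-* pP ε (b * u) (sign∤ pP ε ε²) (∤-* pP b u nb nu)
      (∣m+n∣m⇒∣n {P} {A * (+ 2 * (+ 1 + ε * x))} {ε * (b * u)} d (∣m⇒∣m*n (+ 2 * (+ 1 + ε * x)) dA))
    withK : ∀ K → A * (+ 2 * (+ 1 + ε * x)) + ε * (b * u) ≡ K → P ∤ K → Split P v₁ e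
    withK K eK nK = square-split pP e c₁ v₁ (n′ * K) nc (∤-* pP n′ K nn′ nK) ccv
      where
      ccv : c₁ * (c₁ * v₁) ≡ n′ * K * P ^ e
      ccv = switch-value n′ b x u c₁ v₁ ε A (P ^ e) K eK ev
      nc : P ∤ c₁
      nc d = [ shallow , deep ]′ (zero-or-positive e)
        where
        shallow : e ≡ 0 → ⊥
        shallow q = ∤-* pP n′ K nn′ nK (subst (P ∣_)
          (trans ccv (trans (cong (λ i → n′ * K * P ^ i) q) (ℤₚ.*-identityʳ (n′ * K)))) (∣m⇒∣m*n (c₁ * v₁) d))
        deep : 1 ℕ.≤ e → ⊥
        deep l = prime∤1 pP (subst (P ∣_) (sym (one-combination c₁ X ε x eX)) (∣m∣n⇒∣m-n (∣m⇒∣m*n X d) (∣n⇒∣m*n ε (dx l))))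

private
  middle-eq : ∀ n b c x y → n * (x * x) + b * (x * y) + c * (y * y) ≡ n → y * (b * x + c * y) ≡ n * (+ 1 - x * x)
  middle-eq n b c x y e = ringlc (+ 1) e (solve (n ∷ b ∷ c ∷ x ∷ y ∷ []))

  gcd-cancelled : ∀ g r y₁ A Z w → g * y₁ * Z ≡ g * r * A * w → g * (y₁ * Z) ≡ g * (A * w * r)
  gcd-cancelled g r y₁ A Z w e = ringlc (+ 1) e (solve (g ∷ r ∷ y₁ ∷ A ∷ Z ∷ w ∷ []))

  b-sq : ∀ n b c Δ → + 4 * (n * c) - b * b ≡ Δ → b * b ≡ + 4 * (n * c) - Δ
  b-sq n b c Δ e = ringlc (- + 1) e (solve (n ∷ b ∷ c ∷ Δ ∷ []))

  square-disc₁ : ∀ n b c L → + 4 * ((n * L) * (c * L)) - (b * L) * (b * L) ≡ L * L * (+ 4 * (n * c) - b * b)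
  square-disc₁ = solve-∀

  square-disc₂ : ∀ n b c L → + 4 * ((n * (L * L)) * c) - (b * L) * (b * L) ≡ L * L * (+ 4 * (n * c) - b * b)
  square-disc₂ = solve-∀

  cy≡ : ∀ b c x y → (b * x + c * y) - b * x ≡ c * y
  cy≡ = solve-∀

  bx≡ : ∀ b c x y → (b * x + c * y) - c * y ≡ b * x
  bx≡ = solve-∀

  bisector-by : ∀ n b x y ε v₁ → ε * ε ≡ + 1 → v₁ ≡ + 2 * n + ε * (+ 2 * n * x + b * y) →
    b * y ≡ ε * v₁ - n * (+ 2 * ε + + 2 * x)
  bisector-by n b x y ε v₁ e f = ringlc₂ (- (+ 2 * n * x + b * y)) (- ε) e f (solve (n ∷ b ∷ x ∷ y ∷ ε ∷ v₁ ∷ []))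

record BadPrime (n′ b c x y : ℤ) : Set where
  field
    L : ℤ
    pL : IsPrime L
    L∣n′ : L ∣ n′
    L∣Z : L ∣ b * x + c * y
    L²∣n′ : L ∣ y → L * L ∣ n′

-- L is a prime factor of n′ / g, where g is the gcd of n′ and y. It does not divide y / g, so the
-- equation y (b x + c y) = n′ A (1 - x²), divided by g, puts L into b x + c y. If L ∣ y, then L ∣
-- g, which gives the square.
badPrime : ∀ n′ A b c x y → ¬ n′ ≡ + 0 → val (n′ * A) b c x y ≡ n′ * A → n′ ∤ y → BadPrime n′ b c x y
badPrime n′ A b c x y n′≢0 e n′∤y = fromBezout (bezout n′ y)
  where
  fromBezout : Bezout n′ y → BadPrime n′ b c x y
  fromBezout (bez g r y₁ r′ s en ey cb) = fromDivisor (unit-or-prime-divisor r)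
    where
    g≢0 : ¬ g ≡ + 0
    g≢0 q = n′≢0 (trans en (trans (cong (_* r) q) (ℤₚ.*-zeroˡ r)))
    uni : Unimodular r y₁
    uni = r′ , s , cancelˡ g g≢0 (factor-gcd g r y₁ r′ s y n′ cb en ey)
    Z = b * x + c * y
    y₁Z : y₁ * Z ≡ A * (+ 1 - x * x) * r
    y₁Z = cancelˡ g g≢0 (gcd-cancelled g r y₁ A Z (+ 1 - x * x)
      (trans (cong (_* Z) (sym ey)) (trans (middle-eq (n′ * A) b c x y e) (cong (λ m → m * A * (+ 1 - x * x)) en))))
    fromDivisor : (r ∣ + 1 ⊎ ∃ λ L → IsPrime L × L ∣ r) → BadPrime n′ b c x y
    fromDivisor (inj₁ r∣1) = ⊥-elim
      (n′∤y (subst₂ _∣_ (sym en) (sym ey) (*-monoʳ-∣ g (∣-trans r∣1 (divides y₁ (sym (ℤₚ.*-identityʳ y₁)))))))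
    fromDivisor (inj₂ (L , pL , L∣r)) = record
      { L = L ; pL = pL ; L∣n′ = subst (L ∣_) (sym en) (∣n⇒∣m*n g L∣r)
      ; L∣Z = euclid′ pL L∤y₁ Z (subst (L ∣_) (sym y₁Z) (∣n⇒∣m*n (A * (+ 1 - x * x)) L∣r))
      ; L²∣n′ = λ d → L²∣ (euclid pL g y₁ (subst (L ∣_) ey d)) }
      where
      L∤y₁ : L ∤ y₁
      L∤y₁ = unimodular⇒noCommonPrime uni pL L∣r
      L²∣ : L ∣ g ⊎ L ∣ y₁ → L * L ∣ n′
      L²∣ (inj₁ d) = subst (L * L ∣_) (sym en) (∣-trans (*-monoʳ-∣ L L∣r) (*-monoˡ-∣ r d))
      L²∣ (inj₂ d) = ⊥-elim (L∤y₁ d)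

-- L divides b, and then c y. Either L divides all three coefficients, or L² ∣ n and (n / L² , b / L
-- , c) is integral; in both cases Δ / L² is 4 k - b₁² for an integral form.
nonmaximal : ∀ {L} → IsPrime L → ∀ n b c x y Δ → + 4 * (n * c) - b * b ≡ Δ → L ∣ Δ → L ∣ n → L ∣ b * x + c * y →
  (L ∣ y → L * L ∣ n) →
  ∃₂ λ k b₁ → Δ ≡ L * L * (+ 4 * k - b₁ * b₁)
nonmaximal {L} pL n b c x y Δ disc dΔ dn dZ L² = go (euclid-sq pL b L∣bb)
  where
  L∣bb : L ∣ b * b
  L∣bb = subst (L ∣_) (sym (b-sq n b c Δ disc)) (∣m∣n⇒∣m-n (∣n⇒∣m*n (+ 4) (∣m⇒∣m*n c dn)) dΔ)
  Goal : Set
  Goal = ∃₂ λ k b₁ → Δ ≡ L * L * (+ 4 * k - b₁ * b₁)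
  go : L ∣ b → Goal
  go db = [ (λ dc → bothDivisible db dn dc) , (λ dy → squareDivides db (L² dy)) ]′
    (euclid pL c y (subst (L ∣_) (cy≡ b c x y) (∣m∣n⇒∣m-n dZ (∣m⇒∣m*n x db))))
    where
    bothDivisible : L ∣ b → L ∣ n → L ∣ c → Goal
    bothDivisible (divides b₁ eb) (divides n₁ en) (divides c₁ ec) = n₁ * c₁ , b₁ ,
      trans (sym disc) (trans (cong₂ _-_ (cong (+ 4 *_) (cong₂ _*_ en ec)) (cong₂ _*_ eb eb)) (square-disc₁ n₁ b₁ c₁ L))
    squareDivides : L ∣ b → L * L ∣ n → Goal
    squareDivides (divides b₁ eb) (divides n₁ en) = n₁ * c , b₁ ,
      trans (sym disc) (trans (cong₂ _-_ (cong (λ m → + 4 * (m * c)) en) (cong₂ _*_ eb eb)) (square-disc₂ n₁ b₁ c L))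

∣-coprime-cancel : ∀ {L} → IsPrime L → ∀ v X → L ∤ v → v ∣ X * L → v ∣ X
∣-coprime-cancel {L} pL v X nv (divides w e) = go (euclid pL w v (subst (L ∣_) e (divides X refl)))
  where
  swap : ∀ q L v → q * L * v ≡ L * (q * v)
  swap = solve-∀
  go : L ∣ w ⊎ L ∣ v → v ∣ X
  go (inj₂ d) = ⊥-elim (nv d)
  go (inj₁ (divides q f)) = divides q
    (cancelˡ L (prime≢0 pL) (trans (ℤₚ.*-comm L X) (trans e (trans (cong (_* v) f) (swap q L v)))))

prime∣pos : ∀ {L} → IsPrime L → ∀ m → 1 ℕ.≤ m → L ∣ + m → ∃ λ q → 1 ℕ.≤ q × q ℕ.< m × + m ≡ + q * L
prime∣pos (isPrime {p} pr) m lm d = go (∣⇒∣ᵤ d)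
  where
  go : p ℕ∣.∣ m → ∃ λ q → 1 ℕ.≤ q × q ℕ.< m × + m ≡ + q * + p
  go (ℕ∣.divides zero e) = contradiction (subst (1 ℕ.≤_) e lm) ℕₚ.n≮0
  go (ℕ∣.divides (suc q) e) = suc q , s≤s z≤n , subst (suc q ℕ.<_) (sym e)
    (ℕₚ.m<m*n (suc q) p (prime-abs>1 (isPrime pr))) , trans (cong +_ e) (ℤₚ.pos-* (suc q) p)

module Descent {Δ : ℤ} {Adm : ℤ → Set} (admissible : Admissible Δ Adm) {P : ℤ} (pP : IsPrime P) (P∤Δ : P ∤ Δ)
  {b₀ m₀ : ℤ} (disc₀ : + 4 * m₀ - b₀ * b₀ ≡ Δ) (exponents : NormExponents P b₀ m₀) (d : ℕ) (Δ≡ : Δ ≡ + suc d) (k : ℕ) where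

  open Admissible admissible
  open NormExponents exponents

  T = P * Δ

  -- m bounds the part of n prime to P and Δ; the descent is on m.
  Level : ℕ → ℤ → Set
  Level m n = ∃ λ N → n ∣ + m * T ^ N

  record Facts (m M : ℕ) (n b c : ℤ) : Set where
    constructor facts
    field
      disc : + 4 * (n * c) - b * b ≡ Δ
      adm : Adm n
      splits : Split P n M
      level : Level m n

  record Reach (n b c : ℤ) (m M : ℕ) : Set where
    constructor reach
    field
      n₁ : ℤ
      equivalence : Equivalent Δ n b c n₁
      adm : Adm n₁
      splits : Split P n₁ M
      level : Level m n₁
    open Equivalent equivalence public using (b₁; c₁; disc₁)
    reached : Facts m M n₁ b₁ c₁
    reached = facts disc₁ adm splits level

  stay : ∀ {m M n b c} → Facts m M n b c → Reach n b c m M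
  stay {n = n} {b} {c} (facts d a s l) = reach n (equiv-refl {Δ} {n} {b} {c} d) a s l

  infixl 1 _then_
  _then_ : ∀ {n b c m M m′ M′} (R : Reach n b c m M) →
    (Facts m M (Reach.n₁ R) (Reach.b₁ R) (Reach.c₁ R) → Reach (Reach.n₁ R) (Reach.b₁ R) (Reach.c₁ R) m′ M′) →
    Reach n b c m′ M′
  R then f = reach (Reach.n₁ R′) (equiv-trans (Reach.equivalence R) (Reach.equivalence R′)) (Reach.adm R′) (Reach.splits R′)
    (Reach.level R′)
    where
    R′ = f (Reach.reached R)

  private
    P≢0 : ¬ P ≡ + 0
    P≢0 = prime≢0 pP

    ∣Tᴺ : ∀ {d} → d ∣ T → ∀ i → d ^ i ∣ T ^ i
    ∣Tᴺ d∣T zero = ∣-refl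
    ∣Tᴺ {d} d∣T@(divides q e) (suc i) = ∣-trans (*-monoʳ-∣ d (∣Tᴺ d∣T i))
      (divides q (trans (cong (_* T ^ i) e) (ℤₚ.*-assoc q d (T ^ i))))

    P∣T : P ∣ T
    P∣T = divides Δ (ℤₚ.*-comm P Δ)

    Δ∣T : Δ ∣ T
    Δ∣T = divides P refl

    level-∣ : ∀ m n n₁ i → n₁ ∣ n * T ^ i → Level m n → Level m n₁
    level-∣ m n n₁ i d (N , e) = N ℕ.+ i , ∣-trans d (∣-trans (*-monoˡ-∣ (T ^ i) {n} {+ m * T ^ N} e) (∣-reflexive dvd))
      where
      dvd : + m * T ^ N * T ^ i ≡ + m * T ^ (N ℕ.+ i)
      dvd = trans (ℤₚ.*-assoc (+ m) (T ^ N) (T ^ i)) (cong (+ m *_) (sym (^-+ T N i)))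

    level-∣′ : ∀ m n n₁ → n₁ ∣ n → Level m n → Level m n₁
    level-∣′ m n n₁ d (N , e) = N , ∣-trans d e

    n≡0⊥ : ∀ {m M n b c} → Facts m M n b c → ¬ n ≡ + 0
    n≡0⊥ F = adm≢0 (Facts.adm F)

    ^≡split : ∀ {n M} (S : Split P n M) → 1 ℕ.≤ M → P ∣ n
    ^≡split {M = M} (split n′ e _) l = subst (P ∣_) (sym e) (∣n⇒∣m*n n′ (base∣^ P l))

    P∤middle : ∀ n b c → + 4 * (n * c) - b * b ≡ Δ → P ∣ n → P ∤ b
    P∤middle n b c e dn db = P∤Δ (subst (P ∣_) e (∣m∣n⇒∣m-n (∣n⇒∣m*n (+ 4) (∣m⇒∣m*n c dn)) (∣m⇒∣m*n b db)))

    elementAt : ∀ n b c → + 4 * (n * c) - b * b ≡ Δ → ∀ z → InS P b₀ m₀ z → NormElement P b (n * c) (P ^ (z ℕ.+ z))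
    elementAt n b c e z = changeOrderBasis {P} {b₀} {m₀} {b} {n * c} (trans disc₀ (sym e))

    only-P : ∀ {L} → IsPrime L → ∀ i → L ∣ P ^ i → L ≡ P
    only-P pL i d = prime-∣-prime pP pL (prime-∣-^ pL i d)

    orbit-value : ∀ n b c h u N → h * h + b * h * u + (n * c) * u * u ≡ N →
      n * (h * h) + b * (h * (n * u)) + c * ((n * u) * (n * u)) ≡ n * N
    orbit-value n b c h u N e = ringlc n e (solve (n ∷ b ∷ c ∷ h ∷ u ∷ N ∷ []))

    norm-split : ∀ n b c h u N → h * h + b * h * u + (n * c) * u * u ≡ N → N ≡ h * (h + b * u) + (n * u) * (c * u)
    norm-split n b c h u N e = ringlc (- + 1) e (solve (n ∷ b ∷ c ∷ h ∷ u ∷ N ∷ []))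

    -- h + u ω carries (1 , 0) to (h , n u) and multiplies values by its norm. A common prime of h
    -- and n u divides that norm P^i, so primitivity is in question at P only.
    place : ∀ n b c → + 4 * (n * c) - b * b ≡ Δ → ∀ i h u → h * h + b * h * u + (n * c) * u * u ≡ P ^ i →
      (P ∣ h → P ∣ n * u → ⊥) →
      Equivalent Δ n b c (n * P ^ i)
    place n b c e i h u N cop = equiv {Δ} {n} {b} {c} {n * P ^ i} e h (n * u) (noCommonPrime⇒unimodular h (n * u) common)
      (orbit-value n b c h u (P ^ i) N)
      where
      common : ∀ {L} → IsPrime L → L ∣ h → L ∣ n * u → ⊥
      common {L} pL dh du = at (only-P pL i (subst (L ∣_) (sym (norm-split n b c h u (P ^ i) N))
          (∣m∣n⇒∣m+n (∣m⇒∣m*n (h + b * u) dh) (∣m⇒∣m*n (c * u) du)))) dh du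
        where
        at : L ≡ P → L ∣ h → L ∣ n * u → ⊥
        at refl = cop

    split-* : ∀ {n M} i → Split P n M → Split P (n * P ^ i) (M ℕ.+ i)
    split-* {n} {M} i (split n′ e nd) = split n′
      (trans (cong (_* P ^ i) e) (trans (ℤₚ.*-assoc n′ (P ^ M) (P ^ i)) (cong (n′ *_) (sym (^-+ P M i))))) nd

  up : ∀ {m M n b c} z → InS P b₀ m₀ z → Facts m M n b c → Reach n b c m (M ℕ.+ (z ℕ.+ z))
  up {m} {M} {n} {b} {c} z is (facts disc adm S level) = reach (n * P ^ i) (byDepth M S)
    (adm-∣ pP P∤Δ i n (n * P ^ i) adm ∣-refl)
      (split-* i S) (level-∣ m n (n * P ^ i) i (*-monoʳ-∣ n (∣Tᴺ P∣T i)) level)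
    where
    i = z ℕ.+ z
    N = P ^ i
    α : NormElement P b (n * c) N
    α = elementAt n b c disc z is
    -- For M = 0 the coordinate n u is prime to P. For M > 0 it is not, and the conjugate is chosen
    -- so that the first coordinate is.
    byDepth : ∀ M → Split P n M → Equivalent Δ n b c (n * N)
    byDepth zero (split n′ e nd) = place n b c disc i h u norm
      (λ _ → ∤-* pP n u (λ d → nd (subst (P ∣_) (trans e (ℤₚ.*-identityʳ n′)) d)) ∤u)
      where
      open NormElement α
    byDepth (suc M) S = conjugate (orient pP b (n * c) N (P∤middle n b c disc (^≡split S (s≤s z≤n))) α)
      where
      conjugate : Oriented P b (n * c) N → Equivalent Δ n b c (n * N)
      conjugate (oriented h u norm _ nh̄) = place n b c disc i (h + b * u) (- u) (conj-norm b (n * c) h u N norm)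
        (λ d _ → nh̄ d)

  private
    flip-norm : ∀ b c x u n₀ A R → x * A * (x * A) + b * (x * A) * u + (n₀ * A * c) * u * u ≡ A * R →
      A * (A * x * x + b * x * u + n₀ * c * u * u) ≡ A * R
    flip-norm b c x u n₀ A R e = ringlc (+ 1) e (solve (b ∷ c ∷ x ∷ u ∷ n₀ ∷ A ∷ R ∷ []))

    flip-value : ∀ b c x u n₀ A R → A * x * x + b * x * u + n₀ * c * u * u ≡ R →
      (n₀ * A) * (x * x) + b * (x * (n₀ * u)) + c * ((n₀ * u) * (n₀ * u)) ≡ n₀ * R
    flip-value b c x u n₀ A R e = ringlc n₀ e (solve (b ∷ c ∷ x ∷ u ∷ n₀ ∷ A ∷ R ∷ []))

    flip-split : ∀ b c x u n₀ A R → A * x * x + b * x * u + n₀ * c * u * u ≡ R → R ≡ x * (A * x + b * u) + (n₀ * u) * (c * u)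
    flip-split b c x u n₀ A R e = ringlc (- + 1) e (solve (b ∷ c ∷ x ∷ u ∷ n₀ ∷ A ∷ R ∷ []))

  -- This uses the conjugate of the element that `up` takes for M > 0. Now P^M divides h, so (h , n
  -- u) is P^M times the primitive vector (x , n′ u), of value n P^2z / P^2M. The exponent M becomes
  -- 2 z - M.
  flip : ∀ {m M n b c} z → InS P b₀ m₀ z → 1 ℕ.≤ M → ∀ e → M ℕ.+ e ≡ z ℕ.+ z → Facts m M n b c → Reach n b c m e
  flip {m} {M} {n} {b} {c} z is lM e Me (facts disc adm S@(split n′ refl nd) level) =
    reach (n′ * R) (fromOriented (orient pP b (n * c) (A * R) (P∤middle n b c disc (^≡split S lM)) α))
      (adm-∣ pP P∤Δ e n (n′ * R) adm R∣) (split n′ refl nd)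
        (level-∣ m n (n′ * R) e (∣-trans R∣ (*-monoʳ-∣ n (∣Tᴺ P∣T e))) level)
    where
    A = P ^ M
    R = P ^ e
    R∣ : n′ * R ∣ n′ * A * R
    R∣ = divides A (lem n′ A R)
      where
      lem : ∀ n A R → n * A * R ≡ A * (n * R)
      lem = solve-∀
    α : NormElement P b (n * c) (A * R)
    α = subst (NormElement P b (n * c)) (trans (cong (P ^_) (sym Me)) (^-+ P M e)) (elementAt n b c disc z is)
    fromOriented : Oriented P b (n * c) (A * R) → Equivalent Δ n b c (n′ * R)
    fromOriented (oriented h u norm nu nh̄) = go
      (^-∣-cancel pP nh̄ M h (divides (R - n′ * c * u * u) (hh̄ b c h u n′ A R norm))) norm
      where
      go : A ∣ h → h * h + b * h * u + (n′ * A * c) * u * u ≡ A * R → Equivalent Δ n b c (n′ * R)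
      go (divides x refl) norm = equiv {Δ} {n} {b} {c} {n′ * R} disc x (n′ * u) (noCommonPrime⇒unimodular x (n′ * u) common)
        (flip-value b c x u n′ A R N)
        where
        N : A * x * x + b * x * u + n′ * c * u * u ≡ R
        N = cancelˡ A (^≢0 P≢0 M) (flip-norm b c x u n′ A R norm)
        common : ∀ {L} → IsPrime L → L ∣ x → L ∣ n′ * u → ⊥
        common {L} pL dx du = at (only-P pL e (subst (L ∣_) (sym (flip-split b c x u n′ A R N))
            (∣m∣n⇒∣m+n (∣m⇒∣m*n (A * x + b * u) dx) (∣m⇒∣m*n (c * u) du)))) du
          where
          at : L ≡ P → L ∣ n′ * u → ⊥
          at refl = ∤-* pP n′ u nd nu

  -- A vector of the least positive depth s exists as soon as the exponent of P is at least s.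
  -- `down` divides it by its content, and `switch` bisects it with (1 , 0).
  module Shallow {m e : ℕ} {n b c : ℤ} (F : Facts m (s ℕ.+ e) n b c) where
    open Facts F
    open Split splits
    n₀ = n′ * P ^ e
    A = P ^ s

    n≡n₀A : n ≡ n₀ * A
    n≡n₀A = trans n≡ (trans (cong (n′ *_) (^-+ P s e)) (lem n′ A (P ^ e)))
      where
      lem : ∀ n A E → n * (A * E) ≡ n * E * A
      lem = solve-∀

    P∣n : P ∣ n
    P∣n = ^≡split splits (ℕₚ.≤-trans s≥1 (ℕₚ.m≤m+n s e))

    P∤b : P ∤ b
    P∤b = P∤middle n b c disc P∣n

    v : DepthVector P b c n₀ A
    v = norm⇒depthVector pP b c n₀ s (orient pP b (n₀ * A * c) (A * A) P∤b
      (subst₂ (λ m N → NormElement P b (m * c) N) n≡n₀A (^-+ P s s)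
        (elementAt n b c disc s (subst (InS P b₀ m₀) (ℕₚ.+-identityʳ s) (multiples 1 (s≤s z≤n))))))
    open DepthVector v public

    y = n₀ * u

    v-value : val n b c x y ≡ n
    v-value = subst (λ m → val m b c x y ≡ m) (sym n≡n₀A) (depth-value b c x u n₀ A eq)

    P∣x : 1 ℕ.≤ e → P ∣ x
    P∣x l = depthVector-∣x pP b c n₀ A (∣n⇒∣m*n n′ (base∣^ P l)) (base∣^ P s≥1) P∤b v

    n₀≢0 : ¬ n₀ ≡ + 0
    n₀≢0 q = n≡0⊥ F (trans n≡n₀A (trans (cong (_* A) q) (ℤₚ.*-zeroˡ A)))

  down : ∀ {m e n b c} → 1 ℕ.≤ e → Facts m (s ℕ.+ e) n b c → ∃ λ M → M ℕ.< s ℕ.+ e × Reach n b c m M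
  down {m} {e} {n} {b} {c} l F = from (primitive-value {Δ} {n} {b} {c} disc x y (n≡0⊥ F) v-value)
    where
    open Facts F
    open Shallow F
    P∣y : P ∣ y
    P∣y = ∣m⇒∣m*n u (∣n⇒∣m*n (Split.n′ splits) (base∣^ P l))
    from : (∃₂ λ k n₁ → n ≡ k * k * n₁ × Equivalent Δ n b c n₁ × (∀ {L} → IsPrime L → L ∣ x → L ∣ y → L ∣ k)) →
      ∃ λ M → M ℕ.< s ℕ.+ e × Reach n b c m M
    from (k , n₁ , f , E , common) = fromSplit (splitPower pP n₁ (adm≢0 adm₁))
      where
      n₁∣n : n₁ ∣ n
      n₁∣n = divides (k * k) f
      adm₁ : Adm n₁
      adm₁ = adm-∣ pP P∤Δ 0 n n₁ adm (∣m⇒∣m*n (+ 1) n₁∣n)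
      fromSplit : ∃ (Split P n₁) → ∃ λ M → M ℕ.< s ℕ.+ e × Reach n b c m M
      fromSplit (M , S₁) = M , split-unique-< pP f (common pP (P∣x l) P∣y) splits S₁ , reach n₁ E adm₁ S₁
        (level-∣′ m n n₁ n₁∣n level)

  -- Bisecting the basis vector and a vector of depth s moves the exponent of P by s.
  switch : ∀ {m n b c} e → Facts m (s ℕ.+ e) n b c → Reach n b c m e
  switch {m} {n} {b} {c} e F = from (bisect n b c x y disc adm v-value y≢0)
    where
    open Facts F
    open Shallow F
    open Split splits
    u≢0 : ¬ u ≡ + 0
    u≢0 q = ∤u (subst (P ∣_) (sym q) (divides (+ 0) refl))
    y≢0 : ¬ y ≡ + 0
    y≢0 = *≢0 n₀≢0 u≢0
    Δn∣nT : Δ * n ∣ n * T ^ 1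
    Δn∣nT = subst₂ _∣_ (ℤₚ.*-comm n Δ) (cong (n *_) (sym (ℤₚ.*-identityʳ T))) (*-monoʳ-∣ n Δ∣T)
    from : Bisector Adm n b c x y → Reach n b c m e
    from B = reach v₁ (equiv {Δ} {n} {b} {c} {v₁} disc X Y unimodular refl) (Bisector.adm B)
      (bisector-split pP n′ e A b u x ε c₁ X v₁ n y ∤n′ (base∣^ P s≥1) P∤b ∤u ε² n≡n₀A refl X≡ P∣x
        (bisector-value {Adm} {n} {b} {c} {x} {y} v-value B))
      (level-∣ m n v₁ 1 (∣-trans (bisector-∣ {Adm} {n} {b} {c} {x} {y} v-value B disc) Δn∣nT) level)
      where
      open Bisector B hiding (adm)
      v₁ = val n b c X Y

  lower : ∀ {m M n b c} → Facts m M n b c → ∃ λ M′ → M′ ℕ.≤ s × Reach n b c m M′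
  lower {m} {M} = <-rec Goal step M
    where
    Goal : ℕ → Set
    Goal M = ∀ {n b c} → Facts m M n b c → ∃ λ M′ → M′ ℕ.≤ s × Reach n b c m M′
    step : ∀ M → (∀ {M′} → M′ ℕ.< M → Goal M′) → Goal M
    step M rec {n} {b} {c} F = go (M ℕ.≤? s)
      where
      go : Dec (M ℕ.≤ s) → ∃ λ M′ → M′ ℕ.≤ s × Reach n b c m M′
      go (yes l) = M , l , stay F
      go (no nl) = below (ℕₚ.m≤n⇒∃[o]m+o≡n (ℕₚ.≰⇒> nl))
        where
        below : (∃ λ o → suc s ℕ.+ o ≡ M) → ∃ λ M′ → M′ ℕ.≤ s × Reach n b c m M′
        below (o , e) = continue (down {e = suc o} (s≤s z≤n)
          (subst (λ M → Facts m M n b c) (trans (sym e) (sym (ℕₚ.+-suc s o))) F))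
          where
          continue : (∃ λ M′ → M′ ℕ.< s ℕ.+ suc o × Reach n b c m M′) → ∃ λ M′ → M′ ℕ.≤ s × Reach n b c m M′
          continue (M₁ , l₁ , R) = finish (rec (subst (M₁ ℕ.<_) (trans (ℕₚ.+-suc s o) e) l₁) (Reach.reached R))
            where
            finish : (∃ λ M′ → M′ ℕ.≤ s × Reach (Reach.n₁ R) (Reach.b₁ R) (Reach.c₁ R) m M′) → ∃ λ M′ →
              M′ ℕ.≤ s × Reach n b c m M′
            finish (M₂ , l₂ , R′) = M₂ , l₂ , (R then λ _ → R′)

  -- The number of multiples of s in [0 , M] is k + 1.
  InWindow : ℕ → ℕ → Set
  InWindow k M = k ℕ.* s ℕ.≤ M × M ℕ.< suc k ℕ.* s

  private

    even-low : ∀ j s M → M ℕ.+ (j ℕ.* s ℕ.+ j ℕ.* s) ≡ (j ℕ.+ j) ℕ.* s ℕ.+ M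
    even-low = solveℕ-∀

    even-high : ∀ j s → suc (j ℕ.+ j) ℕ.* s ≡ (j ℕ.+ j) ℕ.* s ℕ.+ s
    even-high = solveℕ-∀

    odd-sum : ∀ j s M e → s ≡ M ℕ.+ e → M ℕ.+ (suc (j ℕ.+ j) ℕ.* s ℕ.+ e) ≡ suc j ℕ.* s ℕ.+ suc j ℕ.* s
    odd-sum j .(M ℕ.+ e) M e refl = lem j M e
      where
      lem : ∀ j M e → M ℕ.+ (suc (j ℕ.+ j) ℕ.* (M ℕ.+ e) ℕ.+ e) ≡ suc j ℕ.* (M ℕ.+ e) ℕ.+ suc j ℕ.* (M ℕ.+ e)
      lem = solveℕ-∀

    odd-high : ∀ j s → suc (suc (j ℕ.+ j)) ℕ.* s ≡ suc (j ℕ.+ j) ℕ.* s ℕ.+ s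
    odd-high = solveℕ-∀

    parity : ∀ k → ∃ λ j → k ≡ j ℕ.+ j ⊎ k ≡ suc (j ℕ.+ j)
    parity zero = 0 , inj₁ refl
    parity (suc k) with parity k
    ... | j , inj₁ e = j , inj₂ (cong suc e)
    ... | j , inj₂ e = suc j , inj₁ (trans (cong suc e) (cong suc (sym (ℕₚ.+-suc j j))))

    inS-multiple : ∀ j → InS P b₀ m₀ (suc j ℕ.* s)
    inS-multiple j = multiples (suc j) (s≤s z≤n)

    inS-s : InS P b₀ m₀ s
    inS-s = subst (InS P b₀ m₀) (ℕₚ.+-identityʳ s) (inS-multiple 0)

  Windowed : ℕ → ℕ → (n b c : ℤ) → Set
  Windowed k m n b c = ∃ λ M → InWindow k M × Reach n b c m M

  -- `up` preserves M modulo 2 s, so an M in [0 , s) reaches every window of even index.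
  window-even : ∀ j {m M n b c} → M ℕ.< s → Facts m M n b c → Windowed (j ℕ.+ j) m n b c
  window-even zero {M = M} l F = M , (z≤n , subst (M ℕ.<_) (sym (ℕₚ.+-identityʳ s)) l) , stay F
  window-even (suc i) {M = M} l F = M′ , subst (InWindow (j ℕ.+ j)) (sym (even-low j s M)) (below , above) , up (j ℕ.* s)
    (inS-multiple i) F
    where
    j = suc i
    M′ = M ℕ.+ (j ℕ.* s ℕ.+ j ℕ.* s)
    below : (j ℕ.+ j) ℕ.* s ℕ.≤ (j ℕ.+ j) ℕ.* s ℕ.+ M
    below = ℕₚ.m≤m+n ((j ℕ.+ j) ℕ.* s) M
    above : (j ℕ.+ j) ℕ.* s ℕ.+ M ℕ.< suc (j ℕ.+ j) ℕ.* s
    above = subst ((j ℕ.+ j) ℕ.* s ℕ.+ M ℕ.<_) (sym (even-high j s)) (ℕₚ.+-monoʳ-< ((j ℕ.+ j) ℕ.* s) l)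

  -- `flip` sends M to - M modulo 2 s, so an M in (0 , s] reaches every window of odd index.
  window-odd : ∀ j {m M n b c} → 1 ℕ.≤ M → M ℕ.≤ s → Facts m M n b c → Windowed (suc (j ℕ.+ j)) m n b c
  window-odd j {m} {M} {n} {b} {c} lM Ms F = go (ℕₚ.m≤n⇒∃[o]m+o≡n Ms)
    where
    K = suc (j ℕ.+ j) ℕ.* s
    go : (∃ λ e → M ℕ.+ e ≡ s) → Windowed (suc (j ℕ.+ j)) m n b c
    go (e , q) = K ℕ.+ e , (ℕₚ.m≤m+n K e , above) , flip (suc j ℕ.* s) (inS-multiple j) lM (K ℕ.+ e) (odd-sum j s M e (sym q)) F
      where
      above : K ℕ.+ e ℕ.< suc (suc (j ℕ.+ j)) ℕ.* s
      above = subst (K ℕ.+ e ℕ.<_) (sym (odd-high j s)) (ℕₚ.+-monoʳ-< K (subst (e ℕ.<_) q (ℕₚ.m<n+m e lM)))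

  infixl 1 _thenWindow_
  _thenWindow_ : ∀ {k n b c m M} (R : Reach n b c m M) →
    (Facts m M (Reach.n₁ R) (Reach.b₁ R) (Reach.c₁ R) → Windowed k m (Reach.n₁ R) (Reach.b₁ R) (Reach.c₁ R)) →
    Windowed k m n b c
  R thenWindow f = proj₁ W , proj₁ (proj₂ W) , (R then λ _ → proj₂ (proj₂ W))
    where
    W = f (Reach.reached R)

  private
    toZero : ∀ {m M n b c} → M ≡ s → Facts m M n b c → Reach n b c m 0
    toZero {m} {M} {n} {b} {c} e F = switch 0 (subst (λ M → Facts m M n b c) (trans e (sym (ℕₚ.+-identityʳ s))) F)

    fromZero : ∀ {m n b c} → Facts m 0 n b c → Reach n b c m s
    fromZero {m} {n} {b} {c} F = R then λ G → switch {m} {Reach.n₁ R} {Reach.b₁ R} {Reach.c₁ R} s G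
      where
      R : Reach n b c m (s ℕ.+ s)
      R = up {m} {0} {n} {b} {c} s inS-s F

  -- M = 0 and M = s are fixed by negation modulo 2 s, and each serves one parity only; the other
  -- parity needs `switch`. Since `switch` lowers the exponent by s, M = 0 is first raised to 2 s.
  window : ∀ k {m M n b c} → M ℕ.≤ s → Facts m M n b c → Windowed k m n b c
  window k {m} {M} {n} {b} {c} l F = go (parity k)
    where
    even : ∀ j → Dec (M ℕ.< s) → Windowed (j ℕ.+ j) m n b c
    even j (yes l<) = window-even j l< F
    even j (no nl) = _thenWindow_ {j ℕ.+ j} {n} {b} {c} {m} {0} R (window-even j s≥1)
      where
      R : Reach n b c m 0
      R = toZero (ℕₚ.≤-antisym l (ℕₚ.≮⇒≥ nl)) F
    odd : ∀ j M → M ℕ.≤ s → Facts m M n b c → Windowed (suc (j ℕ.+ j)) m n b c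
    odd j (suc M) l F = window-odd j (s≤s z≤n) l F
    odd j zero l F = _thenWindow_ {suc (j ℕ.+ j)} {n} {b} {c} {m} {s} R (window-odd j s≥1 ℕₚ.≤-refl)
      where
      R : Reach n b c m s
      R = fromZero F
    go : (∃ λ j → k ≡ j ℕ.+ j ⊎ k ≡ suc (j ℕ.+ j)) → Windowed k m n b c
    go (j , inj₁ e) = subst (λ k → Windowed k m n b c) (sym e) (even j (M ℕ.<? s))
    go (j , inj₂ e) = subst (λ k → Windowed k m n b c) (sym e) (odd j M l F)

  Lowered : ℕ → (n b c : ℤ) → Set
  Lowered m n b c = ∃ λ m′ → 1 ℕ.≤ m′ × m′ ℕ.< m × ∃ (Reach n b c m′)

  private
    reassoc : ∀ m L t → m * L * t ≡ m * t * L
    reassoc = solve-∀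

    reassoc-k : ∀ k L K n₁ → k * L * K * n₁ ≡ L * (k * K * n₁)
    reassoc-k = solve-∀

    Δ-move : ∀ Δ m t L → Δ * (m * t * L) ≡ m * (Δ * t) * L
    Δ-move = solve-∀

  -- The bad prime L is not P, as P ∤ n′, and does not divide Δ, as the form is maximal at L. So L ∣
  -- m, and the new level is m / L. If L ∣ y, then L ∣ x, and the content of (x , y) takes L² out of
  -- n. Otherwise c₁² v₁ ≡ ± b y is prime to L, and v₁ ∣ Δ n holds without one factor L of the
  -- bound.
  improve : ∀ {m M n b c} → 1 ℕ.≤ m → (F : Facts m M n b c) → ∀ x y → val n b c x y ≡ n → Split.n′ (Facts.splits F) ∤ y →
    Lowered m n b c
  improve {m} {M} {n} {b} {c} lm (facts disc adm S@(split n′ n≡ nn′) (N , n∣)) x y v n′∤y = fromBad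
    (badPrime n′ (P ^ M) b c x y n′≢0
      (subst (λ n → val n b c x y ≡ n) n≡ v) n′∤y)
    where
    n≢0 : ¬ n ≡ + 0
    n≢0 = adm≢0 adm
    n′≢0 : ¬ n′ ≡ + 0
    n′≢0 q = n≢0 (trans n≡ (trans (cong (_* P ^ M) q) (ℤₚ.*-zeroˡ (P ^ M))))
    n′∣n : n′ ∣ n
    n′∣n = divides (P ^ M) (trans n≡ (ℤₚ.*-comm n′ (P ^ M)))
    y≢0 : ¬ y ≡ + 0
    y≢0 q = n′∤y (subst (n′ ∣_) (sym q) (divides (+ 0) (sym (ℤₚ.*-zeroˡ n′))))
    fromBad : BadPrime n′ b c x y → Lowered m n b c
    fromBad record { L = L ; pL = pL ; L∣n′ = L∣n′ ; L∣Z = L∣Z ; L²∣n′ = L²∣n′ } = fromLevel (prime∣pos pL m lm L∣m)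
      where
      L∣n : L ∣ n
      L∣n = ∣-trans L∣n′ n′∣n
      L∤Δ : L ∤ Δ
      L∤Δ dΔ = absurd (nonmaximal pL n b c x y Δ disc dΔ L∣n L∣Z (λ dy → ∣-trans (L²∣n′ dy) n′∣n))
        where
        absurd : (∃₂ λ k b₁ → Δ ≡ L * L * (+ 4 * k - b₁ * b₁)) → ⊥
        absurd (k , b₁ , e) = maximal pL n adm L∣n k b₁ e
      L∤P : L ∤ P
      L∤P d = nn′ (subst (_∣ n′) (prime-∣-prime pP pL d) L∣n′)
      L∤Tᴺ : L ∤ T ^ N
      L∤Tᴺ d = ∤-* pL P Δ L∤P L∤Δ (prime-∣-^ pL N d)
      L∣m : L ∣ + m
      L∣m = [ (λ d → d) , (λ d → ⊥-elim (L∤Tᴺ d)) ]′ (euclid pL (+ m) (T ^ N) (∣-trans L∣n n∣))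
      L∤b : L ∤ b
      L∤b db = L∤Δ (subst (L ∣_) disc (∣m∣n⇒∣m-n (∣n⇒∣m*n (+ 4) (∣m⇒∣m*n c L∣n)) (∣m⇒∣m*n b db)))
      fromLevel : (∃ λ q → 1 ℕ.≤ q × q ℕ.< m × + m ≡ + q * L) → Lowered m n b c
      fromLevel (q , lq , q<m , em) = q , lq , q<m , byDivisibility (L ∣? y)
        where
        n∣′ : n ∣ + q * T ^ N * L
        n∣′ = subst (n ∣_) (trans (cong (_* T ^ N) em) (reassoc (+ q) L (T ^ N))) n∣

        shrink : L ∣ y → ∃ (Reach n b c q)
        shrink dy = go (primitive-value {Δ} {n} {b} {c} disc x y n≢0 v)
          where
          dx : L ∣ x
          dx = euclid′ pL L∤b x (subst (L ∣_) (bx≡ b c x y) (∣m∣n⇒∣m-n L∣Z (∣n⇒∣m*n c dy)))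
          go : (∃₂ λ k n₁ → n ≡ k * k * n₁ × Equivalent Δ n b c n₁ × (∀ {L} → IsPrime L → L ∣ x → L ∣ y → L ∣ k)) →
            ∃ (Reach n b c q)
          go (k , n₁ , e , E , common) = finish (common pL dx dy) (splitPower pP n₁ (adm≢0 adm₁))
            where
            n₁∣n : n₁ ∣ n
            n₁∣n = divides (k * k) e
            adm₁ : Adm n₁
            adm₁ = adm-∣ pP P∤Δ 0 n n₁ adm (∣m⇒∣m*n (+ 1) n₁∣n)
            finish : L ∣ k → ∃ (Split P n₁) → ∃ (Reach n b c q)
            finish (divides k₁ ek) (M₁ , S₁) = M₁ , reach n₁ E adm₁ S₁
              (N , ∣-trans (divides (k₁ * k) refl) (∣-cancelˡ L (prime≢0 pL)
              (subst₂ _∣_ (trans e (trans (cong (λ z → z * k * n₁) ek) (reassoc-k k₁ L k n₁)))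
                (ℤₚ.*-comm (+ q * T ^ N) L) n∣′)))

        split-off : L ∤ y → ∃ (Reach n b c q)
        split-off ny = go (bisect n b c x y disc adm v y≢0)
          where
          go : Bisector Adm n b c x y → ∃ (Reach n b c q)
          go B = finish (splitPower pP v₁ (adm≢0 (Bisector.adm B)))
            where
            open Bisector B hiding (adm)
            v₁ = val n b c X Y
            L∤v₁ : L ∤ v₁
            L∤v₁ dv = ∤-* pL b y L∤b ny (subst (L ∣_)
              (sym (bisector-by n b x y ε (c₁ * c₁ * v₁) ε² (bisector-value {Adm} {n} {b} {c} {x} {y} v B)))
              (∣m∣n⇒∣m-n (∣n⇒∣m*n ε (∣n⇒∣m*n (c₁ * c₁) dv)) (∣m⇒∣m*n (+ 2 * ε + + 2 * x) L∣n)))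
            v₁∣ : v₁ ∣ + q * (Δ * T ^ N) * L
            v₁∣ = ∣-trans (bisector-∣ {Adm} {n} {b} {c} {x} {y} v B disc)
              (subst (Δ * n ∣_) (Δ-move Δ (+ q) (T ^ N) L) (*-monoʳ-∣ Δ n∣′))
            finish : ∃ (Split P v₁) → ∃ (Reach n b c q)
            finish (M₁ , S₁) = M₁ , reach v₁ (equiv {Δ} {n} {b} {c} {v₁} disc X Y unimodular refl) (Bisector.adm B) S₁
              (suc N , ∣-trans (∣-coprime-cancel pL v₁ (+ q * (Δ * T ^ N)) L∤v₁ v₁∣) (*-monoʳ-∣ (+ q) (*-monoˡ-∣ (T ^ N) Δ∣T)))

        byDivisibility : Dec (L ∣ y) → ∃ (Reach n b c q)
        byDivisibility (yes dy) = shrink dy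
        byDivisibility (no ny) = split-off ny

  Realised : (n b c : ℤ) → Set
  Realised n b c = ∃ λ N → (¬ N ≡ + 0) × Count n b c N (suc k)

  realised-via : ∀ {n b c m M} (R : Reach n b c m M) → Realised (Reach.n₁ R) (Reach.b₁ R) (Reach.c₁ R) → Realised n b c
  realised-via R (N , ne , C) = N , ne , Equivalent.count (Reach.equivalence R) C

  -- `improve` controls m but not the exponent of P, so each round starts by moving that exponent
  -- into the window again.
  realise : ∀ m → 1 ℕ.≤ m → ∀ {M n b c} → Facts m M n b c → Realised n b c
  realise = <-rec Goal step
    where
    Goal : ℕ → Set
    Goal m = 1 ℕ.≤ m → ∀ {M n b c} → Facts m M n b c → Realised n b c
    step : ∀ m → (∀ {m′} → m′ ℕ.< m → Goal m′) → Goal m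
    step m rec lm F = viaLower (lower F)
      where
      test : ∀ {M n b c} → InWindow k M → Facts m M n b c → Realised n b c
      test {M} {n} {b} {c} (k-low , k-high) F@(facts disc adm S@(split n′ n≡ nn′) level) =
        decide (represented? n b c d n (trans disc Δ≡) (λ _ y → ¬? (n′ ∣? y)))
        where
        decide : Dec (∃₂ λ x y → val n b c x y ≡ n × ¬ n′ ∣ y) → Realised n b c
        decide (yes (x , y , v , n′∤y)) = again (improve lm F x y v n′∤y)
          where
          again : Lowered m n b c → Realised n b c
          again (m′ , lm′ , m′<m , M′ , R) = realised-via R (rec m′<m lm′ (Reach.reached R))
        decide (no none) = n , adm≢0 adm , subst (λ n → Count n b c n (suc k)) (sym n≡)
          (CountOrbits.count pP n′ n′≢0 M b c nD exponents′ k k-low k-high good)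
          where
          n′≢0 : ¬ n′ ≡ + 0
          n′≢0 q = nn′ (subst (P ∣_) (sym q) (divides (+ 0) refl))
          disc′ : + 4 * (n′ * P ^ M * c) - b * b ≡ Δ
          disc′ = subst (λ n → + 4 * (n * c) - b * b ≡ Δ) n≡ disc
          nD : P ∤ + 4 * (n′ * P ^ M * c) - b * b
          nD = subst (P ∤_) (sym disc′) P∤Δ
          exponents′ : NormExponents P b (n′ * P ^ M * c)
          exponents′ = changeExponents {P} {b₀} {m₀} {b} {n′ * P ^ M * c} (trans disc₀ (sym disc′)) exponents
          good : ∀ x y → val (n′ * P ^ M) b c x y ≡ n′ * P ^ M → n′ ∣ y
          good x y v = fromDec (n′ ∣? y)
            where
            fromDec : Dec (n′ ∣ y) → n′ ∣ y
            fromDec (yes d) = d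
            fromDec (no nd) = ⊥-elim (none (x , y , subst (λ n → val n b c x y ≡ n) (sym n≡) v , nd))
      viaWindow : ∀ {n b c} → Windowed k m n b c → Realised n b c
      viaWindow (M , inW , R) = realised-via R (test inW (Reach.reached R))
      viaLower : ∀ {n b c} → (∃ λ M → M ℕ.≤ s × Reach n b c m M) → Realised n b c
      viaLower (M , l , R) = realised-via R (viaWindow (window k l (Reach.reached R)))

-- A large split prime

residue : ℤ → ℕ → ℕ
residue x zero = 0
residue x (suc n) = x ℤ.%ℕ suc n

residue≤ : ∀ x n → residue x n ℕ.≤ n
residue≤ x zero = z≤n
residue≤ x (suc n) = ℕₚ.<⇒≤ (n%ℕd<d x (suc n))

residue-≡ : ∀ x y n → 1 ℕ.≤ n → residue x n ≡ residue y n → + n ∣ x - y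
residue-≡ x y (suc n) _ e = divides (q₁ - q₂) (diff x y r₁ q₁ q₂ (+ suc n) (a≡a%ℕn+[a/ℕn]*n x (suc n))
    (trans (a≡a%ℕn+[a/ℕn]*n y (suc n)) (cong (λ r → + r + q₂ * + suc n) (sym e))))
  where
  r₁ = + (x ℤ.%ℕ suc n)
  q₁ = x ℤ./ℕ suc n
  q₂ = y ℤ./ℕ suc n
  diff : ∀ x y r q₁ q₂ n → x ≡ r + q₁ * n → y ≡ r + q₂ * n → x - y ≡ (q₁ - q₂) * n
  diff x y r q₁ q₂ n refl refl = solve (r ∷ q₁ ∷ q₂ ∷ n ∷ [])

residueFin : ℤ → (n : ℕ) → 1 ℕ.≤ n → Fin n
residueFin x (suc n) _ = Fin.fromℕ< (n%ℕd<d x (suc n))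

residueFin-≡ : ∀ x y n l → residueFin x n l ≡ residueFin y n l → + n ∣ x - y
residueFin-≡ x y (suc n) l e = residue-≡ x y (suc n) l
  (trans (sym (Finₚ.toℕ-fromℕ< (n%ℕd<d x (suc n)))) (trans (cong toℕ e) (Finₚ.toℕ-fromℕ< (n%ℕd<d y (suc n)))))

abs-pos-diff : ∀ a b r → a ℕ.≤ r → b ℕ.≤ r → abs (+ a - + b) ℕ.≤ r
abs-pos-diff a b r la lb = subst (ℕ._≤ r) (cong abs (sym (ℤₚ.m-n≡m⊖n a b))) (ℕₚ.≤-trans (ℤₚ.∣m⊝n∣≤m⊔n a b) (ℕₚ.⊔-lub la lb))

record Thue (ρ : ℤ) (r : ℕ) : Set where
  field
    h u : ℤ
    nonzero : ¬ (h ≡ + 0 × u ≡ + 0)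
    ∣h∣≤ : abs h ℕ.≤ r
    ∣u∣≤ : abs u ℕ.≤ r
    congruent : + (r ℕ.* r) ∣ h - ρ * u

-- There are (r + 1)² pairs with entries in [0 , r] and only r² residues of h - ρ u modulo r²; two
-- pairs collide, and their difference is small.
thue : ∀ ρ r → 1 ℕ.≤ r → Thue ρ r
thue ρ r lr = fromCollision (Finₚ.pigeonhole more f)
  where
  n = suc r
  1≤r² : 1 ℕ.≤ r ℕ.* r
  1≤r² = ℕₚ.*-mono-≤ lr lr
  more : r ℕ.* r ℕ.< n ℕ.* n
  more = ℕₚ.*-mono-< (ℕₚ.n<1+n r) (ℕₚ.n<1+n r)
  fst snd : Fin (n ℕ.* n) → ℕ
  fst i = toℕ (proj₁ (Fin.remQuot {n} n i))
  snd i = toℕ (proj₂ (Fin.remQuot {n} n i))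
  g : Fin (n ℕ.* n) → ℤ
  g i = + fst i - ρ * + snd i
  f : Fin (n ℕ.* n) → Fin (r ℕ.* r)
  f i = residueFin (g i) (r ℕ.* r) 1≤r²
  difference : ∀ h h′ u u′ ρ → (h - ρ * u) - (h′ - ρ * u′) ≡ (h - h′) - ρ * (u - u′)
  difference = solve-∀
  pos-injective : ∀ a b → + a - + b ≡ + 0 → a ≡ b
  pos-injective a b e = ℤₚ.+-injective (ℤₚ.i-j≡0⇒i≡j (+ a) (+ b) e)
  fromCollision : (∃₂ λ i j → i Fin.< j × f i ≡ f j) → Thue ρ r
  fromCollision (i , j , i<j , e) = record
    { h = + fst i - + fst j
    ; u = + snd i - + snd j
    ; nonzero = nonzero
    ; ∣h∣≤ = abs-pos-diff (fst i) (fst j) r (ℕₚ.≤-pred (Finₚ.toℕ<n (proj₁ (Fin.remQuot {n} n i))))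
      (ℕₚ.≤-pred (Finₚ.toℕ<n (proj₁ (Fin.remQuot {n} n j))))
    ; ∣u∣≤ = abs-pos-diff (snd i) (snd j) r (ℕₚ.≤-pred (Finₚ.toℕ<n (proj₂ (Fin.remQuot {n} n i))))
      (ℕₚ.≤-pred (Finₚ.toℕ<n (proj₂ (Fin.remQuot {n} n j))))
    ; congruent = subst (+ (r ℕ.* r) ∣_) (difference (+ fst i) (+ fst j) (+ snd i) (+ snd j) ρ)
      (residueFin-≡ (g i) (g j) (r ℕ.* r) 1≤r² e) }
    where
    nonzero : ¬ (+ fst i - + fst j ≡ + 0 × + snd i - + snd j ≡ + 0)
    nonzero (e₁ , e₂) = Finₚ.<⇒≢ i<j (trans (sym (Finₚ.combine-remQuot {n} n i)) (trans
      (cong₂ Fin.combine (Finₚ.toℕ-injective (pos-injective (fst i) (fst j) e₁))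
        (Finₚ.toℕ-injective (pos-injective (snd i) (snd j) e₂)))
      (Finₚ.combine-remQuot {n} n j)))

private
  hensel-value : ∀ ρ b m q v R₁ P k → ρ * ρ + b * ρ + m ≡ q * (P * R₁) → (+ 2 * ρ + b) * v ≡ + 1 + P * k →
    (ρ - q * v * (P * R₁)) * (ρ - q * v * (P * R₁)) + b * (ρ - q * v * (P * R₁)) + m ≡ (q * v * (q * v) * R₁ - q * k) *
      (P * (P * R₁))
  hensel-value ρ b m q v R₁ P k e f = ringlc₂ (+ 1) (- (q * (P * R₁))) e f (solve (ρ ∷ b ∷ m ∷ q ∷ v ∷ R₁ ∷ P ∷ k ∷ []))

  derivative-sq : ∀ ρ b m → + 4 * m - b * b ≡ + 4 * (ρ * ρ + b * ρ + m) - (+ 2 * ρ + b) * (+ 2 * ρ + b)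
  derivative-sq = solve-∀

  root-of-inverse : ∀ b m W w P k → W * w ≡ + 1 + P * k →
    W * W * (w * w + b * w + m) ≡ (+ 1 * + 1 + b * + 1 * W + m * W * W) + P * (k * (+ 2 + P * k + b * W))
  root-of-inverse b m W w P k e = ringlc (W * w + + 1 + P * k + b * W) e (solve (b ∷ m ∷ W ∷ w ∷ P ∷ k ∷ []))

-- For f(ρ) = ρ² + b ρ + m the derivative satisfies (2 ρ + b)² = 4 f(ρ) - (4 m - b²). It is
-- therefore invertible modulo P at a root, and Newton's step applies.
hensel : ∀ {P} → IsPrime P → ∀ b m → P ∤ + 4 * m - b * b → ∀ ρ → P ∣ ρ * ρ + b * ρ + m → ∀ J → ∃ λ ρ →
  P ^ suc J ∣ ρ * ρ + b * ρ + m
hensel {P} pP b m nD ρ d zero = ρ , subst (_∣ ρ * ρ + b * ρ + m) (sym (ℤₚ.*-identityʳ P)) d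
hensel {P} pP b m nD ρ₀ d (suc J) = step (hensel pP b m nD ρ₀ d J)
  where
  R₁ = P ^ J
  step : (∃ λ ρ → P * R₁ ∣ ρ * ρ + b * ρ + m) → ∃ λ ρ → P * (P * R₁) ∣ ρ * ρ + b * ρ + m
  step (ρ , dρ@(divides q e)) = improve (inverse-mod pP nd)
    where
    nd : P ∤ + 2 * ρ + b
    nd d = nD (subst (P ∣_) (sym (derivative-sq ρ b m))
      (∣m∣n⇒∣m-n (∣n⇒∣m*n (+ 4) (∣-trans (∣m⇒∣m*n R₁ ∣-refl) dρ)) (∣m⇒∣m*n (+ 2 * ρ + b) d)))
    improve : (∃₂ λ v k → (+ 2 * ρ + b) * v ≡ + 1 + P * k) → ∃ λ ρ → P * (P * R₁) ∣ ρ * ρ + b * ρ + m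
    improve (v , k , f) = ρ - q * v * (P * R₁) , divides (q * v * (q * v) * R₁ - q * k) (hensel-value ρ b m q v R₁ P k e f)

record SplitPrime (b m : ℤ) (C : ℕ) : Set where
  field
    P : ℤ
    pP : IsPrime P
    ∤disc : P ∤ + 4 * m - b * b
    large : ∀ e → 1 ℕ.≤ e → e ℕ.≤ C → P ∤ + e
    roots : ∀ J → ∃ λ ρ → P ^ suc J ∣ ρ * ρ + b * ρ + m

private
  norm-square : ∀ b m W D → + 4 * m - b * b ≡ D →
    (+ 2 + b * W) * (+ 2 + b * W) + D * (W * W) ≡ + 4 * (+ 1 * + 1 + b * + 1 * W + m * W * W)
  norm-square b m W D e = ringlc (- (W * W)) e (solve (b ∷ m ∷ W ∷ D ∷ []))

  one-minus : ∀ b m W → (+ 1 * + 1 + b * + 1 * W + m * W * W) - W * (b + m * W) ≡ + 1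
  one-minus = solve-∀

n∣n! : ∀ n → 1 ℕ.≤ n → n ℕ∣.∣ n !
n∣n! (suc n) _ = ℕ∣.m∣m*n (n !)

-- P is a prime factor of F, the norm of 1 + W ω. Since F ≡ 1 modulo W, P is prime to W, hence to
-- the discriminant and to every e ≤ C. Modulo P, the inverse of W is a root of ρ² + b ρ + m.
splitPrime : ∀ b m d → + 4 * m - b * b ≡ + suc d → ∀ C → SplitPrime b m C
splitPrime b m d disc C = fromDivisor (unit-or-prime-divisor F)
  where
  -- The factor 5 gives 4 |F| ≥ W ≥ 5, so F is not ± 1.
  w = 5 ℕ.* (suc d ℕ.* C !)
  W = + w
  F = + 1 * + 1 + b * + 1 * W + m * W * W
  5≤w : 5 ℕ.≤ w
  5≤w = ℕₚ.m≤m*n 5 (suc d ℕ.* C !) {{ℕ.>-nonZero (ℕₚ.*-mono-≤ (s≤s (z≤n {d})) (ℕₚ.1≤n! C))}}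
  w≤4F : w ℕ.≤ abs (+ 4 * F)
  w≤4F = abs-bound d W (+ 2 + b * W) (+ 4 * F) (norm-square b m W (+ suc d) disc)
  F-not-unit : F ∤ + 1
  F-not-unit u = contradiction (ℕₚ.≤-trans 5≤w
    (ℕₚ.≤-trans w≤4F (ℕₚ.≤-reflexive (trans (ℤₚ.abs-* (+ 4) F) (cong (4 ℕ.*_) (ℕ∣.∣1⇒≡1 (∣⇒∣ᵤ u))))))) λ {
    (s≤s (s≤s (s≤s (s≤s ())))) }
  suc-d∣W : + suc d ∣ W
  suc-d∣W = ∣ᵤ⇒∣ (ℕ∣.∣n⇒∣m*n 5 (ℕ∣.m∣m*n (C !)))
  fromDivisor : (F ∣ + 1 ⊎ ∃ λ L → IsPrime L × L ∣ F) → SplitPrime b m C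
  fromDivisor (inj₁ u) = ⊥-elim (F-not-unit u)
  fromDivisor (inj₂ (P , pP , P∣F)) = record { P = P ; pP = pP ; ∤disc = nD ; large = large ; roots = roots
    (inverse-mod pP P∤W) }
    where
    P∤W : P ∤ W
    P∤W dW = prime∤1 pP (subst (P ∣_) (one-minus b m W) (∣m∣n⇒∣m-n P∣F (∣m⇒∣m*n (b + m * W) dW)))
    nD : P ∤ + 4 * m - b * b
    nD dD = P∤W (∣-trans (subst (P ∣_) disc dD) suc-d∣W)
    large : ∀ e → 1 ℕ.≤ e → e ℕ.≤ C → P ∤ + e
    large e le l de = P∤W (∣-trans de (∣ᵤ⇒∣ (ℕ∣.∣n⇒∣m*n 5 (ℕ∣.∣n⇒∣m*n (suc d) (ℕ∣.∣-trans (n∣n! e le) (ℕ∣.m≤n⇒m!∣n! l))))))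
    roots : (∃₂ λ w′ k → W * w′ ≡ + 1 + P * k) → ∀ J → ∃ λ ρ → P ^ suc J ∣ ρ * ρ + b * ρ + m
    roots (w′ , k , e) = hensel pP b m nD w′ (euclid′ pP (∤-* pP W W P∤W P∤W) (w′ * w′ + b * w′ + m)
      (subst (P ∣_) (sym (root-of-inverse b m W w′ P k e)) (∣m∣n⇒∣m+n P∣F (∣m⇒∣m*n (k * (+ 2 + P * k + b * W)) ∣-refl))))

-- Elements of norm a power of P

pos-^ : ∀ p j → + (p ℕ.^ j) ≡ (+ p) ^ j
pos-^ p zero = refl
pos-^ p (suc j) = trans (ℤₚ.pos-* p (p ℕ.^ j)) (cong (+ p *_) (pos-^ p j))

record SmallNorm (P ρ b m : ℤ) (C j : ℕ) : Set where
  field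
    h u : ℤ
    e : ℕ
    norm : h * h + b * h * u + m * u * u ≡ + e * P ^ (j ℕ.+ j)
    e≥1 : 1 ℕ.≤ e
    e≤C : e ℕ.≤ C
    congruent : P ^ (j ℕ.+ j) ∣ h - ρ * u

private
  norm-congruent : ∀ b m h u ρ →
    h * h + b * h * u + m * u * u ≡ (h - ρ * u) * (h + ρ * u + b * u) + (u * u) * (ρ * ρ + b * ρ + m)
  norm-congruent = solve-∀

  norm-complete-square : ∀ b m h u D → + 4 * m - b * b ≡ D →
    (+ 2 * h + b * u) * (+ 2 * h + b * u) + D * (u * u) ≡ + 4 * (h * h + b * h * u + m * u * u)
  norm-complete-square b m h u D e = ringlc (- (u * u)) e (solve (b ∷ m ∷ h ∷ u ∷ D ∷ []))

  norm-at-0 : ∀ b m h → h * h + b * h * + 0 + m * + 0 * + 0 ≡ h * h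
  norm-at-0 = solve-∀

nonnegative-quotient : ∀ q R K → 1 ℕ.≤ R → + 4 * (q * + R) ≡ + K → ∃ λ e → q ≡ + e
nonnegative-quotient (+ e) R K l eq = e , refl
nonnegative-quotient -[1+ x ] (suc R) K l ()

norm-bound : ∀ b m h u r → abs h ℕ.≤ r → abs u ℕ.≤ r →
  abs (h * h + b * h * u + m * u * u) ℕ.≤ (1 ℕ.+ abs b ℕ.+ abs m) ℕ.* (r ℕ.* r)
norm-bound b m h u r lh lu = ℕₚ.≤-trans (ℤₚ.∣i+j∣≤∣i∣+∣j∣ (h * h + b * h * u) (m * u * u)) (ℕₚ.≤-trans
  (ℕₚ.+-mono-≤ (ℕₚ.≤-trans (ℤₚ.∣i+j∣≤∣i∣+∣j∣ (h * h) (b * h * u)) (ℕₚ.+-mono-≤ hh (three b h u lh lu))) (three m u u lu lu))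
  (ℕₚ.≤-reflexive (collect (abs b) (abs m) (r ℕ.* r))))
  where
  hh : abs (h * h) ℕ.≤ r ℕ.* r
  hh = subst (ℕ._≤ r ℕ.* r) (sym (ℤₚ.abs-* h h)) (ℕₚ.*-mono-≤ lh lh)
  three : ∀ k x y → abs x ℕ.≤ r → abs y ℕ.≤ r → abs (k * x * y) ℕ.≤ abs k ℕ.* (r ℕ.* r)
  three k x y lx ly = subst (ℕ._≤ abs k ℕ.* (r ℕ.* r))
    (sym (trans (ℤₚ.abs-* (k * x) y) (trans (cong (ℕ._* abs y) (ℤₚ.abs-* k x)) (ℕₚ.*-assoc (abs k) (abs x) (abs y)))))
    (ℕₚ.*-monoʳ-≤ (abs k) (ℕₚ.*-mono-≤ lx ly))
  collect : ∀ b m r → r ℕ.+ b ℕ.* r ℕ.+ m ℕ.* r ≡ (1 ℕ.+ b ℕ.+ m) ℕ.* r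
  collect = solveℕ-∀

-- Thue's lemma with r = P^j gives h ≡ ρ u modulo P^2j, so P^2j divides the norm. The norm is
-- positive and at most (1 + |b| + |m|) r², which bounds the quotient e.
smallNorm : ∀ {P} → IsPrime P → ∀ b m d → + 4 * m - b * b ≡ + suc d → ∀ ρ j → P ^ (j ℕ.+ j) ∣ ρ * ρ + b * ρ + m →
  SmallNorm P ρ b m (1 ℕ.+ abs b ℕ.+ abs m) j
smallNorm {P} (isPrime {p} pr) b m d disc ρ j root = fromThue (thue ρ r r≥1)
  where
  r = p ℕ.^ j
  r≥1 : 1 ℕ.≤ r
  r≥1 = ℕₚ.m^n>0 p {{prime⇒nonZero pr}} j
    
  R≡ : + (r ℕ.* r) ≡ P ^ (j ℕ.+ j)
  R≡ = trans (ℤₚ.pos-* r r) (trans (cong₂ _*_ (pos-^ p j) (pos-^ p j)) (sym (^-+ (+ p) j j)))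
  fromThue : Thue ρ r → SmallNorm P ρ b m (1 ℕ.+ abs b ℕ.+ abs m) j
  fromThue record { h = h ; u = u ; nonzero = nonzero ; ∣h∣≤ = lh ; ∣u∣≤ = lu ; congruent = cg } =
    fromQuotient (subst (+ (r ℕ.* r) ∣_) (sym (norm-congruent b m h u ρ)) (∣m∣n⇒∣m+n (∣m⇒∣m*n (h + ρ * u + b * u) cg)
      (∣n⇒∣m*n (u * u) (subst (_∣ ρ * ρ + b * ρ + m) (sym R≡) root))))
    where
    N = h * h + b * h * u + m * u * u
    K = abs (+ 2 * h + b * u) ℕ.* abs (+ 2 * h + b * u) ℕ.+ suc d ℕ.* (abs u ℕ.* abs u)
    4N : (+ 2 * h + b * u) * (+ 2 * h + b * u) + + suc d * (u * u) ≡ + 4 * N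
    4N = norm-complete-square b m h u (+ suc d) disc
    4N≡K : + 4 * N ≡ + K
    4N≡K = trans (sym 4N) (sum-squares d (+ 2 * h + b * u) u)
    N≢0 : ¬ N ≡ + 0
    N≢0 q = nonzero (h≡0 , u≡0)
      where
      u≡0 : u ≡ + 0
      u≡0 = ℤₚ.∣i∣≡0⇒i≡0 (ℕₚ.n≤0⇒n≡0 (subst (abs u ℕ.≤_) (cong (λ z → abs (+ 4 * z)) q)
        (abs-bound d u (+ 2 * h + b * u) (+ 4 * N) 4N)))
      hh≡0 : h * h ≡ + 0
      hh≡0 = trans (sym (norm-at-0 b m h)) (subst (λ u → h * h + b * h * u + m * u * u ≡ + 0) u≡0 q)
      h≡0 : h ≡ + 0
      h≡0 = [ (λ z → z) , (λ z → z) ]′ (ℤₚ.i*j≡0⇒i≡0∨j≡0 h hh≡0)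
    fromQuotient : + (r ℕ.* r) ∣ N → SmallNorm P ρ b m (1 ℕ.+ abs b ℕ.+ abs m) j
    fromQuotient (divides q eq) = fromNonneg
      (nonnegative-quotient q (r ℕ.* r) K (ℕₚ.*-mono-≤ r≥1 r≥1) (trans (cong (+ 4 *_) (sym eq)) 4N≡K))
      where
      fromNonneg : (∃ λ e → q ≡ + e) → SmallNorm P ρ b m (1 ℕ.+ abs b ℕ.+ abs m) j
      fromNonneg (e , qe) = record { h = h ; u = u ; e = e ; norm = trans N≡ (cong (+ e *_) R≡) ; e≥1 = e≥1 e N≡ ; e≤C = e≤C
          ; congruent = subst (_∣ h - ρ * u) R≡ cg }
        where
        N≡ : N ≡ + e * + (r ℕ.* r)
        N≡ = trans eq (cong (_* + (r ℕ.* r)) qe)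
        e≥1 : ∀ e → N ≡ + e * + (r ℕ.* r) → 1 ℕ.≤ e
        e≥1 zero z = ⊥-elim (N≢0 z)
        e≥1 (suc e) _ = s≤s z≤n
        e≤C : e ℕ.≤ 1 ℕ.+ abs b ℕ.+ abs m
        e≤C = ℕₚ.*-cancelʳ-≤ e (1 ℕ.+ abs b ℕ.+ abs m) (r ℕ.* r) {{ℕ.>-nonZero (ℕₚ.*-mono-≤ r≥1 r≥1)}}
          (subst (ℕ._≤ (1 ℕ.+ abs b ℕ.+ abs m) ℕ.* (r ℕ.* r)) (trans (cong abs N≡) (ℤₚ.abs-* (+ e) (+ (r ℕ.* r))))
            (norm-bound b m h u r lh lu))

private
  quotient-E : ∀ E h u a c → E ∣ h - a → E ∣ u - c → E ∣ u * a - h * c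
  quotient-E E h u a c dh du = subst (E ∣_) (lem h u a c) (∣m∣n⇒∣m-n (∣n⇒∣m*n h du) (∣n⇒∣m*n u dh))
    where
    lem : ∀ h u a c → h * (u - c) - u * (h - a) ≡ u * a - h * c
    lem = solve-∀

  quotient-R : ∀ R ρ h u h′ u′ → R ∣ h - ρ * u → R ∣ h′ - ρ * u′ → R ∣ u * h′ - h * u′
  quotient-R R ρ h u h′ u′ d d′ = subst (R ∣_) (lem ρ h u h′ u′) (∣m∣n⇒∣m-n (∣n⇒∣m*n u d′) (∣m⇒∣m*n u′ d))
    where
    lem : ∀ ρ h u h′ u′ → u * (h′ - ρ * u′) - (h - ρ * u) * u′ ≡ u * h′ - h * u′
    lem = solve-∀

  quotient-root : ∀ b m n H w S → H * H + b * H * (w * n) + m * (w * n) * (w * n) ≡ n * (n * (S * S)) →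
    H * H + n * (b * w) * H ≡ n * n * (S * S - m * w * w)
  quotient-root b m n H w S e = ringlc (+ 1) e (solve (b ∷ m ∷ n ∷ H ∷ w ∷ S ∷ []))

  quotient-norm : ∀ b m n H w S → H * n * (H * n) + b * (H * n) * (w * n) + m * (w * n) * (w * n) ≡ n * (n * (S * S)) →
    n * n * (H * H + b * H * w + m * w * w) ≡ n * n * (S * S)
  quotient-norm b m n H w S e = ringlc (+ 1) e (solve (b ∷ m ∷ n ∷ H ∷ w ∷ S ∷ []))

  recover : ∀ b m h u h′ u′ H w n → h * h + b * h * u + m * u * u ≡ n → h * (h′ + b * u′) + m * u * u′ ≡ H * n →
    u * h′ - h * u′ ≡ w * n →
    n * u′ ≡ n * (u * H - h * w)
  recover b m h u h′ u′ H w n e f g = ringlc₃ (- u′) u (- h) e f g (solve (b ∷ m ∷ h ∷ u ∷ h′ ∷ u′ ∷ H ∷ w ∷ n ∷ []))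

  e-eq : ∀ b m ρ h u q t E R → h ≡ ρ * u + q * R → ρ * ρ + b * ρ + m ≡ t * R → h * h + b * h * u + m * u * u ≡ E * R →
    R * E ≡ R * (u * (t * u + q * (+ 2 * ρ + b)) + q * q * R)
  e-eq b m ρ .(ρ * u + q * R) u q t E R refl f g = ringlc₂ (u * u) (- + 1) f g (solve (b ∷ m ∷ ρ ∷ u ∷ q ∷ t ∷ E ∷ R ∷ []))

  from-diff : ∀ h x y → h - x ≡ y → h ≡ x + y
  from-diff h x y e = ringlc (+ 1) e (solve (h ∷ x ∷ y ∷ []))

  norm-mod : ∀ b m H w S → H * H + b * H * w + m * w * w ≡ S * S → H * H ≡ S * S - w * (b * H + m * w)
  norm-mod b m H w S e = ringlc (+ 1) e (solve (b ∷ m ∷ H ∷ w ∷ S ∷ []))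

  regroup : ∀ E R S → (E * R) * (E * (R * (S * S))) ≡ (E * R) * ((E * R) * (S * S))
  regroup = solve-∀

-- α ᾱ′ / (E R), for α and α′ of norms E R and E R S² congruent modulo E and divisible by the same power of a prime above P.
quotientElement : ∀ {P} → IsPrime P → ∀ b m ρ E i S h u h′ u′ → P ∤ E → P ∣ S → P ^ i * (S * S) ∣ ρ * ρ + b * ρ + m →
  h * h + b * h * u + m * u * u ≡ E * P ^ i → h′ * h′ + b * h′ * u′ + m * u′ * u′ ≡ E * (P ^ i * (S * S)) →
  P ^ i ∣ h - ρ * u → P ^ i * (S * S) ∣ h′ - ρ * u′ → E ∣ h - h′ → E ∣ u - u′ → ¬ E ≡ + 0 → ¬ S ≡ + 0 → NormElement P b m
    (S * S)
quotientElement {P} pP b m ρ E i S h u h′ u′ nE dS dρ N N′ cg cg′ dh du E≢0 S≢0 =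
  fromE (quotient-E E h u h′ u′ dh du)
  where
  R = P ^ i
  R≢0 : ¬ R ≡ + 0
  R≢0 = ^≢0 (prime≢0 pP) i
  U = u * h′ - h * u′
  H = h * (h′ + b * u′) + m * u * u′
  norm : H * H + b * H * U + m * U * U ≡ (E * R) * ((E * R) * (S * S))
  norm = trans (norm₋ b m h u h′ u′ (E * R) (E * (R * (S * S))) N N′) (regroup E R S)
  R∣RS² : R ∣ R * (S * S)
  R∣RS² = ∣m⇒∣m*n (S * S) ∣-refl
  R∣U : R ∣ U
  R∣U = quotient-R R ρ h u h′ u′ cg (∣-trans R∣RS² cg′)
  ER≢0 : ¬ E * R ≡ + 0
  ER≢0 = *≢0 E≢0 R≢0
  fromE : E ∣ U → NormElement P b m (S * S)
  fromE (divides w₁ e₁) = fromR (^-∣-cancel pP nE i w₁ (subst (R ∣_) (trans e₁ (ℤₚ.*-comm w₁ E)) R∣U))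
    where
    fromR : R ∣ w₁ → NormElement P b m (S * S)
    fromR (divides w e₂) = withU U H refl refl norm (trans e₁ (trans (cong (_* E) e₂) (assoc′ w R E)))
      where
      assoc′ : ∀ w R E → w * R * E ≡ w * (E * R)
      assoc′ = solve-∀
      withU : ∀ U₀ H₀ → U ≡ U₀ → H ≡ H₀ → H₀ * H₀ + b * H₀ * U₀ + m * U₀ * U₀ ≡ (E * R) * ((E * R) * (S * S)) →
        U₀ ≡ w * (E * R) → NormElement P b m (S * S)
      withU _ H₀ eU eH nrm refl = fromH
        (monic-root-∣ (E * R) H₀ (b * w) (S * S - m * w * w) (quotient-root b m (E * R) H₀ w S nrm)) nrm eH
        where
        fromH : E * R ∣ H₀ →
          H₀ * H₀ + b * H₀ * (w * (E * R)) + m * (w * (E * R)) * (w * (E * R)) ≡ (E * R) * ((E * R) * (S * S)) → H ≡ H₀ →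
          NormElement P b m (S * S)
        fromH (divides H₁ refl) nrm eH = element H₁ w norm₁ P∤w
          where
          norm₁ : H₁ * H₁ + b * H₁ * w + m * w * w ≡ S * S
          norm₁ = cancelˡ (E * R * (E * R)) (*≢0 ER≢0 ER≢0) (quotient-norm b m (E * R) H₁ w S nrm)
          u′≡ : u′ ≡ u * H₁ - h * w
          u′≡ = cancelˡ (E * R) ER≢0 (recover b m h u h′ u′ H₁ w (E * R) N eH eU)
          P∤u′ : P ∤ u′
          P∤u′ d = fromCongruence cg′ dρ
            where
            fromCongruence : R * (S * S) ∣ h′ - ρ * u′ → R * (S * S) ∣ ρ * ρ + b * ρ + m → ⊥
            fromCongruence (divides q f) (divides t g) = nE (subst (P ∣_)
              (sym (cancelˡ (R * (S * S)) (*≢0 R≢0 (*≢0 S≢0 S≢0))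
                (e-eq b m ρ h′ u′ q t E (R * (S * S)) (from-diff h′ (ρ * u′) (q * (R * (S * S))) f) g N′)))
              (∣m∣n⇒∣m+n (∣m⇒∣m*n (t * u′ + q * (+ 2 * ρ + b)) d) (∣n⇒∣m*n (q * q) (∣n⇒∣m*n R (∣m⇒∣m*n S dS)))))
          P∤w : P ∤ w
          P∤w d = P∤u′ (subst (P ∣_) (sym u′≡) (∣m∣n⇒∣m-n (∣n⇒∣m*n u P∣H₁) (∣n⇒∣m*n h d)))
            where
            P∣H₁ : P ∣ H₁
            P∣H₁ = euclid-sq pP H₁ (subst (P ∣_) (sym (norm-mod b m H₁ w S norm₁))
              (∣m∣n⇒∣m-n (∣m⇒∣m*n S dS) (∣m⇒∣m*n (b * H₁ + m * w) d)))

^-∣-^ : ∀ P {x y} → x ℕ.≤ y → P ^ x ∣ P ^ y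
^-∣-^ P {x} l = go (ℕₚ.m≤n⇒∃[o]m+o≡n l)
  where
  go : ∀ {y} → (∃ λ o → x ℕ.+ o ≡ y) → P ^ x ∣ P ^ y
  go (o , refl) = divides (P ^ o) (trans (^-+ P x o) (ℤₚ.*-comm (P ^ x) (P ^ o)))

-- The exponents j ≤ K give K + 1 small norms, against K = (C + 1)³ codes made of e and of h and u
-- modulo e. A collision gives a quotient as in `quotientElement`. A single root modulo P^(2 K + 1)
-- is used for all j, so that all elements involve the same prime above P.
someExponent : ∀ b m d → + 4 * m - b * b ≡ + suc d → (SP : SplitPrime b m (1 ℕ.+ abs b ℕ.+ abs m)) →
  ∃ λ z → 1 ℕ.≤ z × InS (SplitPrime.P SP) b m z
someExponent b m d disc SP = fromRoot (roots (K ℕ.+ K))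
  where
  open SplitPrime SP
  C = 1 ℕ.+ abs b ℕ.+ abs m
  c = suc C
  K = c ℕ.* (c ℕ.* c)
  fromRoot : (∃ λ ρ → P ^ suc (K ℕ.+ K) ∣ ρ * ρ + b * ρ + m) → ∃ λ z → 1 ℕ.≤ z × InS P b m z
  fromRoot (ρ , root) = fromCollision (Finₚ.pigeonhole (ℕₚ.n<1+n K) code)
    where
    rootAt : ∀ (i : Fin (suc K)) → P ^ (toℕ i ℕ.+ toℕ i) ∣ ρ * ρ + b * ρ + m
    rootAt i = ∣-trans (^-∣-^ P (ℕₚ.m≤n⇒m≤1+n (ℕₚ.+-mono-≤ i≤K i≤K))) root
      where
      i≤K : toℕ i ℕ.≤ K
      i≤K = ℕₚ.≤-pred (Finₚ.toℕ<n i)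
    α : ∀ (i : Fin (suc K)) → SmallNorm P ρ b m C (toℕ i)
    α i = smallNorm pP b m d disc ρ (toℕ i) (rootAt i)
    open SmallNorm
    bounded : ∀ {j} (α : SmallNorm P ρ b m C j) x → residue x (e α) ℕ.< c
    bounded α x = s≤s (ℕₚ.≤-trans (residue≤ x (e α)) (e≤C α))
    ē h̄ ū : Fin (suc K) → Fin c
    ē i = Fin.fromℕ< (s≤s (e≤C (α i)))
    h̄ i = Fin.fromℕ< (bounded (α i) (h (α i)))
    ū i = Fin.fromℕ< (bounded (α i) (u (α i)))
    code : Fin (suc K) → Fin K
    code i = Fin.combine (ē i) (Fin.combine (h̄ i) (ū i))
    fromℕ<-≡ : ∀ {x y} (p : x ℕ.< c) (q : y ℕ.< c) → Fin.fromℕ< p ≡ Fin.fromℕ< q → x ≡ y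
    fromℕ<-≡ p q eq = trans (sym (Finₚ.toℕ-fromℕ< p)) (trans (cong toℕ eq) (Finₚ.toℕ-fromℕ< q))
    double : ∀ j z → P ^ ((j ℕ.+ z) ℕ.+ (j ℕ.+ z)) ≡ P ^ (j ℕ.+ j) * (P ^ z * P ^ z)
    double j z = trans (^-double P j z) (cong (P ^ (j ℕ.+ j) *_) (^-+ P z z))
    combineSmall : ∀ j z → 1 ℕ.≤ z → (α : SmallNorm P ρ b m C j) (β : SmallNorm P ρ b m C (j ℕ.+ z)) →
      P ^ ((j ℕ.+ z) ℕ.+ (j ℕ.+ z)) ∣ ρ * ρ + b * ρ + m →
      e α ≡ e β → residue (h α) (e α) ≡ residue (h β) (e β) → residue (u α) (e α) ≡ residue (u β) (e β) → InS P b m z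
    combineSmall j z lz α β root ee eh eu = subst (NormElement P b m) (sym (^-+ P z z))
      (quotientElement pP b m ρ (+ e α) (j ℕ.+ j) (P ^ z) (h α) (u α) (h β) (u β) (large (e α) (e≥1 α) (e≤C α)) (base∣^ P lz)
        (subst (_∣ ρ * ρ + b * ρ + m) (double j z) root) (norm α)
        (trans (norm β) (cong₂ (λ E R → + E * R) (sym ee) (double j z))) (congruent α)
          (subst (_∣ h β - ρ * u β) (double j z) (congruent β))
        (residue-≡ (h α) (h β) (e α) (e≥1 α) (trans eh (cong (residue (h β)) (sym ee))))
        (residue-≡ (u α) (u β) (e α) (e≥1 α) (trans eu (cong (residue (u β)) (sym ee))))
        e≢0 (^≢0 (prime≢0 pP) z))
      where
      e≢0 : ¬ + e α ≡ + 0
      e≢0 q = contradiction (subst (1 ℕ.≤_) (ℤₚ.+-injective q) (e≥1 α)) ℕₚ.n≮0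
    fromCollision : (∃₂ λ i j → i Fin.< j × code i ≡ code j) → ∃ λ z → 1 ℕ.≤ z × InS P b m z
    fromCollision (i , j , i<j , eq) = go (ℕₚ.m≤n⇒∃[o]m+o≡n i<j)
      where
      e₁ = Finₚ.combine-injective (ē i) (Fin.combine (h̄ i) (ū i)) (ē j) (Fin.combine (h̄ j) (ū j)) eq
      e₂ = Finₚ.combine-injective (h̄ i) (ū i) (h̄ j) (ū j) (proj₂ e₁)
      eE : e (α i) ≡ e (α j)
      eE = fromℕ<-≡ (s≤s (e≤C (α i))) (s≤s (e≤C (α j))) (proj₁ e₁)
      eH : residue (h (α i)) (e (α i)) ≡ residue (h (α j)) (e (α j))
      eH = fromℕ<-≡ (bounded (α i) (h (α i))) (bounded (α j) (h (α j))) (proj₁ e₂)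
      eU : residue (u (α i)) (e (α i)) ≡ residue (u (α j)) (e (α j))
      eU = fromℕ<-≡ (bounded (α i) (u (α i))) (bounded (α j) (u (α j))) (proj₂ e₂)
      transport : ∀ z j′ → 1 ℕ.≤ z → j′ ≡ toℕ i ℕ.+ z → (β : SmallNorm P ρ b m C j′) → P ^ (j′ ℕ.+ j′) ∣ ρ * ρ + b * ρ + m →
        e (α i) ≡ e β → residue (h (α i)) (e (α i)) ≡ residue (h β) (e β) → residue (u (α i)) (e (α i)) ≡ residue (u β)
          (e β) → InS P b m z
      transport z _ lz refl β = combineSmall (toℕ i) z lz (α i) β
      go : (∃ λ o → suc (toℕ i) ℕ.+ o ≡ toℕ j) → ∃ λ z → 1 ℕ.≤ z × InS P b m z
      go (o , q) = suc o , s≤s z≤n , transport (suc o) (toℕ j) (s≤s z≤n) (trans (sym q) (sym (ℕₚ.+-suc (toℕ i) o))) (α j)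
        (rootAt j) eE eH eU

-- Admissible values

realiseAdmissible : ∀ {Δ Adm} → Admissible Δ Adm → ∀ d → Δ ≡ + suc d → ∀ n b c → + 4 * (n * c) - b * b ≡ Δ → Adm n → ∀ k →
  ∃ λ N → (¬ N ≡ + 0) × Count n b c N (suc k)
realiseAdmissible {Δ} {Adm} A d Δ≡ n b c disc adm k = from (someExponent b (n * c) d disc′ SP)
  where
  disc′ : + 4 * (n * c) - b * b ≡ + suc d
  disc′ = trans disc Δ≡
  SP : SplitPrime b (n * c) (1 ℕ.+ abs b ℕ.+ abs (n * c))
  SP = splitPrime b (n * c) d disc′ (1 ℕ.+ abs b ℕ.+ abs (n * c))
  open SplitPrime SP
  n≢0 : ¬ n ≡ + 0
  n≢0 = Admissible.adm≢0 A adm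
  from : (∃ λ z → 1 ℕ.≤ z × InS P b (n * c) z) → ∃ λ N → (¬ N ≡ + 0) × Count n b c N (suc k)
  from (z , lz , is) = fromSplit (splitPower pP n n≢0)
    where
    open Descent A pP (subst (P ∤_) disc ∤disc) {b} {n * c} disc (normExponents pP b (n * c) d disc′ ∤disc z lz is) d Δ≡ k
    fromSplit : ∃ (Split P n) → ∃ λ N → (¬ N ≡ + 0) × Count n b c N (suc k)
    fromSplit (M , S) = realise (abs n) (ℕₚ.n≢0⇒n>0 (λ q → n≢0 (ℤₚ.∣i∣≡0⇒i≡0 q)))
      (facts disc adm S (0 , subst (n ∣_) (sym (ℤₚ.*-identityʳ (+ abs n))) m∣∣m∣))

private
  y-square : ∀ n b c x y Δ → + 4 * (n * c) - b * b ≡ Δ →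
    (+ 2 * n * x + b * y) * (+ 2 * n * x + b * y) + Δ * (y * y) ≡ + 4 * n * (n * (x * x) + b * (x * y) + c * (y * y))
  y-square n b c x y Δ e = ringlc (- (y * y)) e (solve (n ∷ b ∷ c ∷ x ∷ y ∷ Δ ∷ []))

maximalAdmissible : ∀ d → (∀ {L} → IsPrime L → ∀ k b → ¬ + suc d ≡ L * L * (+ 4 * k - b * b)) →
  Admissible (+ suc d) (λ n → ¬ n ≡ + 0)
maximalAdmissible d max = record
  { adm≢0 = λ n≢0 → n≢0
  ; adm-∣ = λ {P} pP _ i n n₁ → divisor≢0 {P} pP i n n₁
  ; maximal = λ pL n _ _ k b → max pL k b
  ; bisect = bisect }
  where
  divisor≢0 : ∀ {P} → IsPrime P → ∀ i n n₁ → ¬ n ≡ + 0 → n₁ ∣ n * P ^ i → ¬ n₁ ≡ + 0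
  divisor≢0 {P} pP i n n₁ n≢0 d q = *≢0 n≢0 (^≢0 (prime≢0 pP) i) (0∣⇒≡0 (subst (_∣ n * P ^ i) q d))
  bisect : ∀ n b c x y → + 4 * (n * c) - b * b ≡ + suc d → ¬ n ≡ + 0 → val n b c x y ≡ n → ¬ y ≡ + 0 →
    Bisector (λ n → ¬ n ≡ + 0) n b c x y
  bisect n b c x y disc n≢0 v y≢0 = from (primitivePart (+ 1 + + 1 * x) (+ 1 * y) nz)
    where
    nz : ¬ (+ 1 + + 1 * x ≡ + 0 × + 1 * y ≡ + 0)
    nz (_ , q) = y≢0 (trans (sym (ℤₚ.*-identityˡ y)) q)
    from : PrimitivePart (+ 1 + + 1 * x) (+ 1 * y) → Bisector (λ n → ¬ n ≡ + 0) n b c x y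
    from (primPart k X Y k≢0 eX eY uni) = bisector (+ 1) k X Y refl k≢0 (sym eX) (sym eY) uni v₁≢0
      where
      v₁≢0 : ¬ val n b c X Y ≡ + 0
      v₁≢0 q = nz (≡0 , trans eY (trans (cong (k *_) Y≡0) (ℤₚ.*-zeroʳ k)))
        where
        Y≡0 : Y ≡ + 0
        Y≡0 = ℤₚ.∣i∣≡0⇒i≡0 (ℕₚ.n≤0⇒n≡0 (subst (abs Y ℕ.≤_)
          (trans (cong (λ z → abs (+ 4 * n * z)) q) (cong abs (ℤₚ.*-zeroʳ (+ 4 * n))))
          (abs-bound d Y (+ 2 * n * X + b * Y) (+ 4 * n * val n b c X Y) (y-square n b c X Y (+ suc d) disc))))
        ≡0 : + 1 + + 1 * x ≡ + 0
        ≡0 = ⊥-elim (y≢0 (trans (sym (ℤₚ.*-identityˡ y)) (trans eY (trans (cong (k *_) Y≡0) (ℤₚ.*-zeroʳ k)))))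

-- Parity and sums of squares

data Parity (z : ℤ) : Set where
  even : ∀ i → z ≡ + 2 * i → Parity z
  odd : ∀ i → z ≡ + 2 * i + + 1 → Parity z

parityℤ : ∀ z → Parity z
parityℤ z = go (z ℤ.%ℕ 2) (n%ℕd<d z 2) (a≡a%ℕn+[a/ℕn]*n z 2)
  where
  q = z ℤ./ℕ 2
  go : ∀ r → r ℕ.< 2 → z ≡ + r + q * + 2 → Parity z
  go 0 _ e = even q (trans e (lem q))
    where
    lem : ∀ q → + 0 + q * + 2 ≡ + 2 * q
    lem = solve-∀
  go 1 _ e = odd q (trans e (lem q))
    where
    lem : ∀ q → + 1 + q * + 2 ≡ + 2 * q + + 1
    lem = solve-∀
  go (suc (suc r)) (s≤s (s≤s ())) _

2-prime : IsPrime (+ 2)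
2-prime = isPrime prime[2]

even⇒∣ : ∀ {z i} → z ≡ + 2 * i → + 2 ∣ z
even⇒∣ {z} {i} e = divides i (trans e (ℤₚ.*-comm (+ 2) i))

∤⇒odd : ∀ z → + 2 ∤ z → ∃ λ i → z ≡ + 2 * i + + 1
∤⇒odd z n = go (parityℤ z)
  where
  go : Parity z → ∃ λ i → z ≡ + 2 * i + + 1
  go (even i e) = ⊥-elim (n (even⇒∣ e))
  go (odd i e) = i , e

2∣pronic : ∀ l → + 2 ∣ l * l + l
2∣pronic l = go (parityℤ l)
  where
  ev : ∀ i → + 2 * i * (+ 2 * i) + + 2 * i ≡ (i * (+ 2 * i) + i) * + 2
  ev = solve-∀
  od : ∀ i → (+ 2 * i + + 1) * (+ 2 * i + + 1) + (+ 2 * i + + 1) ≡ (+ 2 * i * i + + 3 * i + + 1) * + 2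
  od = solve-∀
  go : Parity l → + 2 ∣ l * l + l
  go (even i refl) = divides (i * (+ 2 * i) + i) (ev i)
  go (odd i refl) = divides (+ 2 * i * i + + 3 * i + + 1) (od i)

4∤2 : + 4 ∤ + 2
4∤2 d with ℕ∣.∣⇒≤ (∣⇒∣ᵤ d)
... | s≤s (s≤s ())

private
  two-odd-squares : ∀ i j k → (+ 2 * i + + 1) * (+ 2 * i + + 1) + (+ 2 * j + + 1) * (+ 2 * j + + 1) ≡ + 4 * k →
    + 2 ≡ (k - i * i - i - j * j - j) * + 4
  two-odd-squares i j k e = ringlc (+ 1) e (solve (i ∷ j ∷ k ∷ []))

  κ4 : ∀ l y i → (+ 2 * l + + 1) * (+ 2 * l + + 1) + + 4 * (y * y) ≡ (+ 2 * i + + 1) * (+ 2 * i + + 1) →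
    + 4 * (y * y) ≡ + 4 * ((i * i + i) - (l * l + l))
  κ4 l y i e = ringlc (+ 1) e (solve (l ∷ y ∷ i ∷ []))

  κ3 : ∀ l j i → (+ 2 * l) * (+ 2 * l) + + 3 * ((+ 2 * j + + 1) * (+ 2 * j + + 1)) ≡ (+ 2 * i + + 1) * (+ 2 * i + + 1) →
    + 2 ≡ (i * i + i - l * l - + 3 * (j * j + j)) * + 4
  κ3 l j i e = ringlc (+ 1) e (solve (l ∷ j ∷ i ∷ []))

odd-squares-sum : ∀ i j k → + 2 ∤ i → + 2 ∤ j → ¬ i * i + j * j ≡ + 4 * k
odd-squares-sum i j k ni nj = go (∤⇒odd i ni) (∤⇒odd j nj)
  where
  go : (∃ λ a → i ≡ + 2 * a + + 1) → (∃ λ a → j ≡ + 2 * a + + 1) → ¬ i * i + j * j ≡ + 4 * k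
  go (a , ea) (b , eb) e = 4∤2 (divides (k - a * a - a - b * b - b)
    (two-odd-squares a b k (trans (sym (cong₂ (λ i j → i * i + j * j) ea eb)) e)))

sum-not-square₄ : ∀ X y n → + 2 ∤ n → X * X + + 4 * (y * y) ≡ n * n → + 2 ∣ y
sum-not-square₄ X y n nn e = go (∤⇒odd n nn) (∤⇒odd X nX)
  where
  nX : + 2 ∤ X
  nX d = nn (euclid-sq 2-prime n (subst (+ 2 ∣_) e (∣m∣n⇒∣m+n (∣m⇒∣m*n X d) (∣m⇒∣m*n (y * y) (divides (+ 2) refl)))))
  go : (∃ λ i → n ≡ + 2 * i + + 1) → (∃ λ l → X ≡ + 2 * l + + 1) → + 2 ∣ y
  go (i , en) (l , eX) = euclid-sq 2-prime y (subst (+ 2 ∣_)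
    (sym (cancelˡ (+ 4) {y * y} {(i * i + i) - (l * l + l)} (λ ())
      (κ4 l y i (subst₂ (λ X n → X * X + + 4 * (y * y) ≡ n * n) eX en e))))
    (∣m∣n⇒∣m-n (2∣pronic i) (2∣pronic l)))

sum-not-square₃ : ∀ X y n → + 2 ∤ n → X * X + + 3 * (y * y) ≡ n * n → + 2 ∣ y
sum-not-square₃ X y n nn e = byParity (parityℤ y)
  where
  byParity : Parity y → + 2 ∣ y
  byParity (even _ q) = even⇒∣ q
  byParity (odd j ey) = ⊥-elim (byParityX (parityℤ X) (∤⇒odd n nn))
    where
    byParityX : Parity X → (∃ λ i → n ≡ + 2 * i + + 1) → ⊥
    byParityX (even l eX) (i , en) = 4∤2 (divides (i * i + i - l * l - + 3 * (j * j + j))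
      (κ3 l j i (trans (sym (cong₂ (λ X y → X * X + + 3 * (y * y)) eX ey)) (trans e (cong₂ _*_ en en)))))
    byParityX (odd l eX) (i , en) = prime∤1 2-prime (divides (+ 2 * (i * i + i) - + 2 * (l * l + l) - + 6 * (j * j + j) - + 1)
      (three-odd l j i (trans (sym (cong₂ (λ X y → X * X + + 3 * (y * y)) eX ey)) (trans e (cong₂ _*_ en en)))))
      where
      three-odd : ∀ l j i →
        (+ 2 * l + + 1) * (+ 2 * l + + 1) + + 3 * ((+ 2 * j + + 1) * (+ 2 * j + + 1)) ≡ (+ 2 * i + + 1) * (+ 2 * i + + 1) →
        + 1 ≡ (+ 2 * (i * i + i) - + 2 * (l * l + l) - + 6 * (j * j + j) - + 1) * + 2
      three-odd l j i e = ringlc (+ 1) e (solve (l ∷ j ∷ i ∷ []))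

private
  -- The parallelogram law for v = (1 , 0) and w = (2 p - 1 , 2 q): (p , q) and (1 - p , - q) are
  -- the halves of v + w and v - w.
  half-parallelogram : ∀ n b c p q →
    n * ((+ 2 * p - + 1) * (+ 2 * p - + 1)) + b * ((+ 2 * p - + 1) * (+ 2 * q)) + c * ((+ 2 * q) * (+ 2 * q)) ≡ n →
    + 2 * (n * (p * p) + b * (p * q) + c * (q * q)) + + 2 *
      (n * ((+ 1 - p) * (+ 1 - p)) + b * ((+ 1 - p) * (- q)) + c * ((- q) * (- q))) ≡ + 2 * n
  half-parallelogram n b c p q e = ringlc (+ 1) e (solve (n ∷ b ∷ c ∷ p ∷ q ∷ []))

  halve-sum : ∀ A B n → + 2 * A + + 2 * B ≡ + 2 * n → A + B ≡ n
  halve-sum A B n e = cancelˡ (+ 2) (λ ()) (trans (ℤₚ.*-distribˡ-+ (+ 2) A B) e)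

  double₁ : ∀ c X p x → p ≡ c * X → x ≡ + 2 * p - + 1 → + 2 * c * X ≡ + 1 + + 1 * x
  double₁ c X p x e f = ringlc₂ (- + 2) (- + 1) e f (solve (c ∷ X ∷ p ∷ x ∷ []))

  double₂ : ∀ c Y q y → q ≡ c * Y → y ≡ + 2 * q → + 2 * c * Y ≡ + 1 * y
  double₂ c Y q y e f = ringlc₂ (- + 2) (- + 1) e f (solve (c ∷ Y ∷ q ∷ y ∷ []))

  double₃ : ∀ c X p x → + 1 - p ≡ c * X → x ≡ + 2 * p - + 1 → + 2 * c * X ≡ + 1 + (- + 1) * x
  double₃ c X p x e f = ringlc₂ (- + 2) (+ 1) e f (solve (c ∷ X ∷ p ∷ x ∷ []))

  double₄ : ∀ c Y q y → - q ≡ c * Y → y ≡ + 2 * q → + 2 * c * Y ≡ (- + 1) * y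
  double₄ c Y q y e f = ringlc₂ (- + 2) (+ 1) e f (solve (c ∷ Y ∷ q ∷ y ∷ []))

  opposite-values : ∀ n b x y → (+ 2 * n + + 1 * (+ 2 * n * x + b * y)) + (+ 2 * n + (- + 1) * (+ 2 * n * x + b * y)) ≡ + 4 * n
  opposite-values = solve-∀

-- The forms of discriminant - ℓ² κ with κ = 3 or 4, ℓ prime: orders of index ℓ in ℤ[ω] or ℤ[i].
module Exceptional {ℓ : ℤ} (pℓ : IsPrime ℓ) (κ : ℕ) (κ34 : κ ≡ 3 ⊎ κ ≡ 4) where

  Δ = ℓ * ℓ * + κ

  Adm : ℤ → Set
  Adm n = ℓ ∤ n

  adm-∣ : ∀ {P} → IsPrime P → P ∤ Δ → ∀ i n n₁ → Adm n → n₁ ∣ n * P ^ i → Adm n₁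
  adm-∣ {P} pP nΔ i n n₁ adm d dℓ = [ adm , (λ dP → nP (prime-∣-prime pP pℓ (prime-∣-^ pℓ i dP))) ]′
    (euclid pℓ n (P ^ i) (∣-trans dℓ d))
    where
    nP : ¬ ℓ ≡ P
    nP q = nΔ (subst (_∣ Δ) q (∣m⇒∣m*n (+ κ) (∣m⇒∣m*n ℓ ∣-refl)))

  -- L differs from ℓ since ℓ ∤ n, so L² ∣ κ, which leaves L = 2 and κ = 4. Then ℓ² + b² = 4 k with
  -- ℓ and b odd, impossible modulo 4.
  maximal : ∀ {L} → IsPrime L → ∀ n → Adm n → L ∣ n → ∀ k b → ¬ Δ ≡ L * L * (+ 4 * k - b * b)
  maximal {L} pL n adm dL k b e = bySquare pL nℓ refl (^-∣-cancel pL nℓ 2 (+ κ) (^-∣-cancel pL nℓ 2 (ℓ * + κ) L²∣))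
    where
    nℓ : L ∤ ℓ
    nℓ d = adm (subst (_∣ n) (prime-∣-prime pℓ pL d) dL)
    L²∣ : L ^ 2 ∣ ℓ * (ℓ * + κ)
    L²∣ = subst₂ _∣_ (cong (L *_) (sym (ℤₚ.*-identityʳ L))) (ℤₚ.*-assoc ℓ ℓ (+ κ))
      (divides (+ 4 * k - b * b) (trans e (ℤₚ.*-comm (L * L) (+ 4 * k - b * b))))
    κ≤4 : κ ℕ.≤ 4
    κ≤4 = [ (λ { refl → ℕₚ.n≤1+n 3 }) , (λ { refl → ℕₚ.≤-refl }) ]′ κ34
    at2 : L ≡ + 2 → + 4 ∣ + κ → ⊥
    at2 refl d = [ (λ { refl → 4∤3 d }) , at24 ]′ κ34
      where
      4∤3 : ¬ + 4 ∣ + 3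
      4∤3 d with ℕ∣.∣⇒≤ (∣⇒∣ᵤ d)
      ... | s≤s (s≤s (s≤s ()))
      at24 : κ ≡ 4 → ⊥
      at24 q = odd-squares-sum ℓ b k nℓ nb sum
        where
        rearr : ∀ ℓ k b → ℓ * ℓ * + 4 ≡ + 2 * + 2 * (+ 4 * k - b * b) → + 4 * (ℓ * ℓ + b * b) ≡ + 4 * (+ 4 * k)
        rearr ℓ k b e = ringlc (+ 1) e (solve (ℓ ∷ k ∷ b ∷ []))
        sum : ℓ * ℓ + b * b ≡ + 4 * k
        sum = cancelˡ (+ 4) (λ ()) (rearr ℓ k b (trans (cong (λ κ → ℓ * ℓ * + κ) (sym q)) e))
        nb : + 2 ∤ b
        nb db = nℓ (euclid-sq 2-prime ℓ
          (∣m+n∣n⇒∣m {+ 2} {ℓ * ℓ} {b * b} (subst (+ 2 ∣_) (sym sum) (∣m⇒∣m*n k (divides (+ 2) refl))) (∣m⇒∣m*n b db)))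
    bySquare : IsPrime L → L ∤ ℓ → ∀ {L′} → L ≡ L′ → L′ ^ 2 ∣ + κ → ⊥
    bySquare (isPrime {p} pr) nℓ refl d = small p (prime-abs>1 (isPrime pr)) refl d
      where
      small : ∀ q → 1 ℕ.< q → p ≡ q → (+ q) ^ 2 ∣ + κ → ⊥
      small 2 _ r d = at2 (cong +_ r) d
      small (suc (suc (suc q))) _ _ d = tooBig (ℕₚ.≤-trans (ℕ∣.∣⇒≤ {{κ-nonZero}} (∣⇒∣ᵤ d)) κ≤4)
        where
        κ-nonZero : NonZero κ
        κ-nonZero = [ (λ { refl → _ }) , (λ { refl → _ }) ]′ κ34
        tooBig : ¬ abs ((+ (3 ℕ.+ q)) ^ 2) ℕ.≤ 4
        tooBig l = contradiction (ℕₚ.≤-trans nine l) λ { (s≤s (s≤s (s≤s (s≤s ())))) }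
          where
          nine : 9 ℕ.≤ abs ((+ (3 ℕ.+ q)) ^ 2)
          nine = subst (9 ℕ.≤_) (sym (trans (ℤₚ.abs-* (+ (3 ℕ.+ q)) ((+ (3 ℕ.+ q)) ^ 1))
            (cong ((3 ℕ.+ q) ℕ.*_) (cong abs (ℤₚ.*-identityʳ (+ (3 ℕ.+ q)))))))
            (ℕₚ.*-mono-≤ (ℕₚ.m≤m+n 3 q) (ℕₚ.m≤m+n 3 q))
      small 0 ()
      small 1 (s≤s ())

  primitive-bisector : ∀ n b c x y → val n b c x y ≡ n → ¬ y ≡ + 0 → ∀ ε → ε * ε ≡ + 1 →
    ℓ ∤ + 2 * n + ε * (+ 2 * n * x + b * y) → Bisector Adm n b c x y
  primitive-bisector n b c x y v y≢0 ε ε² nv = from (primitivePart (+ 1 + ε * x) (ε * y) nz)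
    where
    nz : ¬ (+ 1 + ε * x ≡ + 0 × ε * y ≡ + 0)
    nz (_ , q) = *≢0 {ε} {y} ε≢0 y≢0 q
      where
      ε≢0 : ¬ ε ≡ + 0
      ε≢0 z = contradiction (subst (λ ε → ε * ε ≡ + 1) z ε²) λ ()
    from : PrimitivePart (+ 1 + ε * x) (ε * y) → Bisector Adm n b c x y
    from (primPart k X Y k≢0 eX eY uni) = bisector ε k X Y ε² k≢0 (sym eX) (sym eY) uni
      (λ d → nv (subst (ℓ ∣_) (trans (scale-val n b c X Y k)
        (trans (sym (cong₂ (val n b c) eX eY)) (bis-val n b c x y ε k X Y ε² v))) (∣n⇒∣m*n (k * k) d)))

  private
    halved : ∀ n b c x y ε p q → ε * ε ≡ + 1 → ¬ q ≡ + 0 → (∀ k X → p ≡ k * X → + 2 * k * X ≡ + 1 + ε * x) →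
      (∀ k Y → q ≡ k * Y → + 2 * k * Y ≡ ε * y) →
      ℓ ∤ val n b c p q → Bisector Adm n b c x y
    halved n b c x y ε p q ε² q≢0 fX fY nv = from (primitivePart p q (λ z → q≢0 (proj₂ z)))
      where
      from : PrimitivePart p q → Bisector Adm n b c x y
      from (primPart k X Y k≢0 eX eY uni) = bisector ε (+ 2 * k) X Y ε² (*≢0 {+ 2} {k} (λ ()) k≢0) (fX k X eX) (fY k Y eY) uni
        (λ d → nv (subst (ℓ ∣_) (trans (scale-val n b c X Y k) (sym (cong₂ (val n b c) eX eY))) (∣n⇒∣m*n (k * k) d)))

  -- The values of v + w and v - w add up to 4 n, which is prime to ℓ, so at least one of them is
  -- prime to ℓ.
  bisect-odd : ¬ ℓ ≡ + 2 → ∀ n b c x y → Adm n → val n b c x y ≡ n → ¬ y ≡ + 0 → Bisector Adm n b c x y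
  bisect-odd ℓ≢2 n b c x y adm v y≢0 = choose (ℓ ∣? (+ 2 * n + + 1 * (+ 2 * n * x + b * y)))
    where
    choose : Dec (ℓ ∣ + 2 * n + + 1 * (+ 2 * n * x + b * y)) → Bisector Adm n b c x y
    choose (no nd) = primitive-bisector n b c x y v y≢0 (+ 1) refl nd
    choose (yes d) = primitive-bisector n b c x y v y≢0 (- + 1) refl
      (λ d′ → ∤-* pℓ (+ 4) n (λ d4 → ℓ≢2 (prime-∣-prime 2-prime pℓ (euclid-sq pℓ (+ 2) d4))) adm
        (subst (ℓ ∣_) (opposite-values n b x y) (∣m∣n⇒∣m+n d d′)))

  -- For ℓ = 2 the sum 4 n gives nothing. But b = 2 β, and (n x + β y)² + κ y² = n² with n odd
  -- forces y to be even, hence x odd. So v ± w can be halved, and the values of the halves have the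
  -- odd sum n.
  bisect-2 : ℓ ≡ + 2 → ∀ n b c x y → + 4 * (n * c) - b * b ≡ Δ → Adm n → val n b c x y ≡ n → ¬ y ≡ + 0 → Bisector Adm n b c x y
  bisect-2 ℓ≡2 n b c x y disc adm v y≢0 = fromB (euclid-sq 2-prime b 2∣bb)
    where
    n-odd : + 2 ∤ n
    n-odd = subst (_∤ n) ℓ≡2 adm
    Δ≡ : + 4 * (n * c) - b * b ≡ + 2 * + 2 * + κ
    Δ≡ = trans disc (cong (λ ℓ → ℓ * ℓ * + κ) ℓ≡2)
    bb : ∀ n b c κ → + 4 * (n * c) - b * b ≡ + 2 * + 2 * κ → b * b ≡ (+ 2 * (n * c) - + 2 * κ) * + 2
    bb n b c κ e = ringlc (- + 1) e (solve (n ∷ b ∷ c ∷ κ ∷ []))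
    2∣bb : + 2 ∣ b * b
    2∣bb = divides (+ 2 * (n * c) - + 2 * + κ) (bb n b c (+ κ) Δ≡)
    halfDisc : ∀ n β c κ → + 4 * (n * c) - (β * + 2) * (β * + 2) ≡ + 2 * + 2 * κ → + 4 * (n * c - β * β) ≡ + 4 * κ
    halfDisc n β c κ e = ringlc (+ 1) e (solve (n ∷ β ∷ c ∷ κ ∷ []))
    square : ∀ n β c x y κ → n * c - β * β ≡ κ → n * (x * x) + (β * + 2) * (x * y) + c * (y * y) ≡ n →
      (n * x + β * y) * (n * x + β * y) + κ * (y * y) ≡ n * n
    square n β c x y κ e f = ringlc₂ (- (y * y)) n e f (solve (n ∷ β ∷ c ∷ x ∷ y ∷ κ ∷ []))
    x-parity : ∀ n β c x q → n * (x * x) + (β * + 2) * (x * (q * + 2)) + c * ((q * + 2) * (q * + 2)) ≡ n →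
      n * ((x - + 1) * (x + + 1)) ≡ (- (+ 2 * (β * x * q)) - + 2 * (c * q * q)) * + 2
    x-parity n β c x q e = ringlc (+ 1) e (solve (n ∷ β ∷ c ∷ x ∷ q ∷ []))
    fromB : + 2 ∣ b → Bisector Adm n b c x y
    fromB (divides β eb) = fromY y-even
      where
      nc : n * c - β * β ≡ + κ
      nc = cancelˡ (+ 4) (λ ()) (halfDisc n β c (+ κ) (subst (λ b → + 4 * (n * c) - b * b ≡ + 2 * + 2 * + κ) eb Δ≡))
      v′ : val n (β * + 2) c x y ≡ n
      v′ = subst (λ b → val n b c x y ≡ n) eb v
      sq : (n * x + β * y) * (n * x + β * y) + + κ * (y * y) ≡ n * n
      sq = square n β c x y (+ κ) nc v′
      y-even : + 2 ∣ y
      y-even = [ (λ q → sum-not-square₃ (n * x + β * y) y n n-odd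
        (subst (λ κ → (n * x + β * y) * (n * x + β * y) + + κ * (y * y) ≡ n * n) q sq))
               , (λ q → sum-not-square₄ (n * x + β * y) y n n-odd
                 (subst (λ κ → (n * x + β * y) * (n * x + β * y) + + κ * (y * y) ≡ n * n) q sq)) ]′ κ34
      fromY : + 2 ∣ y → Bisector Adm n b c x y
      fromY (divides q ey) = fromX ([ below , (λ d → d) ]′
        (euclid 2-prime (x - + 1) (x + + 1) (euclid′ 2-prime n-odd ((x - + 1) * (x + + 1))
          (divides (- (+ 2 * (β * x * q)) - + 2 * (c * q * q))
            (x-parity n β c x q (subst (λ y → val n (β * + 2) c x y ≡ n) ey v′))))))
        where
        below : + 2 ∣ x - + 1 → + 2 ∣ x + + 1
        below d = subst (+ 2 ∣_) (lem x) (∣m∣n⇒∣m+n d (∣-refl {+ 2}))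
          where
          lem : ∀ x → x - + 1 + + 2 ≡ x + + 1
          lem = solve-∀
        fromX : + 2 ∣ x + + 1 → Bisector Adm n b c x y
        fromX (divides p ep) = choose (ℓ ∣? val n b c p q)
          where
          ex : x ≡ + 2 * p - + 1
          ex = lem x p ep
            where
            lem : ∀ x p → x + + 1 ≡ p * + 2 → x ≡ + 2 * p - + 1
            lem x p e = ringlc (+ 1) e (solve (x ∷ p ∷ []))
          ey′ : y ≡ + 2 * q
          ey′ = trans ey (ℤₚ.*-comm q (+ 2))
          q≢0 : ¬ q ≡ + 0
          q≢0 z = y≢0 (trans ey (cong (_* + 2) z))
          sum : val n b c p q + val n b c (+ 1 - p) (- q) ≡ n
          sum = halve-sum (val n b c p q) (val n b c (+ 1 - p) (- q)) n
            (half-parallelogram n b c p q (subst₂ (λ x y → val n b c x y ≡ n) ex ey′ v))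
          choose : Dec (ℓ ∣ val n b c p q) → Bisector Adm n b c x y
          choose (no nd) = halved n b c x y (+ 1) p q refl q≢0 (λ k X e → double₁ k X p x e ex)
            (λ k Y e → double₂ k Y q y e ey′) nd
          choose (yes d) = halved n b c x y (- + 1) (+ 1 - p) (- q) refl
            (λ z → q≢0 (trans (sym (ℤₚ.neg-involutive q)) (cong -_ z)))
            (λ k X e → double₃ k X p x e ex) (λ k Y e → double₄ k Y q y e ey′) (λ d′ → adm (subst (ℓ ∣_) sum (∣m∣n⇒∣m+n d d′)))

  admissible : Admissible Δ Adm
  admissible = record
    { adm≢0 = λ adm q → adm (subst (ℓ ∣_) (sym q) (divides (+ 0) refl))
    ; adm-∣ = adm-∣
    ; maximal = maximal
    ; bisect = bisect }
    where
    bisect : ∀ n b c x y → + 4 * (n * c) - b * b ≡ Δ → Adm n → val n b c x y ≡ n → ¬ y ≡ + 0 → Bisector Adm n b c x y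
    bisect n b c x y disc adm v y≢0 = byTwo (ℓ ℤ.≟ + 2)
      where
      byTwo : Dec (ℓ ≡ + 2) → Bisector Adm n b c x y
      byTwo (yes q) = bisect-2 q n b c x y disc adm v y≢0
      byTwo (no nq) = bisect-odd nq n b c x y adm v y≢0

-- Reduction of the discriminant

NoCommonPrime : ℤ → ℤ → ℤ → Set
NoCommonPrime a b c = ∀ {L} → IsPrime L → L ∣ a → L ∣ b → L ∣ c → ⊥

Realisable : ℕ → (a b c : ℤ) → Set
Realisable k a b c = ∃ λ N → (¬ N ≡ + 0) × Count a b c N k

private
  scaled-value : ∀ a b c k ℓ b′ c′ x y → b + + 2 * (a * k) ≡ ℓ * b′ → a * (k * k) + b * k + c ≡ ℓ * ℓ * c′ →
    a * ((ℓ * x + k * y) * (ℓ * x + k * y)) + b * ((ℓ * x + k * y) * y) + c * (y * y) ≡ ℓ * ℓ *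
      (a * (x * x) + b′ * (x * y) + c′ * (y * y))
  scaled-value a b c k ℓ b′ c′ x y e f = ringlc₂ (ℓ * x * y) (y * y) e f (solve (a ∷ b ∷ c ∷ k ∷ ℓ ∷ b′ ∷ c′ ∷ x ∷ y ∷ []))

  scaled-det : ∀ k ℓ x y x′ y′ → (ℓ * x + k * y) * y′ - (ℓ * x′ + k * y′) * y ≡ ℓ * (x * y′ - x′ * y)
  scaled-det = solve-∀

  sublattice : ∀ a b c k ℓ b′ c′ X Y N → b + + 2 * (a * k) ≡ ℓ * b′ → a * (k * k) + b * k + c ≡ ℓ * ℓ * c′ →
    a * (X * X) + b * (X * Y) + c * (Y * Y) ≡ ℓ * ℓ * N → a * ((X - k * Y) * (X - k * Y)) ≡
      (ℓ * N - b′ * ((X - k * Y) * Y) - ℓ * c′ * (Y * Y)) * ℓ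
  sublattice a b c k ℓ b′ c′ X Y N e f g = ringlc₃ (- ((X - k * Y) * Y)) (- (Y * Y)) (+ 1) e f g
    (solve (a ∷ b ∷ c ∷ k ∷ ℓ ∷ b′ ∷ c′ ∷ X ∷ Y ∷ N ∷ []))

  polar-norm : ∀ a b c x y x′ y′ N N′ D → + 4 * (a * c) - b * b ≡ D → a * (x * x) + b * (x * y) + c * (y * y) ≡ N →
    a * (x′ * x′) + b * (x′ * y′) + c * (y′ * y′) ≡ N′ →
    (+ 2 * a * x * x′ + b * (x * y′ + x′ * y) + + 2 * c * y * y′) *
      (+ 2 * a * x * x′ + b * (x * y′ + x′ * y) + + 2 * c * y * y′)
      + D * ((x * y′ - x′ * y) * (x * y′ - x′ * y)) ≡ + 4 * (N * N′)
  polar-norm a b c x y x′ y′ N N′ D e f g = ringlc₃ (- ((x * y′ - x′ * y) * (x * y′ - x′ * y)))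
    (+ 4 * (a * (x′ * x′) + b * (x′ * y′) + c * (y′ * y′))) (+ 4 * N) e f g
    (solve (a ∷ b ∷ c ∷ x ∷ y ∷ x′ ∷ y′ ∷ N ∷ N′ ∷ D ∷ []))

sum-abs : ∀ d B Y m → B * B + + suc d * (Y * Y) ≡ + m → abs B ℕ.* abs B ℕ.+ suc d ℕ.* (abs Y ℕ.* abs Y) ≡ m
sum-abs d B Y m e = ℤₚ.+-injective (trans (sym (sum-squares d B Y)) e)

-- Units of an order of discriminant < -4 are ± 1.
det-zero : ∀ d B Y N → 4 ℕ.≤ d → ¬ N ≡ + 0 → N ∣ Y → B * B + + suc d * (Y * Y) ≡ + 4 * (N * N) → Y ≡ + 0
det-zero d B Y N ld N≢0 (divides u eY) e = ℤₚ.∣i∣≡0⇒i≡0 (byAbs (abs u) refl)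
  where
  n = abs N
  Y≡ : abs Y ≡ abs u ℕ.* n
  Y≡ = trans (cong abs eY) (ℤₚ.abs-* u N)
  n≥1 : 1 ℕ.≤ n
  n≥1 = ℕₚ.n≢0⇒n>0 (λ q → N≢0 (ℤₚ.∣i∣≡0⇒i≡0 q))
  byAbs : ∀ a → abs u ≡ a → abs Y ≡ 0
  byAbs zero q = trans Y≡ (cong (ℕ._* n) q)
  byAbs (suc a) q = contradiction
    (ℕₚ.≤-trans five (ℕₚ.≤-trans (ℕₚ.m≤n+m (suc d ℕ.* (abs Y ℕ.* abs Y)) (abs B ℕ.* abs B))
    (ℕₚ.≤-reflexive (sum-abs d B Y (4 ℕ.* (n ℕ.* n))
    (trans e (trans (cong (+ 4 *_) (sq-abs N)) (sym (ℤₚ.pos-* 4 (n ℕ.* n)))))) )))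
      (ℕₚ.<⇒≱ (ℕₚ.*-monoˡ-< (n ℕ.* n) {{ℕ.>-nonZero (ℕₚ.*-mono-≤ n≥1 n≥1)}} (ℕₚ.n<1+n 4)))
    where
    n≤Y : n ℕ.≤ abs Y
    n≤Y = subst (n ℕ.≤_) (sym (trans Y≡ (cong (ℕ._* n) q))) (ℕₚ.m≤m+n n (a ℕ.* n))
    five : 5 ℕ.* (n ℕ.* n) ℕ.≤ suc d ℕ.* (abs Y ℕ.* abs Y)
    five = ℕₚ.*-mono-≤ (s≤s ld) (ℕₚ.*-mono-≤ n≤Y n≤Y)

-- All vectors of value ℓ² N lie in the sublattice of the (ℓ z + k₀ y , y). Passing to it multiplies
-- determinants by ℓ but values by ℓ², so divisibility of the determinant by N is not enough for
-- completeness. The bound on d′ leaves only the units ± 1, and then the determinant of two vectors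
-- in one orbit is 0.
scaledCount : ∀ {a b c ℓ} → IsPrime ℓ → ℓ ∤ a → ∀ k₀ b′ c′ d′ → 4 ℕ.≤ d′ → b + + 2 * (a * k₀) ≡ ℓ * b′ →
  a * (k₀ * k₀) + b * k₀ + c ≡ ℓ * ℓ * c′ →
  + 4 * (a * c′) - b′ * b′ ≡ + suc d′ → ∀ {k} → Realisable k a b′ c′ → Realisable k a b c
scaledCount {a} {b} {c} {ℓ} pℓ ℓ∤a k₀ b′ c′ d′ ld e f disc′ {k} (N , N≢0 , C) = ℓ * ℓ * N , *≢0 ℓℓ≢0 N≢0 , record
    { X = X′ ; Y = Y ; value = value′ ; distinct = distinct′ ; complete = complete′ }
  where
  open Count C
  ℓ≢0 : ¬ ℓ ≡ + 0
  ℓ≢0 = prime≢0 pℓ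
  ℓℓ≢0 : ¬ ℓ * ℓ ≡ + 0
  ℓℓ≢0 = *≢0 ℓ≢0 ℓ≢0
  X′ : Fin k → ℤ
  X′ i = ℓ * X i + k₀ * Y i
  value′ : ∀ i → val a b c (X′ i) (Y i) ≡ ℓ * ℓ * N
  value′ i = trans (scaled-value a b c k₀ ℓ b′ c′ (X i) (Y i) e f) (cong (ℓ * ℓ *_) (value i))
  distinct′ : ∀ i j → ℓ * ℓ * N ∣ X′ i * Y j - X′ j * Y i → i ≡ j
  distinct′ i j d = distinct i j (∣-trans (∣n⇒∣m*n ℓ ∣-refl)
    (∣-cancelˡ ℓ ℓ≢0 (subst₂ _∣_ (ℤₚ.*-assoc ℓ ℓ N) (scaled-det k₀ ℓ (X i) (Y i) (X j) (Y j)) d)))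
  complete′ : ∀ x y → val a b c x y ≡ ℓ * ℓ * N → ∃ λ i → ℓ * ℓ * N ∣ X′ i * y - x * Y i
  complete′ x y v = go (euclid-sq pℓ (x - k₀ * y) (euclid′ pℓ ℓ∤a ((x - k₀ * y) * (x - k₀ * y))
      (divides (ℓ * N - b′ * ((x - k₀ * y) * y) - ℓ * c′ * (y * y)) (sublattice a b c k₀ ℓ b′ c′ x y N e f v))))
    where
    go : ℓ ∣ x - k₀ * y → ∃ λ i → ℓ * ℓ * N ∣ X′ i * y - x * Y i
    go (divides z ez) = fromComplete (complete z y vz)
      where
      ex : x ≡ ℓ * z + k₀ * y
      ex = lem x (k₀ * y) z ℓ ez
        where
        lem : ∀ x w z ℓ → x - w ≡ z * ℓ → x ≡ ℓ * z + w
        lem x w z ℓ e = ringlc (+ 1) e (solve (x ∷ w ∷ z ∷ ℓ ∷ []))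
      vz : val a b′ c′ z y ≡ N
      vz = cancelˡ (ℓ * ℓ) ℓℓ≢0 (trans (sym (scaled-value a b c k₀ ℓ b′ c′ z y e f))
        (trans (cong (λ x → val a b c x y) (sym ex)) v))
      fromComplete : (∃ λ i → N ∣ X i * y - z * Y i) → ∃ λ i → ℓ * ℓ * N ∣ X′ i * y - x * Y i
      fromComplete (i , d) = i , subst (λ x → ℓ * ℓ * N ∣ X′ i * y - x * Y i) (sym ex)
        (subst (ℓ * ℓ * N ∣_) (sym (trans (scaled-det k₀ ℓ (X i) (Y i) z y) (cong (ℓ *_)
          (det-zero d′ (+ 2 * a * X i * z + b′ * (X i * y + z * Y i) + + 2 * c′ * Y i * y) (X i * y - z * Y i) N ld N≢0 d
            (polar-norm a b′ c′ (X i) (Y i) z y N N (+ suc d′) disc′ (value i) vz)))))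
          (divides (+ 0) (ℤₚ.*-zeroʳ ℓ)))

swapCount : ∀ {a b c k} → Realisable k c b a → Realisable k a b c
swapCount {a} {b} {c} {k} (N , N≢0 , C) = N , N≢0 , record
    { X = Y ; Y = X ; value = λ i → trans (swap-val a b c (Y i) (X i)) (value i)
    ; distinct = λ i j d → distinct i j (subst (N ∣_) (swap-det (X i) (Y i) (X j) (Y j)) (∣m⇒∣-m d))
    ; complete = complete′ }
  where
  open Count C
  swap-val : ∀ a b c x y → a * (x * x) + b * (x * y) + c * (y * y) ≡ c * (y * y) + b * (y * x) + a * (x * x)
  swap-val = solve-∀
  swap-det : ∀ x y x′ y′ → - (y * x′ - y′ * x) ≡ x * y′ - x′ * y
  swap-det = solve-∀
  swap-det′ : ∀ x y x′ y′ → - (x * y′ - x′ * y) ≡ y * x′ - y′ * x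
  swap-det′ = solve-∀
  complete′ : ∀ x y → val a b c x y ≡ N → ∃ λ i → N ∣ Y i * y - x * X i
  complete′ x y v = from (complete y x (trans (sym (swap-val a b c x y)) v))
    where
    from : (∃ λ i → N ∣ X i * x - y * Y i) → ∃ λ i → N ∣ Y i * y - x * X i
    from (i , d) = i , subst (N ∣_) (swap-det′ (X i) (Y i) y x) (∣m⇒∣-m d)

private
  parity-b : ∀ a b c ℓ κ β → + 4 * (a * c) - b * b ≡ ℓ * ℓ * (+ 4 * κ - β * β) →
    (b - ℓ * β) * (b - ℓ * β) ≡ (+ 2 * (a * c) - + 2 * (ℓ * ℓ * κ) + ℓ * β * (ℓ * β) - ℓ * β * b) * + 2
  parity-b a b c ℓ κ β e = ringlc (- + 1) e (solve (a ∷ b ∷ c ∷ ℓ ∷ κ ∷ β ∷ []))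

  shifted-b : ∀ a b ℓ β δ k j → b - ℓ * β ≡ δ * + 2 → a * k + δ ≡ ℓ * j → b + + 2 * (a * k) ≡ ℓ * (β + + 2 * j)
  shifted-b a b ℓ β δ k j e f = ringlc₂ (+ 1) (+ 2) e f (solve (a ∷ b ∷ ℓ ∷ β ∷ δ ∷ k ∷ j ∷ []))

  shifted-c : ∀ a b c ℓ κ β k b′ → + 4 * (a * c) - b * b ≡ ℓ * ℓ * (+ 4 * κ - β * β) → b + + 2 * (a * k) ≡ ℓ * b′ →
    + 4 * (a * (a * (k * k) + b * k + c)) ≡ ℓ * ℓ * (b′ * b′ + + 4 * κ - β * β)
  shifted-c a b c ℓ κ β k b′ e f = ringlc₂ (+ 1) (b + + 2 * (a * k) + ℓ * b′) e f (solve (a ∷ b ∷ c ∷ ℓ ∷ κ ∷ β ∷ k ∷ b′ ∷ []))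

  shifted-square : ∀ β j κ ℓ → ℓ * ℓ * ((β + + 2 * j) * (β + + 2 * j) + + 4 * κ - β * β) ≡ + 4 * ((β * j + j * j + κ) * (ℓ * ℓ))
  shifted-square = solve-∀

  shifted-disc : ∀ a q ℓ b′ κ β c′ → + 4 * (a * q) ≡ ℓ * ℓ * (b′ * b′ + + 4 * κ - β * β) → q ≡ ℓ * ℓ * c′ →
    ℓ * ℓ * (+ 4 * (a * c′) - b′ * b′) ≡ ℓ * ℓ * (+ 4 * κ - β * β)
  shifted-disc a q ℓ b′ κ β c′ e f = ringlc₂ (+ 1) (- (+ 4 * a)) e f (solve (a ∷ q ∷ ℓ ∷ b′ ∷ κ ∷ β ∷ c′ ∷ []))

  solve-linear : ∀ a w ℓ y δ → a * y ≡ + 1 + ℓ * w → a * (- (y * δ)) + δ ≡ ℓ * (- (w * δ))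
  solve-linear a w ℓ y δ e = ringlc (- δ) e (solve (a ∷ w ∷ ℓ ∷ y ∷ δ ∷ []))

record Overform (a b c ℓ Δ′ : ℤ) : Set where
  field
    k₀ b′ c′ : ℤ
    b≡ : b + + 2 * (a * k₀) ≡ ℓ * b′
    c≡ : a * (k₀ * k₀) + b * k₀ + c ≡ ℓ * ℓ * c′
    disc′ : + 4 * (a * c′) - b′ * b′ ≡ Δ′

-- k₀ solves a k + δ ≡ 0 modulo ℓ, where 2 δ = b - ℓ β; such a δ exists because b and ℓ β have the
-- same parity. The shape 4 κ - β² of the smaller discriminant treats ℓ = 2 like the odd primes.
overform : ∀ {a b c ℓ} → IsPrime ℓ → ℓ ∤ a → ∀ κ β → + 4 * (a * c) - b * b ≡ ℓ * ℓ * (+ 4 * κ - β * β) →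
  Overform a b c ℓ (+ 4 * κ - β * β)
overform {a} {b} {c} {ℓ} pℓ ℓ∤a κ β disc = fromParity (euclid-sq 2-prime (b - ℓ * β)
    (divides (+ 2 * (a * c) - + 2 * (ℓ * ℓ * κ) + ℓ * β * (ℓ * β) - ℓ * β * b) (parity-b a b c ℓ κ β disc)))
  where
  Δ′ = + 4 * κ - β * β
  ℓℓ≢0 : ¬ ℓ * ℓ ≡ + 0
  ℓℓ≢0 = *≢0 (prime≢0 pℓ) (prime≢0 pℓ)
  fromParity : + 2 ∣ b - ℓ * β → Overform a b c ℓ Δ′
  fromParity (divides δ eδ) = fromInverse (inverse-mod pℓ ℓ∤a)
    where
    fromInverse : (∃₂ λ y w → a * y ≡ + 1 + ℓ * w) → Overform a b c ℓ Δ′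
    fromInverse (y , w , ey) = fromSquare
      (subst (_∣ q) ℓ² (^-∣-cancel pℓ ℓ∤a 2 q (subst (_∣ a * q) (sym ℓ²) (divides (β * j + j * j + κ) aq))))
      where
      k₀ = - (y * δ)
      j = - (w * δ)
      b′ = β + + 2 * j
      q = a * (k₀ * k₀) + b * k₀ + c
      ℓ² : ℓ ^ 2 ≡ ℓ * ℓ
      ℓ² = cong (ℓ *_) (ℤₚ.*-identityʳ ℓ)
      b≡ : b + + 2 * (a * k₀) ≡ ℓ * b′
      b≡ = shifted-b a b ℓ β δ k₀ j eδ (solve-linear a w ℓ y δ ey)
      4aq : + 4 * (a * q) ≡ ℓ * ℓ * (b′ * b′ + + 4 * κ - β * β)
      4aq = shifted-c a b c ℓ κ β k₀ b′ disc b≡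
      aq : a * q ≡ (β * j + j * j + κ) * (ℓ * ℓ)
      aq = cancelˡ (+ 4) (λ ()) (trans 4aq (shifted-square β j κ ℓ))
      fromSquare : ℓ * ℓ ∣ q → Overform a b c ℓ Δ′
      fromSquare (divides c′ eq) = record { k₀ = k₀ ; b′ = b′ ; c′ = c′ ; b≡ = b≡ ; c≡ = q≡
          ; disc′ = cancelˡ (ℓ * ℓ) ℓℓ≢0 (shifted-disc a q ℓ b′ κ β c′ 4aq q≡) }
        where
        q≡ : q ≡ ℓ * ℓ * c′
        q≡ = trans eq (ℤₚ.*-comm c′ (ℓ * ℓ))

private
  L∣b-from : ∀ {L} a b k ℓ b′ → b + + 2 * (a * k) ≡ ℓ * b′ → L ∣ a → L ∣ b′ → L ∣ b
  L∣b-from {L} a b k ℓ b′ e da db′ = ∣m+n∣n⇒∣m {L} {b} {+ 2 * (a * k)} (subst (L ∣_) (sym e) (∣n⇒∣m*n ℓ db′))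
    (∣n⇒∣m*n (+ 2) (∣m⇒∣m*n k da))

  L∣c-from : ∀ {L} a b c k ℓ c′ → a * (k * k) + b * k + c ≡ ℓ * ℓ * c′ → L ∣ a → L ∣ b → L ∣ c′ → L ∣ c
  L∣c-from {L} a b c k ℓ c′ e da db dc′ = ∣m+n∣m⇒∣n {L} {a * (k * k) + b * k} {c} (subst (L ∣_) (sym e) (∣n⇒∣m*n (ℓ * ℓ) dc′))
    (∣m∣n⇒∣m+n (∣m⇒∣m*n (k * k) da) (∣m⇒∣m*n k db))

  ac-comm : ∀ a b c → + 4 * (c * a) - b * b ≡ + 4 * (a * c) - b * b
  ac-comm = solve-∀

-- The values of (a , b , c) divisible by ℓ² are ℓ² times the values of a form of discriminant divided by ℓ².
throughOverform : ∀ {k a b c ℓ} → IsPrime ℓ → ∀ κ β d′ → 4 ℕ.≤ d′ → + 4 * (a * c) - b * b ≡ ℓ * ℓ * (+ 4 * κ - β * β) →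
  + 4 * κ - β * β ≡ + suc d′ → NoCommonPrime a b c →
  (∀ a b c → + 4 * (a * c) - b * b ≡ + suc d′ → NoCommonPrime a b c → Realisable k a b c) → Realisable k a b c
throughOverform {k} {a} {b} {c} {ℓ} pℓ κ β d′ ld disc Δ′≡ prim rec = byDivisor (ℓ ∣? a)
  where
  via : ∀ a c → ℓ ∤ a → + 4 * (a * c) - b * b ≡ ℓ * ℓ * (+ 4 * κ - β * β) → NoCommonPrime a b c → Realisable k a b c
  via a c ℓ∤a disc prim = scaledCount {a} {b} {c} {ℓ} pℓ ℓ∤a k₀ b′ c′ d′ ld b≡ c≡ (trans disc′ Δ′≡)
    (rec a b′ c′ (trans disc′ Δ′≡) prim′)
    where
    O : Overform a b c ℓ (+ 4 * κ - β * β)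
    O = overform pℓ ℓ∤a κ β disc
    open Overform O
    prim′ : NoCommonPrime a b′ c′
    prim′ {L} pL da db′ dc′ = prim pL da db (L∣c-from a b c k₀ ℓ c′ c≡ da db dc′)
      where
      db : L ∣ b
      db = L∣b-from a b k₀ ℓ b′ b≡ da db′
  byDivisor : Dec (ℓ ∣ a) → Realisable k a b c
  byDivisor (no nd) = via a c nd disc prim
  byDivisor (yes da) = swapCount {a} {b} {c} (via c a ℓ∤c (trans (ac-comm a b c) disc) (λ pL dc db da → prim pL da db dc))
    where
    ℓ∣b : ℓ ∣ b
    ℓ∣b = euclid-sq pℓ b (subst (ℓ ∣_) (sym (b-sq a b c (ℓ * ℓ * (+ 4 * κ - β * β)) disc))
      (∣m∣n⇒∣m-n (∣n⇒∣m*n (+ 4) (∣m⇒∣m*n c da)) (∣m⇒∣m*n (+ 4 * κ - β * β) (∣m⇒∣m*n ℓ ∣-refl))))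
    ℓ∤c : ℓ ∤ c
    ℓ∤c = prim pℓ da ℓ∣b

-- A primitive vector of value prime to ℓ has to become (1 , 0). The candidates have values a, c and
-- a + b + c: if ℓ divides a and c, it does not divide b.
exceptional : ∀ {ℓ} → IsPrime ℓ → ∀ κ → κ ≡ 3 ⊎ κ ≡ 4 → ∀ d a b c → + 4 * (a * c) - b * b ≡ ℓ * ℓ * + κ → ℓ * ℓ * + κ ≡ + suc d →
  NoCommonPrime a b c → ∀ k → Realisable (suc k) a b c
exceptional {ℓ} pℓ κ κ34 d a b c disc Δ≡ prim k = byA (ℓ ∣? a)
  where
  open Exceptional pℓ κ κ34
  at : ∀ x y → Unimodular x y → ℓ ∤ val a b c x y → Realisable (suc k) a b c
  at x y uni nd = transport (realiseAdmissible admissible d Δ≡ (val a b c x y) b₁ c₁ disc₁ nd k)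
    where
    E : Equivalent Δ a b c (val a b c x y)
    E = equiv {Δ} {a} {b} {c} {val a b c x y} disc x y uni refl
    open Equivalent E
    transport : Realisable (suc k) (val a b c x y) b₁ c₁ → Realisable (suc k) a b c
    transport (N , N≢0 , C) = N , N≢0 , count C
  val₀₁ : ∀ a b c → a * (+ 0 * + 0) + b * (+ 0 * + 1) + c * (+ 1 * + 1) ≡ c
  val₀₁ = solve-∀
  val₁₁ : ∀ a b c → a * (+ 1 * + 1) + b * (+ 1 * + 1) + c * (+ 1 * + 1) - a - c ≡ b
  val₁₁ = solve-∀
  byC : ℓ ∣ a → Dec (ℓ ∣ c) → Realisable (suc k) a b c
  byC da (no nd) = at (+ 0) (+ 1) (- + 1 , + 0 , refl) (subst (ℓ ∤_) (sym (val₀₁ a b c)) nd)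
  byC da (yes dc) = at (+ 1) (+ 1) (+ 0 , + 1 , refl)
    (λ d → prim pℓ da (subst (ℓ ∣_) (val₁₁ a b c) (∣m∣n⇒∣m-n (∣m∣n⇒∣m-n d da) dc)) dc)
  byA : Dec (ℓ ∣ a) → Realisable (suc k) a b c
  byA (no nd) = at (+ 1) (+ 0) (+ 0 , + 1 , refl) (subst (ℓ ∤_) (sym (val₁₀ a b c)) nd)
  byA (yes da) = byC da (ℓ ∣? c)

record SquareDivisor (d : ℕ) : Set where
  constructor squareDivisor
  field
    ℓ : ℤ
    pℓ : IsPrime ℓ
    κ β : ℤ
    β01 : β ≡ + 0 ⊎ β ≡ + 1
    disc≡ : + suc d ≡ ℓ * ℓ * (+ 4 * κ - β * β)

private
  pos-4sq : ∀ p → + (4 ℕ.* (p ℕ.* p)) ≡ + 4 * (+ p * + p)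
  pos-4sq p = trans (ℤₚ.pos-* 4 (p ℕ.* p)) (cong (+ 4 *_) (ℤₚ.pos-* p p))

  β0 : ∀ κ ℓ → κ * (+ 4 * (ℓ * ℓ)) ≡ ℓ * ℓ * (+ 4 * κ - + 0 * + 0)
  β0 = solve-∀

  β1 : ∀ κ ℓ D → D + ℓ * ℓ ≡ κ * (+ 4 * (ℓ * ℓ)) → D ≡ ℓ * ℓ * (+ 4 * κ - + 1 * + 1)
  β1 κ ℓ D e = ringlc (+ 1) e (solve (κ ∷ ℓ ∷ D ∷ []))

  β-even : ∀ k i ℓ → ℓ * ℓ * (+ 4 * k - + 2 * i * (+ 2 * i)) ≡ (k - i * i) * (+ 4 * (ℓ * ℓ))
  β-even = solve-∀

  β-odd : ∀ k i ℓ → ℓ * ℓ * (+ 4 * k - (+ 2 * i + + 1) * (+ 2 * i + + 1)) + ℓ * ℓ ≡ (k - i * i - i) * (+ 4 * (ℓ * ℓ))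
  β-odd = solve-∀

-- Only the parity of the root matters: p² (4 κ - β²) is a multiple of 4 p² for even β and becomes
-- one after adding p² for odd β. A prime p with p² ∣ d + 1 is at most d + 1, so the search is
-- finite.
squareDivisor? : ∀ d → SquareDivisor d ⊎ (∀ {L} → IsPrime L → ∀ k b → ¬ + suc d ≡ L * L * (+ 4 * k - b * b))
squareDivisor? d = fromSearch (ℕₚ.anyUpTo? test (suc (suc d)))
  where
  Test : ℕ → Set
  Test p = Prime p × (4 ℕ.* (p ℕ.* p) ℕ∣.∣ suc d ⊎ 4 ℕ.* (p ℕ.* p) ℕ∣.∣ suc d ℕ.+ p ℕ.* p)
  test : Decidable Test
  test p = prime? p ×-dec ((4 ℕ.* (p ℕ.* p) ℕ∣.∣? suc d) ⊎-dec (4 ℕ.* (p ℕ.* p) ℕ∣.∣? suc d ℕ.+ p ℕ.* p))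
  None : Set
  None = ∀ {L} → IsPrime L → ∀ k b → ¬ + suc d ≡ L * L * (+ 4 * k - b * b)
  fromSearch : Dec (∃ λ p → p ℕ.< suc (suc d) × Test p) → SquareDivisor d ⊎ None
  fromSearch (yes (p , _ , pr , inj₁ (ℕ∣.divides κ e))) = inj₁ (squareDivisor (+ p) (isPrime pr) (+ κ) (+ 0) (inj₁ refl)
    (trans (cong +_ e) (trans (ℤₚ.pos-* κ (4 ℕ.* (p ℕ.* p))) (trans (cong (+ κ *_) (pos-4sq p)) (β0 (+ κ) (+ p))))))
  fromSearch (yes (p , _ , pr , inj₂ (ℕ∣.divides κ e))) = inj₁ (squareDivisor (+ p) (isPrime pr) (+ κ) (+ 1) (inj₂ refl)
    (β1 (+ κ) (+ p) (+ suc d) (trans (cong (ℤ._+_ (+ suc d)) (sym (ℤₚ.pos-* p p))) (trans (sym (ℤₚ.pos-+ (suc d) (p ℕ.* p)))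
      (trans (cong +_ e) (trans (ℤₚ.pos-* κ (4 ℕ.* (p ℕ.* p))) (cong (+ κ *_) (pos-4sq p))))))))
  fromSearch (no none) = inj₂ absent
    where
    absent : None
    absent (isPrime {p} pr) k b e = byParity (parityℤ b)
      where
      p≤ : p ℕ.< suc (suc d)
      p≤ = s≤s (ℕ∣.∣⇒≤ (∣⇒∣ᵤ {+ p} {+ suc d} (subst (+ p ∣_) (sym e) (∣m⇒∣m*n (+ 4 * k - b * b) (∣m⇒∣m*n (+ p) ∣-refl)))))
      byParity : Parity b → ⊥
      byParity (even i eb) = none (p , p≤ , pr , inj₁ (∣⇒∣ᵤ {+ (4 ℕ.* (p ℕ.* p))} {+ suc d} (divides (k - i * i)
        (trans e (trans (cong (λ b → + p * + p * (+ 4 * k - b * b)) eb)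
          (trans (β-even k i (+ p)) (cong ((k - i * i) *_) (sym (pos-4sq p)))))))))
      byParity (odd i eb) = none (p , p≤ , pr , inj₂
        (∣⇒∣ᵤ {+ (4 ℕ.* (p ℕ.* p))} {+ (suc d ℕ.+ p ℕ.* p)} (divides (k - i * i - i)
        (trans (ℤₚ.pos-+ (suc d) (p ℕ.* p))
          (trans (cong₂ _+_ (trans e (cong (λ b → + p * + p * (+ 4 * k - b * b)) eb)) (ℤₚ.pos-* p p))
          (trans (β-odd k i (+ p)) (cong ((k - i * i - i) *_) (sym (pos-4sq p)))))))))

positive-cofactor : ∀ {ℓ} → IsPrime ℓ → ∀ d D → + suc d ≡ ℓ * ℓ * D → ∃ λ d′ → D ≡ + suc d′ × d′ ℕ.< d
positive-cofactor (isPrime {p} pr) d D e = go p (prime-abs>1 (isPrime pr)) D e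
  where
  go : ∀ p → 1 ℕ.< p → ∀ D → + suc d ≡ + p * + p * D → ∃ λ d′ → D ≡ + suc d′ × d′ ℕ.< d
  go (suc p) _ (+ zero) e = contradiction (trans e (ℤₚ.*-zeroʳ (+ suc p * + suc p))) λ ()
  go (suc p) _ -[1+ x ] ()
  go p lp (+ suc d′) e = d′ , refl , ℕₚ.≤-pred
    (subst (suc d′ ℕ.<_) (sym (trans eq (ℕₚ.*-comm (p ℕ.* p) (suc d′)))) (ℕₚ.m<m*n (suc d′) (p ℕ.* p) (ℕₚ.*-mono-< lp lp)))
    where
    eq : suc d ≡ p ℕ.* p ℕ.* suc d′
    eq = ℤₚ.+-injective (trans e (trans (cong (_* + suc d′) (sym (ℤₚ.pos-* p p))) (sym (ℤₚ.pos-* (p ℕ.* p) (suc d′)))))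

small-discriminant : ∀ κ β d′ → β ≡ + 0 ⊎ β ≡ + 1 → + 4 * κ - β * β ≡ + suc d′ → d′ ℕ.< 4 → suc d′ ≡ 3 ⊎ suc d′ ≡ 4
small-discriminant κ β d′ β01 e l = [ zeroCase , oneCase ]′ β01
  where
  add : ∀ κ β D → + 4 * κ - β * β ≡ D → D + β * β ≡ κ * + 4
  add κ β D e = ringlc (- + 1) e (solve (κ ∷ β ∷ D ∷ []))
  4∣ : + 4 ∣ + suc d′ + β * β
  4∣ = divides κ (add κ β (+ suc d′) e)
  byResidue₀ : ∀ d → d ℕ.< 4 → 4 ℕ∣.∣ suc d ℕ.+ 0 → suc d ≡ 3 ⊎ suc d ≡ 4
  byResidue₀ 0 _ d = contradiction (ℕ∣.∣⇒≤ d) λ { (s≤s ()) }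
  byResidue₀ 1 _ d = contradiction (ℕ∣.∣⇒≤ d) λ { (s≤s (s≤s ())) }
  byResidue₀ 2 _ d = contradiction (ℕ∣.∣⇒≤ d) λ { (s≤s (s≤s (s≤s ()))) }
  byResidue₀ 3 _ d = inj₂ refl
  byResidue₀ (suc (suc (suc (suc _)))) (s≤s (s≤s (s≤s (s≤s ())))) _
  byResidue₁ : ∀ d → d ℕ.< 4 → 4 ℕ∣.∣ suc d ℕ.+ 1 → suc d ≡ 3 ⊎ suc d ≡ 4
  byResidue₁ 0 _ d = contradiction (ℕ∣.∣⇒≤ d) λ { (s≤s (s≤s ())) }
  byResidue₁ 1 _ d = contradiction (ℕ∣.∣⇒≤ d) λ { (s≤s (s≤s (s≤s ()))) }
  byResidue₁ 2 _ d = inj₁ refl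
  byResidue₁ 3 _ d = inj₂ refl
  byResidue₁ (suc (suc (suc (suc _)))) (s≤s (s≤s (s≤s (s≤s ())))) _
  zeroCase : β ≡ + 0 → suc d′ ≡ 3 ⊎ suc d′ ≡ 4
  zeroCase q = byResidue₀ d′ l (∣⇒∣ᵤ (subst (λ β → + 4 ∣ + suc d′ + β * β) q 4∣))
  oneCase : β ≡ + 1 → suc d′ ≡ 3 ⊎ suc d′ ≡ 4
  oneCase q = byResidue₁ d′ l (∣⇒∣ᵤ (subst (λ β → + 4 ∣ + suc d′ + β * β) q 4∣))

realiseForm : ∀ k d a b c → + 4 * (a * c) - b * b ≡ + suc d → NoCommonPrime a b c → Realisable (suc k) a b c
realiseForm k = <-rec Goal step
  where
  Goal : ℕ → Set
  Goal d = ∀ a b c → + 4 * (a * c) - b * b ≡ + suc d → NoCommonPrime a b c → Realisable (suc k) a b c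
  step : ∀ d → (∀ {d′} → d′ ℕ.< d → Goal d′) → Goal d
  step d rec a b c disc prim = [ reducible , fundamental ]′ (squareDivisor? d)
    where
    reducible : SquareDivisor d → Realisable (suc k) a b c
    reducible (squareDivisor ℓ pℓ κ β β01 disc≡) = fromCofactor (positive-cofactor pℓ d (+ 4 * κ - β * β) disc≡)
      where
      fromCofactor : (∃ λ d′ → + 4 * κ - β * β ≡ + suc d′ × d′ ℕ.< d) → Realisable (suc k) a b c
      fromCofactor (d′ , Δ′≡ , d′<d) = bySize (4 ℕ.≤? d′)
        where
        disc′ : ℓ * ℓ * + suc d′ ≡ + suc d
        disc′ = trans (cong (ℓ * ℓ *_) (sym Δ′≡)) (sym disc≡)
        bySize : Dec (4 ℕ.≤ d′) → Realisable (suc k) a b c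
        bySize (yes l) = throughOverform {suc k} {a} {b} {c} {ℓ} pℓ κ β d′ l (trans disc disc≡) Δ′≡ prim (rec d′<d)
        bySize (no nl) = exceptional pℓ (suc d′) (small-discriminant κ β d′ β01 Δ′≡ (ℕₚ.≰⇒> nl)) d a b c
          (trans disc (sym disc′)) disc′ prim k
    fundamental : (∀ {L} → IsPrime L → ∀ k b → ¬ + suc d ≡ L * L * (+ 4 * k - b * b)) → Realisable (suc k) a b c
    fundamental max = realiseAdmissible (maximalAdmissible d max) d refl a b c disc a≢0 k
      where
      a≢0 : ¬ a ≡ + 0
      a≢0 q = contradiction (ℕₚ.m+n≡0⇒n≡0 (abs b ℕ.* abs b) (sum-abs d b (+ 1) 0 (cancels a b c (+ suc d) q disc))) λ ()
        where
        cancels : ∀ a b c D → a ≡ + 0 → + 4 * (a * c) - b * b ≡ D → b * b + D * (+ 1 * + 1) ≡ + 0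
        cancels a b c D e f = ringlc₂ (+ 4 * c) (- + 1) e f (solve (a ∷ b ∷ c ∷ D ∷ []))

-- Values not represented

NotRepresented : (a b c : ℤ) → ℕ → Set
NotRepresented a b c n = ∀ x y → ¬ val a b c x y ≡ + n

private
  solution? : ∀ m D → Dec (∃ λ B → B ℕ.< suc m × ∃ λ Y → Y ℕ.< suc m × B ℕ.* B ℕ.+ D ℕ.* (Y ℕ.* Y) ≡ m)
  solution? m D = ℕₚ.anyUpTo? (λ B → ℕₚ.anyUpTo? (λ Y → B ℕ.* B ℕ.+ D ℕ.* (Y ℕ.* Y) ℕ.≟ m) (suc m)) (suc m)

  unsolvable : ∀ m d → ¬ (∃ λ B → B ℕ.< suc m × ∃ λ Y → Y ℕ.< suc m × B ℕ.* B ℕ.+ suc d ℕ.* (Y ℕ.* Y) ≡ m) →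
    ∀ B Y → ¬ B ℕ.* B ℕ.+ suc d ℕ.* (Y ℕ.* Y) ≡ m
  unsolvable m d none B Y e = none (B , s≤s B≤m , Y , s≤s Y≤m , e)
    where
    B≤m : B ℕ.≤ m
    B≤m = ℕₚ.≤-trans (n≤n² B) (subst (B ℕ.* B ℕ.≤_) e (ℕₚ.m≤m+n (B ℕ.* B) (suc d ℕ.* (Y ℕ.* Y))))
    Y≤m : Y ℕ.≤ m
    Y≤m = ℕₚ.≤-trans (n≤n² Y) (ℕₚ.≤-trans (ℕₚ.m≤m+n (Y ℕ.* Y) (d ℕ.* (Y ℕ.* Y)))
      (subst (suc d ℕ.* (Y ℕ.* Y) ℕ.≤_) e (ℕₚ.m≤n+m (suc d ℕ.* (Y ℕ.* Y)) (B ℕ.* B))))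

  -- The entry g for d is chosen so that B² + (d + 1) Y² = 4 g has no solution, which a finite
  -- search confirms.
  gap : ℕ → ℕ
  gap 0 = 3
  gap 1 = 5
  gap 2 = 2
  gap 3 = 3
  gap 4 = 2
  gap 5 = 2
  gap 6 = 3
  gap _ = 5

  gap-unsolvable : ∀ d → d ℕ.< 8 → ∀ B Y → ¬ B ℕ.* B ℕ.+ suc d ℕ.* (Y ℕ.* Y) ≡ 4 ℕ.* gap d
  gap-unsolvable 0 _ = unsolvable 12 0 (from-no (solution? 12 1))
  gap-unsolvable 1 _ = unsolvable 20 1 (from-no (solution? 20 2))
  gap-unsolvable 2 _ = unsolvable 8 2 (from-no (solution? 8 3))
  gap-unsolvable 3 _ = unsolvable 12 3 (from-no (solution? 12 4))
  gap-unsolvable 4 _ = unsolvable 8 4 (from-no (solution? 8 5))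
  gap-unsolvable 5 _ = unsolvable 8 5 (from-no (solution? 8 6))
  gap-unsolvable 6 _ = unsolvable 12 6 (from-no (solution? 12 7))
  gap-unsolvable 7 _ = unsolvable 20 7 (from-no (solution? 20 8))
  gap-unsolvable (suc (suc (suc (suc (suc (suc (suc (suc _)))))))) (s≤s (s≤s (s≤s (s≤s (s≤s (s≤s (s≤s (s≤s ()))))))))

  8-not-square : ∀ B → ¬ B ℕ.* B ≡ 8
  8-not-square 0 ()
  8-not-square 1 ()
  8-not-square 2 ()
  8-not-square (suc (suc (suc B))) e = contradiction (subst (9 ℕ.≤_) e (ℕₚ.*-mono-≤ (ℕₚ.m≤m+n 3 B) (ℕₚ.m≤m+n 3 B)))
    (ℕₚ.<⇒≱ (ℕₚ.n<1+n 8))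

-- Vectors of values 1 and n give a solution of B² + |D| Y² = 4 n, so representing 1 and 2 forces |D| ≤ 8; one of 2, 3, 5 is then missed.
unrepresented : ∀ a b c d → + 4 * (a * c) - b * b ≡ + suc d → ∃ (NotRepresented a b c)
unrepresented a b c d disc = one (rep? 1)
  where
  Rep : ℕ → Set
  Rep n = ∃₂ λ x y → val a b c x y ≡ + n × ⊤
  rep? : ∀ n → Dec (Rep n)
  rep? n = represented? a b c d (+ n) disc (λ _ _ → yes tt)
  missed : ∀ n → ¬ Rep n → ∃ (NotRepresented a b c)
  missed n none = n , λ x y v → none (x , y , v , tt)
  pairing : ∀ n → Rep 1 → Rep n → ∃₂ λ B Y → B ℕ.* B ℕ.+ suc d ℕ.* (Y ℕ.* Y) ≡ 4 ℕ.* n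
  pairing n (x , y , v , _) (x′ , y′ , v′ , _) = abs B , abs (x * y′ - x′ * y) ,
    sum-abs d B (x * y′ - x′ * y) (4 ℕ.* n) (trans (polar-norm a b c x y x′ y′ (+ 1) (+ n) (+ suc d) disc v v′)
      (trans (cong (+ 4 *_) (ℤₚ.*-identityˡ (+ n))) (sym (ℤₚ.pos-* 4 n))))
    where
    B = + 2 * a * x * x′ + b * (x * y′ + x′ * y) + + 2 * c * y * y′
  small : ∀ B Y → B ℕ.* B ℕ.+ suc d ℕ.* (Y ℕ.* Y) ≡ 8 → d ℕ.< 8
  small B zero e = ⊥-elim (8-not-square B
    (trans (sym (trans (cong (B ℕ.* B ℕ.+_) (ℕₚ.*-zeroʳ (suc d))) (ℕₚ.+-identityʳ (B ℕ.* B)))) e))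
  small B (suc Y) e = ℕₚ.≤-trans (ℕₚ.m≤m*n (suc d) (suc Y ℕ.* suc Y))
    (subst (suc d ℕ.* (suc Y ℕ.* suc Y) ℕ.≤_) e (ℕₚ.m≤n+m (suc d ℕ.* (suc Y ℕ.* suc Y)) (B ℕ.* B)))
  three : Rep 1 → d ℕ.< 8 → Dec (Rep (gap d)) → ∃ (NotRepresented a b c)
  three _ _ (no none) = missed (gap d) none
  three r₁ l (yes r) = ⊥-elim (absurd (pairing (gap d) r₁ r))
    where
    absurd : (∃₂ λ B Y → B ℕ.* B ℕ.+ suc d ℕ.* (Y ℕ.* Y) ≡ 4 ℕ.* gap d) → ⊥
    absurd (B , Y , e) = gap-unsolvable d l B Y e
  two : Rep 1 → Dec (Rep 2) → ∃ (NotRepresented a b c)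
  two _ (no none) = missed 2 none
  two r₁ (yes r₂) = bound (pairing 2 r₁ r₂)
    where
    bound : (∃₂ λ B Y → B ℕ.* B ℕ.+ suc d ℕ.* (Y ℕ.* Y) ≡ 8) → ∃ (NotRepresented a b c)
    bound (B , Y , e) = three r₁ (small B Y e) (rep? (gap d))
  one : Dec (Rep 1) → ∃ (NotRepresented a b c)
  one (no none) = missed 1 none
  one (yes r₁) = two r₁ (rep? 2)

-- Positive definite forms

private
  positive : ∀ {x} → + 0 < x → ∃ λ n → x ≡ + suc n
  positive {+ zero} (ℤ.+<+ ())
  positive {+ suc n} _ = n , refl

  positive-factor : ∀ n D → + 0 < + suc n * D → ∃ λ d → D ≡ + suc d
  positive-factor n (+ zero) l = contradiction (subst (+ 0 <_) (ℤₚ.*-zeroʳ (+ suc n)) l) λ { (ℤ.+<+ ()) }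
  positive-factor n (+ suc d) _ = d , refl
  positive-factor n -[1+ x ] ()

  val-disc : ∀ a b c → a * ((- b) * (- b)) + b * ((- b) * (+ 2 * a)) + c * ((+ 2 * a) * (+ 2 * a)) ≡ a * (+ 4 * (a * c) - b * b)
  val-disc = solve-∀

-- The value at (- b , 2 a) is a (4 a c - b²), and a is positive as the value at (1 , 0).
positive-discriminant : ∀ a b c → PositiveDefinite (form a b c) → ∃ λ d → + 4 * (a * c) - b * b ≡ + suc d
positive-discriminant a b c pd = fromA (positive (subst (+ 0 <_) (val₁₀ a b c) (pd (+ 1) (+ 0) (λ ()))))
  where
  D = + 4 * (a * c) - b * b
  fromA : (∃ λ n → a ≡ + suc n) → ∃ λ d → D ≡ + suc d
  fromA (n , ea) = positive-factor n D
    (subst (λ z → + 0 < z * D) ea (subst (+ 0 <_) (val-disc a b c) (pd (- b) (+ 2 * a) nonzero)))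
    where
    nonzero : ¬ (- b ≡ + 0 × + 2 * a ≡ + 0)
    nonzero (_ , q) = *≢0 {+ 2} {a} (λ ()) (λ a≡0 → contradiction (trans (sym ea) a≡0) λ ()) q

primitive⇒noCommonPrime : ∀ a b c → Primitive (form a b c) → NoCommonPrime a b c
primitive⇒noCommonPrime a b c prim {L} pL da db dc = prime∤1 pL (∣ᵤ⇒∣ {L} {+ 1} (subst (abs L ℕ∣.∣_) prim
  (ℕGCD.gcd-greatest (ℕGCD.gcd-greatest (∣⇒∣ᵤ da) (∣⇒∣ᵤ db)) (∣⇒∣ᵤ dc))))

theorem1p4 : (Q : BQF) → Primitive Q → PositiveDefinite Q →
    ∀ (k : ℕ) → ∃ λ (n : ℕ) → RepCountPlus Q n k
theorem1p4 (form a b c) prim pd k = fromDisc k (positive-discriminant a b c pd)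
  where
  fromDisc : ∀ k → (∃ λ d → + 4 * (a * c) - b * b ≡ + suc d) → ∃ λ n → RepCountPlus (form a b c) n k
  fromDisc zero (d , disc) = none (unrepresented a b c d disc)
    where
    none : ∃ (NotRepresented a b c) → ∃ λ n → RepCountPlus (form a b c) n 0
    none (n , nr) = n , (λ ()) , (λ ()) , (λ ()) , λ { (x , y) v → ⊥-elim (nr x y v) }
  fromDisc (suc k) (d , disc) = some (realiseForm k d a b c disc (primitive⇒noCommonPrime a b c prim))
    where
    some : Realisable (suc k) a b c → ∃ λ n → RepCountPlus (form a b c) n (suc k)
    -- There is at least one representative, so N is the value of a vector, nonzero because N ≠ 0;
    -- hence N is positive and is a natural number.
    some (N , N≢0 , C) = at (positive (subst (+ 0 <_) (value Fin.zero) (pd (X Fin.zero) (Y Fin.zero) nonzero)))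
      where
      open Count C
      nonzero : ¬ (X Fin.zero ≡ + 0 × Y Fin.zero ≡ + 0)
      nonzero (p , q) = N≢0 (trans (sym (value Fin.zero)) (trans (cong₂ (val a b c) p q) (val₀₀ a b c)))
      at : (∃ λ n → N ≡ + suc n) → ∃ λ n → RepCountPlus (form a b c) n (suc k)
      at (n , e) = suc n , Count⇒RepCountPlus (suc n) prim (λ ()) (subst (λ N → Count a b c N (suc k)) e C)
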